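{- Let $q$ be an indeterminate and for $k\in\mathbb{Z}_{>0}$ put $[k]_q:=1+q+\cdots+q^{k-1}$ (so $[k]_{ -q}=1-q+q^2-\cdots+(-q)^{k-1}$, etc.). With the Coxeter groups and homomorphisms $\phi$ described in the context, and with $U^{W}_{\widehat W}(q):=\sum_{w\in\widehat W}q^{\ell_W(\phi(w))}$ where $\ell_W$ is the length function of $W$ with respect to its Coxeter generators, the following hold: \begin{enumerate} \item For $n\ge 1$ and $\phi:B_n\to A_{2n-1}$, $\phi(r_i)=s_is_{2n-i}$ for $i\neq n$, $\phi(r_n)=s_n$: $\displaystyle U_{B_n}^{A_{2n-1}}(q)=\prod_{k=1}^{2n}[k]_{(-1)^kq}$. \item For $n\ge 1$ and $\phi:B_n\to A_{2n}$, $\phi(r_i)=s_is_{2n+1-i}$ for $i\neq n$, $\phi(r_n)=s_ns_{n+1}s_n$: $\displaystyle U_{B_n}^{A_{2n}}(q)=\prod_{k=1}^{2n+1}[k]_{(-1)^kq}$. \item For $n\ge 2$ and $\phi:B_n\to D_{n+1}$, $\phi(r_i)=s_i$ for $i\neq n$, $\phi(r_n)=s_ns_{n+1}$: $\displaystyle U_{B_n}^{D_{n+1}}(q)=[2]_q[3]_{ -q}[4]_q\prod_{k=3}^{n}\left([2k+1]_q-q^k\right)$. \item For $\phi:I_2(n+1)\to A_n$ with $\phi(r_1)=\prod_{i \text{ odd},\,1\le i\le n}s_i$ and $\phi(r_2)=\prod_{i\text{ even},\,1\le i\le n}s_i$: if $n=2m$ then $U_{I_2(n+1)}^{A_n}(q)=[2]_{q^m}[n+1]_{q^m}$.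 \item In the same setting as (4), if $n=2m-1$ then $U_{I_2(n+1)}^{A_n}(q)=[2]_{q^{m-1}}[2]_{q^m}[m]_{q^n}$. \end{enumerate}
   Context: Coxeter groups used: $A_N$ ($N\ge1$) is generated by $s_1,\dots,s_N$ with $s_i^2=e$, $(s_is_{i+1})^3=e$, and $(s_is_j)^2=e$ for $|i-j|\ge2$ (the symmetric group $S_{N+1}$). $B_n$ is generated by $r_1,\dots,r_n$ with $r_i^2=e$, $(r_ir_{i+1})^3=e$ for $1\le i<n-1$, $(r_{n-1}r_n)^4=e$, and $(r_ir_j)^2=e$ otherwise (for $n=1$, $B_1=\{e,r_1\}$). $D_{n+1}$ ($n\ge2$) is generated by $s_1,\dots,s_{n+1}$ with $s_i^2=e$, $(s_is_{i+1})^3=e$ for $1\le i\le n-2$, $(s_{n-1}s_n)^3=(s_{n-1}s_{n+1})^3=e$, and all other pairs commuting. $I_2(N)$ is the dihedral group generated by $r_1,r_2$ with $r_1^2=r_2^2=(r_1r_2)^N=e$. In each case the stated assignment on generators extends to an injective group homomorphism $\phi$ (the image is a "folding subgroup"); products of commuting generators are written in any order. -}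

module Defs where

open import Data.Nat as ℕ using (ℕ; zero; suc; _≤_; _<?_; _∸_)
open import Data.Nat.Properties as ℕP using ()
open import Data.Integer as ℤ using (ℤ; +_; -_; -[1+_])
open import Data.Fin as Fin using (Fin; inject₁; fromℕ<; fromℕ)
open import Data.Bool using (Bool; true; false; if_then_else_; _xor_)
import Data.Bool
open import Data.Product using (_×_; _,_; ∃; Σ)
open import Data.List as List using (List; []; _∷_; _++_; upTo; map; foldr; length)
open import Data.List.Membership.Propositional using (_∈_)
open import Data.List.Relation.Unary.All using (All)
open import Data.Vec as Vec using (Vec; tabulate; lookup)
open import Relation.Nullary using (does; yes; no)
open import Relation.Binary.PropositionalEquality using (_≡_)

-- Polynomials in an indeterminate q with integer coefficients,
-- represented by their coefficient function (coefficient of q^i).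
-- Equality of polynomials = equality of all coefficients.

Poly : Set
Poly = ℕ → ℤ

_≈P_ : Poly → Poly → Set
p ≈P r = ∀ i → p i ≡ r i

0P : Poly
0P _ = + 0

mono : ℤ → ℕ → Poly
mono c k i = if does (i ℕ.≟ k) then c else + 0

1P : Poly
1P = mono (+ 1) 0

_+P_ : Poly → Poly → Poly
(p +P r) i = p i ℤ.+ r i

_-P_ : Poly → Poly → Poly
(p -P r) i = p i ℤ.- r i

_*P_ : Poly → Poly → Poly
(p *P r) i = foldr ℤ._+_ (+ 0) (map (λ j → p j ℤ.* r (i ∸ j)) (upTo (suc i)))

sumP : List Poly → Poly
sumP = foldr _+P_ 0P

prodP : List Poly → Poly
prodP = foldr _*P_ 1P

fromTo : ℕ → ℕ → List ℕ
fromTo a b = map (a ℕ.+_) (upTo (suc b ∸ a))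

-- qint c m k  =  [k]_{c q^m}  =  Σ_{j<k} (c q^m)^j
qint : ℤ → ℕ → ℕ → Poly
qint c m k = sumP (map (λ j → mono (c ℤ.^ j) (m ℕ.* j)) (upTo k))

qintPow : ℕ → ℕ → Poly
qintPow m k = qint (+ 1) m k

[_]q : ℕ → Poly
[ k ]q = qint (+ 1) 1 k

[_]-q : ℕ → Poly
[ k ]-q = qint (- + 1) 1 k

[_]±q : ℕ → Poly
[ k ]±q = qint ((- + 1) ℤ.^ k) 1 k

module Words {G : Set} (_·_ : G → G → G) (e : G) where

  prod : List G → G
  prod []      = e
  prod (g ∷ w) = g · prod w

  -- x lies in the subgroup generated by S
  -- (all groups here are finite and generated by involutions, so
  --  products of generators suffice)
  Gen : List G → G → Set
  Gen S x = ∃ λ (w : List G) → All (_∈ S) w × prod w ≡ x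

  IsLength : List G → (G → ℕ) → Set
  IsLength S ℓ = ∀ x → Gen S x →
      (∃ λ (w : List G) → All (_∈ S) w × prod w ≡ x × length w ≡ ℓ x)
    × (∀ (w : List G) → All (_∈ S) w → prod w ≡ x → ℓ x ≤ length w)

  U : (G → ℕ) → List G → Poly
  U ℓ L = sumP (map (λ x → mono (+ 1) (ℓ x)) L)

-- A_N = S_{N+1}: permutations of Fin (N+1) in one-line notation.

Perm : ℕ → Set
Perm m = Vec (Fin m) m

idP : ∀ {m} → Perm m
idP = tabulate (λ i → i)

_∘P_ : ∀ {m} → Perm m → Perm m → Perm m
σ ∘P τ = tabulate (λ i → lookup σ (lookup τ i))

transp : ∀ {m} → Fin m → Fin m → Perm m
transp a b = tabulate (λ j →
  if does (j Fin.≟ a) then b else if does (j Fin.≟ b) then a else j)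

-- Coxeter generator s_k (1 ≤ k ≤ N) of A_N, swapping k and k+1
-- (0-based positions k-1, k); identity for out-of-range k (never used).
sA : (N : ℕ) → ℕ → Perm (suc N)
sA N zero = idP
sA N (suc k) with k <? N
... | yes p = transp (inject₁ (fromℕ< p)) (Fin.suc (fromℕ< p))
... | no _  = idP

coxA : (N : ℕ) → List (Perm (suc N))
coxA N = map (sA N) (fromTo 1 N)

-- D_{n+1}: even signed permutations of {1,…,n+1}; w(i) = (j , b)
-- means w(i) = -j if b = true, +j if b = false.

SPerm : ℕ → Set
SPerm m = Vec (Fin m × Bool) m

idS : ∀ {m} → SPerm m
idS = tabulate (λ i → (i , false))

_∘S_ : ∀ {m} → SPerm m → SPerm m → SPerm m
σ ∘S τ = tabulate (λ i → step (lookup τ i))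
  where
  step : _ → _
  step (j , s) with lookup σ j
  ... | (k , t) = (k , s xor t)

liftS : ∀ {m} → Perm m → SPerm m
liftS σ = Vec.map (λ j → (j , false)) σ

stransp : ∀ {m} → Fin m → Fin m → SPerm m
stransp a b = tabulate (λ j →
  if does (j Fin.≟ a) then (b , true)
  else if does (j Fin.≟ b) then (a , true) else (j , false))

-- s_{n+1} of D_{n+1}: n ↦ -(n+1), n+1 ↦ -n (1-based)
sDspecial : (n : ℕ) → SPerm (suc n)
sDspecial zero    = idS
sDspecial (suc n) = stransp (inject₁ (fromℕ n)) (Fin.suc (fromℕ n))

-- Coxeter generators s_1,…,s_{n+1} of D_{n+1}: s_k (k ≤ n) swaps k,k+1;
-- s_{n+1} as above; so s_{n-1} is joined to both s_n and s_{n+1}.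
sD : (n : ℕ) → ℕ → SPerm (suc n)
sD n k with does (k ℕ.≤? n)
... | true  = liftS (sA n k)
... | false = if does (k ℕ.≟ suc n) then sDspecial n else idS

coxD : (n : ℕ) → List (SPerm (suc n))
coxD n = map (sD n) (fromTo 1 (suc n))

foldB-A-odd : (n : ℕ) → List (Perm (suc (2 ℕ.* n ∸ 1)))
foldB-A-odd n =
  map (λ i → sA N i ∘P sA N (2 ℕ.* n ∸ i)) (fromTo 1 (n ∸ 1)) ++ (sA N n ∷ [])
  where N = 2 ℕ.* n ∸ 1

foldB-A-even : (n : ℕ) → List (Perm (suc (2 ℕ.* n)))
foldB-A-even n =
  map (λ i → sA N i ∘P sA N (suc (2 ℕ.* n) ∸ i)) (fromTo 1 (n ∸ 1))
  ++ ((sA N n ∘P (sA N (suc n) ∘P sA N n)) ∷ [])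
  where N = 2 ℕ.* n

foldB-D : (n : ℕ) → List (SPerm (suc n))
foldB-D n =
  map (sD n) (fromTo 1 (n ∸ 1)) ++ ((sD n n ∘S sD n (suc n)) ∷ [])

oddB : ℕ → Bool
oddB zero          = false
oddB (suc zero)    = true
oddB (suc (suc k)) = oddB k

odds evens : ℕ → List ℕ
odds  n = List.filter (λ i → oddB i Data.Bool.≟ true) (fromTo 1 n)
evens n = List.filter (λ i → oddB i Data.Bool.≟ false) (fromTo 1 n)

prodA : (n : ℕ) → List ℕ → Perm (suc n)
prodA n ks = foldr (λ k σ → sA n k ∘P σ) idP ks

dihA₁ dihA₂ : (n : ℕ) → Perm (suc n)
dihA₁ n = prodA n (odds n)
dihA₂ n = prodA n (evens n)

powP : ∀ {m} → Perm m → ℕ → Perm m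
powP σ zero    = idP
powP σ (suc k) = σ ∘P powP σ k

-- The elements of I_2(N) are (r_1 r_2)^k and (r_1 r_2)^k r_1 for
-- 0 ≤ k < N (2N distinct elements).  U^{A_n}_{I_2(n+1)}(q) =
-- Σ_{k<n+1} ( q^{ℓ(φ((r_1r_2)^k))} + q^{ℓ(φ((r_1r_2)^k r_1))} ).
UDih : (n : ℕ) → (Perm (suc n) → ℕ) → Poly
UDih n ℓ = sumP (map (λ k →
    mono (+ 1) (ℓ (powP ρ k)) +P mono (+ 1) (ℓ (powP ρ k ∘P dihA₁ n)))
  (upTo (suc n)))
  where ρ = dihA₁ n ∘P dihA₂ n

{-# OPTIONS --safe #-}

-- In each of (1)–(3) the folding generators satisfy the relations of Bₙ. Multiplying coset
-- representatives of B₁ ⊂ B₂ ⊂ … (the right factors of a palindromic word "flip") gives normal-form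
-- words for all elements, where rₙ has weight b and every other generator weight a, the
-- lengths of their images. Each normal form is completed on the right to the longest element,
-- with total weight equal to the number of inversions (negative roots) of the longest element.
-- As a generator changes that number by at most 1, every normal form is a shortest word:
-- lengths are weights, and comparing the weights of coset representatives shows that the
-- normal forms are distinct. Hence U = ∏ₖ (1 + y xᵏ)[k+1]ₓ over 0 ≤ k < n, with x = qᵃ and
-- y = qᵇ, where (a , b) = (2 , 1), (2 , 3), (1 , 2).
-- In (4) and (5) the alternating words of length n + 1 in r₁, r₂ both give the reversal of
-- 1, …, n + 1, so all shorter alternating words are shortest words by the same counting.
module Submission where

-- The relations of Bₙ rewrite every word into a normal form, but they cannot show that normal forms
-- are shortest or distinct. Both facts come from the ambient group, through a lower bound on the
-- words for one single element. The longest element is the right choice because it is -1 on the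
-- signed coordinates 1, ..., n. It is therefore central, so what completes a coset representative
-- on the left can be moved to the right, and its image makes every pair an inversion (every
-- positive root negative), so the statistic needs evaluating only there and at the identity.
--
-- The relations themselves are verified once, for signed coordinates, and pulled back along a
-- labelling of the points on which the ambient group acts.
--
-- The signs in the products of type A have one source: 1 + q^(2k+1) is 1 + q times [2k+1] at -q,
-- while 1 + q times [k+1] at q² is [2k+2]. So each coset factor is a product of two q-integers of
-- consecutive indices. For D the coset factor (1 + q^(k+2)) [k+1] expands to [2k+3] - q^(k+1)
-- instead.

open import Defs

-- The commutative ring of polynomials given by coefficient functions.

module Polynomials where
  open import Algebra.Bundles using (CommutativeRing)
  open import Data.Bool using (true; false; if_then_else_)
  open import Data.Integer as ℤ using (ℤ; +_; -_)
  import Data.Integer.Properties as ℤ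
  open import Data.Integer.Tactic.RingSolver using (solve-∀)
  open import Data.List using (List; map; foldr; applyUpTo)
  open import Data.List.Properties using (map-applyUpTo; map-upTo)
  open import Data.Nat as ℕ using (ℕ; zero; suc; _∸_)
  open import Data.Product using (_,_)
  open import Function using (_∘_)
  open import Relation.Binary.PropositionalEquality
  open import Level using (0ℓ)

  tail : Poly → Poly
  tail p = p ∘ suc

  -- Convolution by recursion on the degree. The fold in `*P` runs over a list and subtracts
  -- indices, which obstructs induction; the ring laws are proved for `⊛` and transported.
  _⊛_ : Poly → Poly → Poly
  (p ⊛ r) zero    = p 0 ℤ.* r 0
  (p ⊛ r) (suc i) = p 0 ℤ.* r (suc i) ℤ.+ (tail p ⊛ r) i

  -- After the term `j = 0` is split off, all indices are successors and `suc i ∸ suc j` computes to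
  -- `i ∸ j`, which is the fold for `tail p`.
  *P≈⊛ : ∀ p r → (p *P r) ≈P (p ⊛ r)
  *P≈⊛ p r zero = ℤ.+-identityʳ _
  *P≈⊛ p r (suc i) = cong (λ z → p 0 ℤ.* r (suc i) ℤ.+ z) (begin
    sum (map term (applyUpTo suc (suc i)))       ≡⟨ cong sum (map-applyUpTo suc term (suc i)) ⟩
    sum (applyUpTo (term ∘ suc) (suc i))         ≡⟨ cong sum (map-upTo (term ∘ suc) (suc i)) ⟨
    (tail p *P r) i                              ≡⟨ *P≈⊛ (tail p) r i ⟩
    (tail p ⊛ r) i ∎)
    where
    open ≡-Reasoning
    sum = foldr ℤ._+_ (+ 0)
    term = λ j → p j ℤ.* r (suc i ∸ j)

  ⊛-cong : ∀ {p p′ r r′} → p ≈P p′ → r ≈P r′ → (p ⊛ r) ≈P (p′ ⊛ r′)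
  ⊛-cong p≈ r≈ zero    = cong₂ ℤ._*_ (p≈ 0) (r≈ 0)
  ⊛-cong p≈ r≈ (suc i) =
    cong₂ ℤ._+_ (cong₂ ℤ._*_ (p≈ 0) (r≈ (suc i))) (⊛-cong (p≈ ∘ suc) r≈ i)

  ⊛-distribʳ : ∀ p r s → ((r +P s) ⊛ p) ≈P ((r ⊛ p) +P (s ⊛ p))
  ⊛-distribʳ p r s zero    = ℤ.*-distribʳ-+ (p 0) (r 0) (s 0)
  ⊛-distribʳ p r s (suc i) =
    trans (cong₂ ℤ._+_ {x = (r 0 ℤ.+ s 0) ℤ.* p (suc i)} refl (⊛-distribʳ p (tail r) (tail s) i))
      (lemma (r 0) (s 0) (p (suc i)) ((tail r ⊛ p) i) ((tail s ⊛ p) i))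
    where
    lemma : ∀ x y z u v → (x ℤ.+ y) ℤ.* z ℤ.+ (u ℤ.+ v) ≡ x ℤ.* z ℤ.+ u ℤ.+ (y ℤ.* z ℤ.+ v)
    lemma = solve-∀

  -- The mirror image of the defining equation, splitting off the last term instead of the first.
  -- Commutativity follows by matching the two recursions.
  ⊛-suc : ∀ p r i → (p ⊛ r) (suc i) ≡ p (suc i) ℤ.* r 0 ℤ.+ (p ⊛ tail r) i
  ⊛-suc p r zero    = ℤ.+-comm _ (p 1 ℤ.* r 0)
  ⊛-suc p r (suc i) = trans (cong₂ ℤ._+_ {x = p 0 ℤ.* r (suc (suc i))} refl (⊛-suc (tail p) r i))
    (lemma (p 0 ℤ.* r (suc (suc i))) (p (suc (suc i)) ℤ.* r 0) ((tail p ⊛ tail r) i))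
    where
    lemma : ∀ x y z → x ℤ.+ (y ℤ.+ z) ≡ y ℤ.+ (x ℤ.+ z)
    lemma = solve-∀

  ⊛-comm : ∀ p r → (p ⊛ r) ≈P (r ⊛ p)
  ⊛-comm p r zero    = ℤ.*-comm (p 0) (r 0)
  ⊛-comm p r (suc i) = trans (⊛-suc p r i)
    (cong₂ ℤ._+_ (ℤ.*-comm (p (suc i)) (r 0)) (⊛-comm p (tail r) i))

  ⊛-scale : ∀ c p r → ((λ i → c ℤ.* p i) ⊛ r) ≈P (λ i → c ℤ.* (p ⊛ r) i)
  ⊛-scale c p r zero    = ℤ.*-assoc c (p 0) (r 0)
  ⊛-scale c p r (suc i) = trans (cong₂ ℤ._+_ {x = c ℤ.* p 0 ℤ.* r (suc i)} refl (⊛-scale c (tail p) r i))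
    (lemma c (p 0) (r (suc i)) ((tail p ⊛ r) i))
    where
    lemma : ∀ c x y z → c ℤ.* x ℤ.* y ℤ.+ c ℤ.* z ≡ c ℤ.* (x ℤ.* y ℤ.+ z)
    lemma = solve-∀

  ⊛-assoc : ∀ p r s → ((p ⊛ r) ⊛ s) ≈P (p ⊛ (r ⊛ s))
  ⊛-assoc p r s zero    = ℤ.*-assoc (p 0) (r 0) (s 0)
  ⊛-assoc p r s (suc i) = begin
    p 0 ℤ.* r 0 ℤ.* s (suc i) ℤ.+ (((λ j → p 0 ℤ.* tail r j) +P (tail p ⊛ r)) ⊛ s) i
      ≡⟨ cong₂ ℤ._+_ {x = p 0 ℤ.* r 0 ℤ.* s (suc i)} refl (⊛-distribʳ s (λ j → p 0 ℤ.* tail r j) (tail p ⊛ r) i) ⟩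
    p 0 ℤ.* r 0 ℤ.* s (suc i) ℤ.+ (((λ j → p 0 ℤ.* tail r j) ⊛ s) i ℤ.+ ((tail p ⊛ r) ⊛ s) i)
      ≡⟨ cong₂ ℤ._+_ {x = p 0 ℤ.* r 0 ℤ.* s (suc i)} refl (cong₂ ℤ._+_ (⊛-scale (p 0) (tail r) s i) (⊛-assoc (tail p) r s i)) ⟩
    p 0 ℤ.* r 0 ℤ.* s (suc i) ℤ.+ (p 0 ℤ.* (tail r ⊛ s) i ℤ.+ (tail p ⊛ (r ⊛ s)) i)
      ≡⟨ lemma (p 0) (r 0) (s (suc i)) ((tail r ⊛ s) i) ((tail p ⊛ (r ⊛ s)) i) ⟩
    p 0 ℤ.* (r 0 ℤ.* s (suc i) ℤ.+ (tail r ⊛ s) i) ℤ.+ (tail p ⊛ (r ⊛ s)) i ∎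
    where
    open ≡-Reasoning
    lemma : ∀ a b c d e → a ℤ.* b ℤ.* c ℤ.+ (a ℤ.* d ℤ.+ e) ≡ a ℤ.* (b ℤ.* c ℤ.+ d) ℤ.+ e
    lemma = solve-∀

  0⊛ : ∀ r → (0P ⊛ r) ≈P 0P
  0⊛ r zero    = refl
  0⊛ r (suc i) = trans (ℤ.+-identityˡ _) (0⊛ r i)

  mono0⊛ : ∀ c r → (mono c 0 ⊛ r) ≈P (λ i → c ℤ.* r i)
  mono0⊛ c r zero    = refl
  mono0⊛ c r (suc i) = trans (cong₂ ℤ._+_ {x = c ℤ.* r (suc i)} refl (0⊛ r i)) (ℤ.+-identityʳ _)

  mono-cong : ∀ {c d k l} → c ≡ d → k ≡ l → mono c k ≈P mono d l
  mono-cong refl refl i = refl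

  mono⊛mono : ∀ c d k l → (mono c k ⊛ mono d l) ≈P mono (c ℤ.* d) (k ℕ.+ l)
  mono⊛mono c d zero    l i       = trans (mono0⊛ c (mono d l) i) (lemma (does (i ℕ.≟ l)))
    where
    open import Relation.Nullary using (does)
    lemma : ∀ b → c ℤ.* (if b then d else + 0) ≡ (if b then c ℤ.* d else + 0)
    lemma true  = refl
    lemma false = ℤ.*-zeroʳ c
  mono⊛mono c d (suc k) l zero    = refl
  mono⊛mono c d (suc k) l (suc i) = trans (ℤ.+-identityˡ _) (mono⊛mono c d k l i)

  polyRing : CommutativeRing 0ℓ 0ℓ
  polyRing = record
    { Carrier = Poly
    ; _≈_ = _≈P_
    ; _+_ = _+P_
    ; _*_ = _*P_
    ; -_ = λ p i → - p i
    ; 0# = 0P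
    ; 1# = 1P
    ; isCommutativeRing = record
      { isRing = record
        { +-isAbelianGroup = record
          { isGroup = record
            { isMonoid = record
              { isSemigroup = record
                { isMagma = record
                  { isEquivalence = record
                    { refl  = λ i → refl
                    ; sym   = λ p i → sym (p i)
                    ; trans = λ p q i → trans (p i) (q i)
                    }
                  ; ∙-cong = λ p q i → cong₂ ℤ._+_ (p i) (q i)
                  }
                ; assoc = λ p r s i → ℤ.+-assoc (p i) (r i) (s i)
                }
              ; identity = (λ p i → ℤ.+-identityˡ (p i)) , (λ p i → ℤ.+-identityʳ (p i))
              }
            ; inverse = (λ p i → ℤ.+-inverseˡ (p i)) , (λ p i → ℤ.+-inverseʳ (p i))
            ; ⁻¹-cong = λ p i → cong -_ (p i)
            }
          ; comm = λ p r i → ℤ.+-comm (p i) (r i)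
          }
        ; *-cong = cong-*
        ; *-assoc = assoc-*
        ; *-identity = identityˡ , λ p → tr (comm-* p 1P) (identityˡ p)
        ; distrib = (λ p r s → tr (comm-* p (r +P s)) (tr (distribʳ-* p r s)
            (λ i → cong₂ ℤ._+_ (comm-* r p i) (comm-* s p i)))) , distribʳ-*
        }
      ; *-comm = comm-*
      }
    }
    where
    tr : ∀ {p r s : Poly} → p ≈P r → r ≈P s → p ≈P s
    tr x y i = trans (x i) (y i)
    cong-* : ∀ {p p′ r r′} → p ≈P p′ → r ≈P r′ → (p *P r) ≈P (p′ *P r′)
    cong-* {p} {p′} {r} {r′} x y i =
      trans (*P≈⊛ p r i) (trans (⊛-cong x y i) (sym (*P≈⊛ p′ r′ i)))
    comm-* : ∀ p r → (p *P r) ≈P (r *P p)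
    comm-* p r i = trans (*P≈⊛ p r i) (trans (⊛-comm p r i) (sym (*P≈⊛ r p i)))
    assoc-* : ∀ p r s → ((p *P r) *P s) ≈P (p *P (r *P s))
    assoc-* p r s i = begin
      ((p *P r) *P s) i ≡⟨ *P≈⊛ (p *P r) s i ⟩
      ((p *P r) ⊛ s) i  ≡⟨ ⊛-cong {r = s} (*P≈⊛ p r) (λ _ → refl) i ⟩
      ((p ⊛ r) ⊛ s) i   ≡⟨ ⊛-assoc p r s i ⟩
      (p ⊛ (r ⊛ s)) i   ≡⟨ ⊛-cong {p = p} (λ _ → refl) (*P≈⊛ r s) i ⟨
      (p ⊛ (r *P s)) i  ≡⟨ *P≈⊛ p (r *P s) i ⟨
      (p *P (r *P s)) i ∎
      where open ≡-Reasoning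
    identityˡ : ∀ p → (1P *P p) ≈P p
    identityˡ p i = trans (*P≈⊛ 1P p i) (trans (mono0⊛ (+ 1) p i) (ℤ.*-identityˡ (p i)))
    distribʳ-* : ∀ p r s → ((r +P s) *P p) ≈P ((r *P p) +P (s *P p))
    distribʳ-* p r s i = trans (*P≈⊛ (r +P s) p i) (trans (⊛-distribʳ p r s i)
      (sym (cong₂ ℤ._+_ (*P≈⊛ r p i) (*P≈⊛ s p i))))

  mono*mono : ∀ c d k l → (mono c k *P mono d l) ≈P mono (c ℤ.* d) (k ℕ.+ l)
  mono*mono c d k l i = trans (*P≈⊛ (mono c k) (mono d l) i) (mono⊛mono c d k l i)

-- Identities between q-integers in an arbitrary commutative ring.

module GeometricSums where
  open import Algebra.Bundles using (CommutativeRing)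
  open import Data.Nat as ℕ using (ℕ; zero; suc)
  import Data.Nat.Properties as ℕ
  open import Relation.Binary.PropositionalEquality as ≡ using (_≡_)

  module Geometric {c l} (R : CommutativeRing c l) where
    open CommutativeRing R using (Carrier; _≈_; _+_; _*_; -_; 0#; 1#; ring; commutativeSemiring; setoid; refl; sym; trans; +-cong; *-cong; +-congˡ; *-congˡ; +-congʳ; *-congʳ; +-identityʳ; +-identityˡ; -‿inverseʳ; -‿cong; zeroʳ; zeroˡ; reflexive; *-identityˡ; *-identityʳ)
    open import Algebra.Properties.Ring ring using (-‿distribˡ-*; -‿distribʳ-*; -‿involutive)
    open import Algebra.Solver.Ring.NaturalCoefficients.Default commutativeSemiring
    open import Relation.Binary.Reasoning.Setoid setoid

    -x*-x : ∀ x → - x * - x ≈ x * x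
    -x*-x x = trans (sym (-‿distribˡ-* x (- x))) (trans (-‿cong (sym (-‿distribʳ-* x x))) (-‿involutive _))

    pow : Carrier → ℕ → Carrier
    pow x zero    = 1#
    pow x (suc k) = x * pow x k

    -- The q-integer [k] at x, in Horner form.
    geo : Carrier → ℕ → Carrier
    geo x zero    = 0#
    geo x (suc k) = 1# + x * geo x k

    pow-cong : ∀ {x y} k → x ≈ y → pow x k ≈ pow y k
    pow-cong zero    eq = refl
    pow-cong (suc k) eq = *-cong eq (pow-cong k eq)

    geo-cong : ∀ {x y} k → x ≈ y → geo x k ≈ geo y k
    geo-cong zero    eq = refl
    geo-cong (suc k) eq = +-congˡ (*-cong eq (geo-cong k eq))

    geo-+ : ∀ x j k → geo x (j ℕ.+ k) ≈ geo x j + pow x j * geo x k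
    geo-+ x zero    k = sym (trans (+-identityˡ _) (*-identityˡ _))
    geo-+ x (suc j) k = trans (+-congˡ (*-congˡ (geo-+ x j k))) (lemma x (geo x j) (pow x j) (geo x k))
      where
      lemma : ∀ x g p h → 1# + x * (g + p * h) ≈ (1# + x * g) + (x * p) * h
      lemma = solve 4 (λ x g p h → con 1 :+ x :* (g :+ p :* h) := (con 1 :+ x :* g) :+ (x :* p) :* h) refl

    geo-snoc : ∀ x k → geo x (suc k) ≈ geo x k + pow x k
    geo-snoc x k = begin
      geo x (suc k)                        ≡⟨ ≡.cong (geo x) (ℕ.+-comm 1 k) ⟩
      geo x (k ℕ.+ 1)                      ≈⟨ geo-+ x k 1 ⟩
      geo x k + pow x k * (1# + x * 0#)    ≈⟨ lemma x (geo x k) (pow x k) ⟩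
      geo x k + pow x k ∎
      where
      lemma : ∀ x g p → g + p * (1# + x * 0#) ≈ g + p
      lemma = solve 3 (λ x g p → g :+ p :* (con 1 :+ x :* con 0) := g :+ p) refl

    pow-double : ∀ q k → pow q (k ℕ.+ k) ≈ pow (q * q) k
    pow-double q zero    = refl
    pow-double q (suc k) = begin
      q * pow q (k ℕ.+ suc k)     ≡⟨ ≡.cong (λ j → q * pow q j) (ℕ.+-suc k k) ⟩
      q * (q * pow q (k ℕ.+ k))   ≈⟨ *-congˡ (*-congˡ (pow-double q k)) ⟩
      q * (q * pow (q * q) k)     ≈⟨ lemma q (pow (q * q) k) ⟩
      (q * q) * pow (q * q) k     ∎
      where
      lemma : ∀ q p → q * (q * p) ≈ (q * q) * p
      lemma = solve 2 (λ q p → q :* (q :* p) := (q :* q) :* p) refl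

    -- Consecutive powers are grouped in pairs q^(2j) + q^(2j+1) = q^(2j) (1 + q).
    geo-double : ∀ q k → geo q (k ℕ.+ k) ≈ (1# + q) * geo (q * q) k
    geo-double q zero    = sym (zeroʳ _)
    geo-double q (suc k) = begin
      1# + q * geo q (k ℕ.+ suc k)                ≡⟨ ≡.cong (λ j → 1# + q * geo q j) (ℕ.+-suc k k) ⟩
      1# + q * (1# + q * geo q (k ℕ.+ k))
        ≈⟨ +-congˡ (*-congˡ (+-congˡ (*-congˡ (geo-double q k)))) ⟩
      1# + q * (1# + q * ((1# + q) * geo (q * q) k)) ≈⟨ lemma q (geo (q * q) k) ⟩
      (1# + q) * geo (q * q) (suc k) ∎
      where
      lemma : ∀ q g → 1# + q * (1# + q * ((1# + q) * g)) ≈ (1# + q) * (1# + (q * q) * g)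
      lemma = solve 2 (λ q g → con 1 :+ q :* (con 1 :+ q :* ((con 1 :+ q) :* g))
        := (con 1 :+ q) :* (con 1 :+ (q :* q) :* g)) refl

    -- The alternating sum of 2k + 1 powers telescopes against 1 + q, leaving 1 + q^(2k+1). This is
    -- the origin of the q-integers at -q in the theorem.
    geo-alternating : ∀ q k → (1# + q) * geo (- q) (suc (k ℕ.+ k)) ≈ 1# + q * pow (q * q) k
    geo-alternating q zero    = lemma q (- q)
      where
      lemma : ∀ q m → (1# + q) * (1# + m * 0#) ≈ 1# + q * 1#
      lemma = solve 2 (λ q m → (con 1 :+ q) :* (con 1 :+ m :* con 0) := con 1 :+ q :* con 1) refl
    geo-alternating q (suc k) = begin
      (1# + q) * (1# + - q * geo (- q) (suc (k ℕ.+ suc k)))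
        ≡⟨ ≡.cong (λ j → (1# + q) * (1# + - q * geo (- q) (suc j))) (ℕ.+-suc k k) ⟩
      (1# + q) * (1# + - q * (1# + - q * g))
        ≈⟨ lemma₁ q (- q) g ⟩
      1# + (q + - q) + q * - q + (- q * - q) * ((1# + q) * g)
        ≈⟨ +-cong (+-congʳ (+-congˡ (-‿inverseʳ q))) (*-cong (-x*-x q) (geo-alternating q k)) ⟩
      1# + 0# + q * - q + (q * q) * (1# + q * p)
        ≈⟨ lemma₂ q (- q) p ⟩
      1# + q * ((q * q) * p) + q * (q + - q)
        ≈⟨ +-congˡ (trans (*-congˡ (-‿inverseʳ q)) (zeroʳ q)) ⟩
      1# + q * ((q * q) * p) + 0#
        ≈⟨ +-identityʳ _ ⟩
      1# + q * ((q * q) * p) ∎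
      where
      g = geo (- q) (suc (k ℕ.+ k))
      p = pow (q * q) k
      -- The solver knows semirings only, so `- q` enters as a variable `m`; `q + m ≈ 0` and
      -- `m * m ≈ q * q` are applied by hand between the solver calls.
      lemma₁ : ∀ q m g → (1# + q) * (1# + m * (1# + m * g)) ≈ 1# + (q + m) + q * m + (m * m) * ((1# + q) * g)
      lemma₁ = solve 3 (λ q m g → (con 1 :+ q) :* (con 1 :+ m :* (con 1 :+ m :* g))
        := con 1 :+ (q :+ m) :+ q :* m :+ (m :* m) :* ((con 1 :+ q) :* g)) refl
      lemma₂ : ∀ q m p → 1# + 0# + q * m + (q * q) * (1# + q * p) ≈ 1# + q * ((q * q) * p) + q * (q + m)
      lemma₂ = solve 3 (λ q m p → con 1 :+ con 0 :+ q :* m :+ (q :* q) :* (con 1 :+ q :* p)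
        := con 1 :+ q :* ((q :* q) :* p) :+ q :* (q :+ m)) refl

    -- The sum of q^weight over the coset representatives of B_k in B_{k+1}, for x = qᵃ and y = qᵇ.
    cosetSum : Carrier → Carrier → ℕ → Carrier
    cosetSum x y k = (1# + y * pow x k) * geo x (suc k)

    -- The three summands are the three kinds of words in `cosets (suc k)`: the empty one, those of
    -- `cosets k` with one more letter of weight x, and `flip (suc k)`, whose weight is y x^(2k+2).
    cosetSum-suc : ∀ x y k → 1# + cosetSum x y k * x + y * (pow x (suc k) * pow x (suc k)) ≈ cosetSum x y (suc k)
    cosetSum-suc x y k = begin
      1# + (1# + y * p) * g * x + y * ((x * p) * (x * p))   ≈⟨ lemma₁ x y p g ⟩
      (1# + x * g) + y * (x * p) * (g + x * p)
        ≈⟨ +-congˡ (*-congˡ (geo-snoc x (suc k))) ⟨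
      (1# + x * g) + y * (x * p) * (1# + x * g)             ≈⟨ lemma₂ (1# + x * g) (y * (x * p)) ⟩
      cosetSum x y (suc k) ∎
      where
      p = pow x k
      g = geo x (suc k)
      lemma₁ : ∀ x y p g → 1# + (1# + y * p) * g * x + y * ((x * p) * (x * p))
        ≈ (1# + x * g) + y * (x * p) * (g + x * p)
      lemma₁ = solve 4 (λ x y p g → con 1 :+ (con 1 :+ y :* p) :* g :* x :+ y :* ((x :* p) :* (x :* p))
        := (con 1 :+ x :* g) :+ y :* (x :* p) :* (g :+ x :* p)) refl
      lemma₂ : ∀ a b → a + b * a ≈ (1# + b) * a
      lemma₂ = solve 2 (λ a b → a :+ b :* a := (con 1 :+ b) :* a) refl

    -- The Poincaré polynomial of B_k with unequal parameters: y for the generator at the end of the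
    -- fourfold bond, x for the others.
    poincare : Carrier → Carrier → ℕ → Carrier
    poincare x y zero    = 1#
    poincare x y (suc k) = cosetSum x y k * poincare x y k

    poincare-cong : ∀ {x x′ y y′} k → x ≈ x′ → y ≈ y′ → poincare x y k ≈ poincare x′ y′ k
    poincare-cong zero    x≈ y≈ = refl
    poincare-cong (suc k) x≈ y≈ = *-cong
      (*-cong (+-congˡ (*-cong y≈ (pow-cong k x≈))) (geo-cong (suc k) x≈))
      (poincare-cong k x≈ y≈)

    -- The first factor 1 + q^(2k+1) gives up a factor 1 + q, which turns [k+1] at q² into [2k+2] at
    -- q. For `cosetSum-even` the exponent is 2k + 3 and the same exchange applies.
    cosetSum-odd : ∀ q k → cosetSum (q * q) q k ≈ geo (- q) (suc (k ℕ.+ k)) * geo q (suc k ℕ.+ suc k)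
    cosetSum-odd q k = begin
      (1# + q * pow (q * q) k) * g                 ≈⟨ *-congʳ (geo-alternating q k) ⟨
      (1# + q) * h * g                             ≈⟨ lemma q h g ⟩
      h * ((1# + q) * g)                           ≈⟨ *-congˡ (geo-double q (suc k)) ⟨
      h * geo q (suc k ℕ.+ suc k) ∎
      where
      g = geo (q * q) (suc k)
      h = geo (- q) (suc (k ℕ.+ k))
      lemma : ∀ q h g → (1# + q) * h * g ≈ h * ((1# + q) * g)
      lemma = solve 3 (λ q h g → (con 1 :+ q) :* h :* g := h :* ((con 1 :+ q) :* g)) refl

    cosetSum-even : ∀ q k → cosetSum (q * q) (q * (q * q)) k
      ≈ geo q (suc k ℕ.+ suc k) * geo (- q) (suc (suc k ℕ.+ suc k))
    cosetSum-even q k = begin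
      (1# + q * (q * q) * p) * g                   ≈⟨ lemma₁ q p g ⟩
      (1# + q * (q * q * p)) * g                   ≈⟨ *-congʳ (geo-alternating q (suc k)) ⟨
      (1# + q) * h * g                             ≈⟨ lemma₂ q h g ⟩
      ((1# + q) * g) * h                           ≈⟨ *-congʳ (geo-double q (suc k)) ⟨
      geo q (suc k ℕ.+ suc k) * h ∎
      where
      p = pow (q * q) k
      g = geo (q * q) (suc k)
      h = geo (- q) (suc (suc k ℕ.+ suc k))
      lemma₁ : ∀ q p g → (1# + q * (q * q) * p) * g ≈ (1# + q * (q * q * p)) * g
      lemma₁ = solve 3 (λ q p g → (con 1 :+ q :* (q :* q) :* p) :* g := (con 1 :+ q :* (q :* q :* p)) :* g) refl
      lemma₂ : ∀ q h g → (1# + q) * h * g ≈ ((1# + q) * g) * h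
      lemma₂ = solve 3 (λ q h g → (con 1 :+ q) :* h :* g := ((con 1 :+ q) :* g) :* h) refl

    -- In [k+1] + q^(k+1) (q [k+1]) the bracket is [k+2] - 1. The two sums then join to [2k+3], and
    -- the -1 contributes -q^(k+1).
    cosetSum-D : ∀ q k → cosetSum q (q * q) k ≈ geo q (suc (suc k ℕ.+ suc k)) + - pow q (suc k)
    cosetSum-D q k = begin
      (1# + q * q * p) * g                                ≈⟨ lemma₁ q p g ⟩
      g + q * p * (q * g) + 0#                            ≈⟨ +-congˡ (-‿inverseʳ (q * p)) ⟨
      g + q * p * (q * g) + (q * p + - (q * p))           ≈⟨ lemma₂ q p g (- (q * p)) ⟩
      g + q * p * (1# + q * g) + - (q * p)                ≈⟨ +-congʳ (geo-+ q (suc k) (suc (suc k))) ⟨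
      geo q (suc k ℕ.+ suc (suc k)) + - (q * p)
        ≡⟨ ≡.cong (λ j → geo q j + - (q * p)) (ℕ.+-suc (suc k) (suc k)) ⟩
      geo q (suc (suc k ℕ.+ suc k)) + - (q * p) ∎
      where
      p = pow q k
      g = geo q (suc k)
      lemma₁ : ∀ q p g → (1# + q * q * p) * g ≈ g + q * p * (q * g) + 0#
      lemma₁ = solve 3 (λ q p g → (con 1 :+ q :* q :* p) :* g := g :+ q :* p :* (q :* g) :+ con 0) refl
      lemma₂ : ∀ q p g m → g + q * p * (q * g) + (q * p + m) ≈ g + q * p * (1# + q * g) + m
      lemma₂ = solve 4 (λ q p g m → g :+ q :* p :* (q :* g) :+ (q :* p :+ m)
        := g :+ q :* p :* (con 1 :+ q :* g) :+ m) refl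

    -- Rank 2 is special because its factors recombine across the two cosets: (1 + q)(1 + q²) is
    -- [4], and 1 + q³ is [2] times [3] at -q.
    poincare-D₂ : ∀ q → poincare q (q * q) 2 ≈ geo q 2 * (geo (- q) 3 * geo q 4)
    poincare-D₂ q = begin
      cosetSum q (q * q) 1 * (cosetSum q (q * q) 0 * 1#)              ≈⟨ lemma₁ q ⟩
      (1# + q * (q * q * 1#)) * geo q 4
        ≈⟨ *-congʳ (geo-alternating q 1) ⟨
      (1# + q) * geo (- q) 3 * geo q 4                                ≈⟨ lemma₂ q (geo (- q) 3) ⟩
      geo q 2 * (geo (- q) 3 * geo q 4) ∎
      where
      lemma₁ : ∀ q → (1# + q * q * (q * 1#)) * (1# + q * (1# + q * 0#)) * ((1# + q * q * 1#) * (1# + q * 0#) * 1#) ≈ (1# + q * (q * q * 1#)) * (1# + q * (1# + q * (1# + q * (1# + q * 0#))))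
      lemma₁ = solve 1 (λ q → (con 1 :+ q :* q :* (q :* con 1)) :* (con 1 :+ q :* (con 1 :+ q :* con 0)) :* ((con 1 :+ q :* q :* con 1) :* (con 1 :+ q :* con 0) :* con 1)
        := (con 1 :+ q :* (q :* q :* con 1)) :* (con 1 :+ q :* (con 1 :+ q :* (con 1 :+ q :* (con 1 :+ q :* con 0))))) refl
      lemma₂ : ∀ q h → (1# + q) * h * (1# + q * (1# + q * (1# + q * (1# + q * 0#))))
        ≈ (1# + q * (1# + q * 0#)) * (h * (1# + q * (1# + q * (1# + q * (1# + q * 0#)))))
      lemma₂ = solve 2 (λ q h → (con 1 :+ q) :* h :* (con 1 :+ q :* (con 1 :+ q :* (con 1 :+ q :* (con 1 :+ q :* con 0))))
        := (con 1 :+ q :* (con 1 :+ q :* con 0)) :* (h :* (con 1 :+ q :* (con 1 :+ q :* (con 1 :+ q :* (con 1 :+ q :* con 0)))))) refl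

-- Normal-form words for Bₙ, derived from its relations alone.

module CosetWords where
  open import Data.Empty using (⊥-elim)
  open import Data.List using (List; []; _∷_; _++_; map; [_]; _∷ʳ_; reverse; cartesianProductWith)
  open import Data.List.Properties using (unfold-reverse)
  open import Data.List.Membership.Propositional using (_∈_)
  open import Data.List.Membership.Propositional.Properties using (∈-++⁺ˡ; ∈-++⁺ʳ; ∈-++⁻; ∈-map⁺; ∈-map⁻; ∈-cartesianProductWith⁺; ∈-cartesianProductWith⁻)
  open import Data.List.Relation.Unary.All as All using (All; []; _∷_)
  import Data.List.Relation.Unary.All.Properties as All
  open import Data.List.Relation.Unary.Any using (here; there)
  open import Data.Nat using (ℕ; zero; suc; _+_; _*_; _≤_; _<_; z≤n; s≤s; s≤s⁻¹)
  open import Data.Nat.Properties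
  open import Data.Product using (_×_; _,_; ∃)
  open import Data.Sum using (_⊎_; inj₁; inj₂)
  open import Function using (_∘_)
  open import Relation.Binary.PropositionalEquality hiding ([_])
  open import Data.Nat.Tactic.RingSolver using (solve-∀)

  -- Letter 0 stands for rₙ and letter i for rₙ₋ᵢ, so that the letters below k generate the
  -- parabolic subgroup B_k. The word is k ... 1 0 1 ... k, the sign change of coordinate k + 1.
  flip : ℕ → List ℕ
  flip zero    = [ 0 ]
  flip (suc k) = suc k ∷ (flip k ∷ʳ suc k)

  mutual
    cosets : ℕ → List (List ℕ)
    cosets k = [] ∷ (middle k ∷ʳ flip k)

    middle : ℕ → List (List ℕ)
    middle zero    = []
    middle (suc k) = map (_∷ʳ suc k) (cosets k)

  elements : ℕ → List (List ℕ)
  elements zero    = [ [] ]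
  elements (suc k) = cartesianProductWith _++_ (cosets k) (elements k)

  -- The product of all the sign changes, hence -1 on k coordinates.
  longest : ℕ → List ℕ
  longest zero    = []
  longest (suc k) = flip k ++ longest k

  -- Membership in `cosets` as an inductive view, so that statements about representatives are
  -- proved by pattern matching rather than by list membership.
  data IsCoset : ℕ → List ℕ → Set where
    nil  : ∀ {k} → IsCoset k []
    snoc : ∀ {k c} → IsCoset k c → IsCoset (suc k) (c ∷ʳ suc k)
    top  : ∀ {k} → IsCoset k (flip k)

  IsCoset⇒∈ : ∀ {k c} → IsCoset k c → c ∈ cosets k
  IsCoset⇒∈ nil      = here refl
  IsCoset⇒∈ (snoc c) = there (∈-++⁺ˡ (∈-map⁺ _ (IsCoset⇒∈ c)))
  IsCoset⇒∈ {k} top  = there (∈-++⁺ʳ (middle k) (here refl))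

  ∈⇒IsCoset : ∀ k {c} → c ∈ cosets k → IsCoset k c
  ∈⇒IsCoset k (here refl) = nil
  ∈⇒IsCoset k (there c∈) with ∈-++⁻ (middle k) c∈
  ... | inj₂ (here refl) = top
  ∈⇒IsCoset (suc k) (there c∈) | inj₁ c∈′ with ∈-map⁻ _ c∈′
  ... | _ , d∈ , refl = snoc (∈⇒IsCoset k d∈)

  flip-letters : ∀ k → All (_≤ k) (flip k)
  flip-letters zero    = ≤-refl ∷ []
  flip-letters (suc k) = ≤-refl ∷ All.∷ʳ⁺ (All.map m≤n⇒m≤1+n (flip-letters k)) ≤-refl

  coset-letters : ∀ {k c} → IsCoset k c → All (_≤ k) c
  coset-letters nil      = []
  coset-letters (snoc c) = All.∷ʳ⁺ (All.map m≤n⇒m≤1+n (coset-letters c)) ≤-refl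
  coset-letters {k} top  = flip-letters k

  longest-letters : ∀ k → All (_< k) (longest k)
  longest-letters zero    = []
  longest-letters (suc k) =
    All.++⁺ (All.map s≤s (flip-letters k)) (All.map m<n⇒m<1+n (longest-letters k))

  element-view : ∀ k {w} → w ∈ elements (suc k) →
    ∃ λ c → ∃ λ u → IsCoset k c × u ∈ elements k × w ≡ c ++ u
  element-view k w∈ with ∈-cartesianProductWith⁻ _++_ (cosets k) (elements k) w∈
  ... | c , u , c∈ , u∈ , eq = c , u , ∈⇒IsCoset k c∈ , u∈ , eq

  mk-element : ∀ k {c u} → IsCoset k c → u ∈ elements k → c ++ u ∈ elements (suc k)
  mk-element k c u∈ = ∈-cartesianProductWith⁺ _++_ (IsCoset⇒∈ c) u∈

  element-letters : ∀ k {w} → w ∈ elements k → All (_< k) w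
  element-letters zero    (here refl) = []
  element-letters (suc k) w∈ with element-view k w∈
  ... | c , u , c-coset , u∈ , refl =
    All.++⁺ (All.map s≤s (coset-letters c-coset)) (All.map m<n⇒m<1+n (element-letters k u∈))

  []∈elements : ∀ k → [] ∈ elements k
  []∈elements zero    = here refl
  []∈elements (suc k) = mk-element k nil ([]∈elements k)

  module Weights (a b : ℕ) where
    weight : ℕ → ℕ
    weight zero    = b
    weight (suc _) = a

    wt : List ℕ → ℕ
    wt []      = 0
    wt (i ∷ w) = weight i + wt w

    wt-++ : ∀ u v → wt (u ++ v) ≡ wt u + wt v
    wt-++ []      v = refl
    wt-++ (i ∷ u) v = trans (cong (weight i +_) (wt-++ u v)) (sym (+-assoc (weight i) _ _))

    wt-∷ʳ : ∀ u k → wt (u ∷ʳ suc k) ≡ wt u + a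
    wt-∷ʳ u k = trans (wt-++ u [ suc k ]) (cong (wt u +_) (+-identityʳ a))

    wt-flip : ∀ k → wt (flip (suc k)) ≡ a + (wt (flip k) + a)
    wt-flip k = cong (a +_) (wt-∷ʳ (flip k) k)

    wt-flip-total : ∀ k → wt (flip k) ≡ b + a * (k + k)
    wt-flip-total zero    = cong (b +_) (sym (*-zeroʳ a))
    wt-flip-total (suc k) = trans (wt-flip k) (trans (cong (λ w → a + (w + a)) (wt-flip-total k)) (lemma a b k))
      where
      lemma : ∀ a b k → a + (b + a * (k + k) + a) ≡ b + a * (suc k + suc k)
      lemma = solve-∀

    wt≤flip : ∀ {k c} → IsCoset k c → wt c ≤ wt (flip k)
    wt≤flip nil = z≤n
    wt≤flip top = ≤-refl
    wt≤flip (snoc {k} {c} d) = subst₂ _≤_ (sym (wt-∷ʳ c k)) (sym (wt-flip k))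
      (m≤n⇒m≤o+n a (+-monoˡ-≤ a (wt≤flip d)))

    -- The weights increase strictly along the list of cosets.
    wt-injective : 1 ≤ a → 1 ≤ b → ∀ {k c d} → IsCoset k c → IsCoset k d → wt c ≡ wt d → c ≡ d
    wt-injective 1≤a 1≤b = inj
      where
      flip-pos : ∀ k → 0 < wt (flip k)
      flip-pos zero    = m≤n⇒m≤n+o 0 1≤b
      flip-pos (suc k) = m≤n⇒m≤n+o _ 1≤a
      snoc-pos : ∀ c k → 0 < wt (c ∷ʳ suc k)
      snoc-pos c k = subst (0 <_) (sym (wt-∷ʳ c k)) (m≤n⇒m≤o+n (wt c) 1≤a)
      snoc<flip : ∀ {k c} → IsCoset k c → wt (c ∷ʳ suc k) < wt (flip (suc k))
      snoc<flip {k} {c} d = subst₂ _<_ (sym (wt-∷ʳ c k)) (sym (wt-flip k))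
        (<-≤-trans (n<1+n _) (+-mono-≤ 1≤a (+-monoˡ-≤ a (wt≤flip d))))
      inj : ∀ {k c d} → IsCoset k c → IsCoset k d → wt c ≡ wt d → c ≡ d
      inj nil          nil          eq = refl
      inj nil          (snoc {k} {d} _) eq = ⊥-elim (<⇒≢ (snoc-pos d k) eq)
      inj {k} nil      top          eq = ⊥-elim (<⇒≢ (flip-pos k) eq)
      inj (snoc {k} {c} _) nil      eq = ⊥-elim (<⇒≢ (snoc-pos c k) (sym eq))
      inj (snoc {k} {c} x) (snoc {c = d} y) eq = cong (_∷ʳ suc k) (inj x y
        (+-cancelʳ-≡ a _ _ (trans (sym (wt-∷ʳ c k)) (trans eq (wt-∷ʳ d k)))))
      inj (snoc x)     top          eq = ⊥-elim (<⇒≢ (snoc<flip x) eq)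
      inj {k} top      nil          eq = ⊥-elim (<⇒≢ (flip-pos k) (sym eq))
      inj top          (snoc y)     eq = ⊥-elim (<⇒≢ (snoc<flip y) (sym eq))
      inj top          top          eq = refl

  module Action {X : Set} (t : ℕ → X → X) where
    act : List ℕ → X → X
    act []      x = x
    act (i ∷ w) x = t i (act w x)

    act-++ : ∀ u v x → act (u ++ v) x ≡ act u (act v x)
    act-++ []      v x = refl
    act-++ (i ∷ u) v x = cong (t i) (act-++ u v x)

    -- The relations are stated for an action on a set. They then apply at any place inside a word
    -- without reassociating products.
    module Relations (n : ℕ)
      (square  : ∀ {i} → i < n → ∀ x → t i (t i x) ≡ x)
      (commute : ∀ {i j} → suc i < j → j < n → ∀ x → t i (t j x) ≡ t j (t i x))
      (braid   : ∀ {i} → 2 + i < n → ∀ x →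
        t (1 + i) (t (2 + i) (t (1 + i) x)) ≡ t (2 + i) (t (1 + i) (t (2 + i) x)))
      (braid₄  : 1 < n → ∀ x → t 0 (t 1 (t 0 (t 1 x))) ≡ t 1 (t 0 (t 1 (t 0 x))))
      where
      open ≡-Reasoning

      act-reverse : ∀ {w} → All (_< n) w → ∀ x → act (reverse w) (act w x) ≡ x
      act-reverse [] x = refl
      act-reverse {i ∷ w} (i<n ∷ w<n) x = begin
        act (reverse (i ∷ w)) (t i (act w x))
          ≡⟨ cong (λ v → act v (t i (act w x))) (unfold-reverse i w) ⟩
        act (reverse w ∷ʳ i) (t i (act w x))      ≡⟨ act-++ (reverse w) [ i ] _ ⟩
        act (reverse w) (t i (t i (act w x)))     ≡⟨ cong (act (reverse w)) (square i<n _) ⟩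
        act (reverse w) (act w x)                 ≡⟨ act-reverse w<n x ⟩
        x ∎

      act-commute : ∀ {w j} → j < n → All (λ i → suc i < j) w → ∀ x → t j (act w x) ≡ act w (t j x)
      act-commute j<n []         x = refl
      act-commute j<n (i<j ∷ w<) x =
        trans (sym (commute i<j j<n _)) (cong (t _) (act-commute j<n w< x))

      act-flip : ∀ k x → act (flip (suc k)) x ≡ t (suc k) (act (flip k) (t (suc k) x))
      act-flip k x = cong (t (suc k)) (act-++ (flip k) [ suc k ] x)

      letters-far : ∀ {k w} → All (_≤ k) w → All (λ i → suc i < suc (suc k)) w
      letters-far = All.map (λ i≤k → s≤s (s≤s i≤k))

      -- The sign change of coordinate k + 1 commutes with B_k. A letter not adjacent to k passes
      -- the two outer letters and reduces to a shorter flip; the adjacent one needs a braid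
      -- relation.
      flip-commute : ∀ {i} k → k < n → i < k → ∀ x → t i (act (flip k) x) ≡ act (flip k) (t i x)
      flip-commute {i} (suc k) k<n i<k x with m≤n⇒m<n∨m≡n (s≤s⁻¹ i<k)
      ... | inj₁ i<k′ = begin
        t i (act (flip (suc k)) x)                    ≡⟨ cong (t i) (act-flip k x) ⟩
        t i (t (suc k) (act (flip k) (t (suc k) x)))  ≡⟨ commute (s≤s i<k′) k<n _ ⟩
        t (suc k) (t i (act (flip k) (t (suc k) x)))
          ≡⟨ cong (t (suc k)) (flip-commute k (<⇒≤ k<n) i<k′ _) ⟩
        t (suc k) (act (flip k) (t i (t (suc k) x)))
          ≡⟨ cong (t (suc k) ∘ act (flip k)) (commute (s≤s i<k′) k<n x) ⟩
        t (suc k) (act (flip k) (t (suc k) (t i x)))  ≡⟨ act-flip k (t i x) ⟨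
        act (flip (suc k)) (t i x) ∎
      -- 0 · 1 0 1 = 1 0 1 · 0 is precisely the relation of order four.
      flip-commute (suc zero)    k<n i<k x | inj₂ refl = braid₄ k<n x
      -- The braid relation on the left turns `t₁ t₂ t₁` into `t₂ t₁ t₂`. Its last `t₂` commutes
      -- with all letters of `g` and enters a second braid on the right.
      flip-commute (suc (suc k)) k<n i<k x | inj₂ refl = begin
        t₁ (act (flip (suc (suc k))) x)     ≡⟨ cong t₁ (unfold x) ⟩
        t₁ (t₂ (t₁ (g (t₁ (t₂ x)))))        ≡⟨ braid k<n _ ⟩
        t₂ (t₁ (t₂ (g (t₁ (t₂ x)))))
          ≡⟨ cong (t₂ ∘ t₁) (act-commute k<n (letters-far (flip-letters k)) _) ⟩
        t₂ (t₁ (g (t₂ (t₁ (t₂ x)))))        ≡⟨ cong (t₂ ∘ t₁ ∘ g) (braid k<n x) ⟨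
        t₂ (t₁ (g (t₁ (t₂ (t₁ x)))))        ≡⟨ unfold (t₁ x) ⟨
        act (flip (suc (suc k))) (t₁ x)     ∎
        where
        t₁ = t (suc k)
        t₂ = t (suc (suc k))
        g = act (flip k)
        unfold : ∀ y → act (flip (suc (suc k))) y ≡ t₂ (t₁ (g (t₁ (t₂ y))))
        unfold y = trans (act-flip (suc k) y) (cong t₂ (act-flip k (t₂ y)))

      -- Deodhar's lemma for these representatives: a generator times `c` is another representative,
      -- or else `c` times a generator of the parabolic subgroup. It makes `elements` closed under
      -- left multiplication.
      coset-step : ∀ {k c i} → k < n → IsCoset k c → i ≤ k →
        (∃ λ d → IsCoset k d × (∀ x → t i (act c x) ≡ act d x)) ⊎
        (∃ λ j → j < k × (∀ x → t i (act c x) ≡ act c (t j x)))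
      coset-step k<n c i≤k with m≤n⇒m<n∨m≡n i≤k
      coset-step         k<n nil i≤k | inj₁ i<k  = inj₂ (_ , i<k , λ x → refl)
      coset-step {zero}  k<n nil i≤k | inj₂ refl = inj₁ (_ , top , λ x → refl)
      coset-step {suc k} k<n nil i≤k | inj₂ refl = inj₁ (_ , snoc nil , λ x → refl)
      coset-step {k}     k<n top i≤k | inj₁ i<k  = inj₂ (_ , i<k , flip-commute k k<n i<k)
      coset-step {zero}  k<n top i≤k | inj₂ refl = inj₁ (_ , nil , square k<n)
      coset-step {suc k} k<n top i≤k | inj₂ refl = inj₁ (_ , snoc top , λ x → square k<n _)
      coset-step {suc k} {i = i} k<n (snoc {c = c} c-coset) _ | inj₁ i<k
        with coset-step (<⇒≤ k<n) c-coset (s≤s⁻¹ i<k)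
      ... | inj₁ (d , d-coset , eq) = inj₁ (_ , snoc d-coset , λ x →
        trans (cong (t i) (act-++ c _ x)) (trans (eq _) (sym (act-++ d _ x))))
      ... | inj₂ (j , j<k , eq) = inj₂ (j , m<n⇒m<1+n j<k , λ x → begin
        t i (act (c ∷ʳ suc k) x)      ≡⟨ cong (t i) (act-++ c _ x) ⟩
        t i (act c (t (suc k) x))     ≡⟨ eq _ ⟩
        act c (t j (t (suc k) x))     ≡⟨ cong (act c) (commute (s≤s j<k) k<n x) ⟩
        act c (t (suc k) (t j x))     ≡⟨ act-++ c _ (t j x) ⟨
        act (c ∷ʳ suc k) (t j x) ∎)
      coset-step k<n (snoc nil) _ | inj₂ refl = inj₁ (_ , nil , square k<n)
      coset-step k<n (snoc top) _ | inj₂ refl = inj₁ (_ , top , λ x → refl)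
      -- The letter k + 2 passes `c`, whose letters are at most k. Then (k+2)(k+1)(k+2) =
      -- (k+1)(k+2)(k+1) restores the representative and leaves k + 1 on its right.
      coset-step {suc (suc k)} k<n (snoc (snoc {c = c} c-coset)) _ | inj₂ refl =
        inj₂ (suc k , ≤-refl , λ x → begin
        t₂ (act ((c ∷ʳ suc k) ∷ʳ suc (suc k)) x)      ≡⟨ cong t₂ (unfold x) ⟩
        t₂ (act c (t₁ (t₂ x)))
          ≡⟨ act-commute k<n (letters-far (coset-letters c-coset)) _ ⟩
        act c (t₂ (t₁ (t₂ x)))                        ≡⟨ cong (act c) (braid k<n x) ⟨
        act c (t₁ (t₂ (t₁ x)))                        ≡⟨ unfold (t₁ x) ⟨
        act ((c ∷ʳ suc k) ∷ʳ suc (suc k)) (t₁ x) ∎)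
        where
        t₁ = t (suc k)
        t₂ = t (suc (suc k))
        unfold : ∀ y → act ((c ∷ʳ suc k) ∷ʳ suc (suc k)) y ≡ act c (t₁ (t₂ y))
        unfold y = trans (act-++ (c ∷ʳ suc k) _ y) (act-++ c _ (t₂ y))

      element-step : ∀ {k u i} → k ≤ n → u ∈ elements k → i < k →
        ∃ λ v → v ∈ elements k × (∀ x → t i (act u x) ≡ act v x)
      element-step {suc k} {i = i} k<n u∈ i<k with element-view k u∈
      ... | c , u , c-coset , u∈ , refl with coset-step k<n c-coset (s≤s⁻¹ i<k)
      ...   | inj₁ (d , d-coset , eq) = d ++ u , mk-element k d-coset u∈ , λ x →
        trans (cong (t i) (act-++ c u x)) (trans (eq _) (sym (act-++ d u x)))
      ...   | inj₂ (j , j<k , eq) with element-step (<⇒≤ k<n) u∈ j<k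
      ...     | v , v∈ , eq′ = c ++ v , mk-element k c-coset v∈ , λ x → begin
        t i (act (c ++ u) x)      ≡⟨ cong (t i) (act-++ c u x) ⟩
        t i (act c (act u x))     ≡⟨ eq _ ⟩
        act c (t j (act u x))     ≡⟨ cong (act c) (eq′ x) ⟩
        act c (act v x)           ≡⟨ act-++ c v x ⟨
        act (c ++ v) x ∎

      normalise : ∀ {k w} → k ≤ n → All (_< k) w → ∃ λ v → v ∈ elements k × (∀ x → act w x ≡ act v x)
      normalise {k} k≤n [] = [] , []∈elements k , λ x → refl
      normalise k≤n (i<k ∷ w<k) with normalise k≤n w<k
      ... | v , v∈ , eq with element-step k≤n v∈ i<k
      ...   | v′ , v′∈ , eq′ = v′ , v′∈ , λ x → trans (cong (t _) (eq x)) (eq′ x)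

      flip-comm-word : ∀ {w} k → k < n → All (_< k) w → ∀ x → act w (act (flip k) x) ≡ act (flip k) (act w x)
      flip-comm-word k k<n []          x = refl
      flip-comm-word k k<n (i<k ∷ w<k) x =
        trans (cong (t _) (flip-comm-word k k<n w<k x)) (flip-commute k k<n i<k _)

      longest-central : ∀ {i} k → k ≤ n → i < k → ∀ x → t i (act (longest k) x) ≡ act (longest k) (t i x)
      longest-central {i} (suc k) k<n i<k x with m≤n⇒m<n∨m≡n (s≤s⁻¹ i<k)
      ... | inj₁ i<k′ = begin
        t i (act (flip k ++ longest k) x)       ≡⟨ cong (t i) (act-++ (flip k) _ x) ⟩
        t i (act (flip k) (act (longest k) x))  ≡⟨ flip-commute k k<n i<k′ _ ⟩
        act (flip k) (t i (act (longest k) x))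
          ≡⟨ cong (act (flip k)) (longest-central k (<⇒≤ k<n) i<k′ x) ⟩
        act (flip k) (act (longest k) (t i x))  ≡⟨ act-++ (flip k) _ (t i x) ⟨
        act (flip k ++ longest k) (t i x) ∎
      longest-central (suc zero)    k<n i<k x | inj₂ refl = refl
      -- Conjugation by `s` exchanges the last two sign changes: `f′` is `s f s`. Since `f` and `f′`
      -- commute, `s` passes their product.
      longest-central (suc (suc k)) k<n i<k x | inj₂ refl = begin
        s (act (longest (2 + k)) x)             ≡⟨ cong s (unfold x) ⟩
        s (f′ (f (w x)))
          ≡⟨ cong s (flip-comm-word (suc k) k<n (All.map s≤s (flip-letters k)) _) ⟨
        s (f (f′ (w x)))                        ≡⟨ cong (s ∘ f) (act-flip k (w x)) ⟩
        s (f (s (f (s (w x)))))                 ≡⟨ act-flip k (f (s (w x))) ⟨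
        f′ (f (s (w x)))
          ≡⟨ cong (f′ ∘ f) (act-commute k<n (All.map s≤s (longest-letters k)) x) ⟩
        f′ (f (w (s x)))                        ≡⟨ unfold (s x) ⟨
        act (longest (2 + k)) (s x) ∎
        where
        s = t (suc k)
        f = act (flip k)
        f′ = act (flip (suc k))
        w = act (longest k)
        unfold : ∀ y → act (longest (2 + k)) y ≡ f′ (f (w y))
        unfold y = trans (act-++ (flip (suc k)) _ y) (cong f′ (act-++ (flip k) _ y))

      longest-central-word : ∀ {w} k → k ≤ n → All (_< k) w → ∀ x →
        act w (act (longest k) x) ≡ act (longest k) (act w x)
      longest-central-word k k<n []          x = refl
      longest-central-word k k<n (i<k ∷ w<k) x =
        trans (cong (t _) (longest-central-word k k<n w<k x)) (longest-central k k<n i<k _)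

      module _ (a b : ℕ) where
        open Weights a b

        -- As `c` is a right factor of `flip k`, the word `p` is the left part that remains.
        coset-complement : ∀ {k c} → IsCoset k c →
          ∃ λ p → All (_≤ k) p × (∀ x → act p (act c x) ≡ act (flip k) x) × wt p + wt c ≡ wt (flip k)
        coset-complement {k} nil = flip k , flip-letters k , (λ x → refl) , +-identityʳ _
        coset-complement top = [] , [] , (λ x → refl) , refl
        coset-complement (snoc {k} {c} d) with coset-complement d
        ... | p , p≤k , eq , sum = suc k ∷ p , ≤-refl ∷ All.map m≤n⇒m≤1+n p≤k , eq′ , sum′
          where
          eq′ : ∀ x → t (suc k) (act p (act (c ∷ʳ suc k) x)) ≡ act (flip (suc k)) x
          eq′ x = trans (cong (t (suc k)) (trans (cong (act p) (act-++ c _ x)) (eq _))) (sym (act-flip k x))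
          lemma : ∀ a p c → a + p + (c + a) ≡ a + ((p + c) + a)
          lemma = solve-∀
          sum′ : a + wt p + wt (c ∷ʳ suc k) ≡ wt (flip (suc k))
          sum′ = begin
            a + wt p + wt (c ∷ʳ suc k)  ≡⟨ cong (a + wt p +_) (wt-∷ʳ c k) ⟩
            a + wt p + (wt c + a)       ≡⟨ lemma a (wt p) (wt c) ⟩
            a + ((wt p + wt c) + a)     ≡⟨ cong (λ z → a + (z + a)) sum ⟩
            a + (wt (flip k) + a)       ≡⟨ wt-flip k ⟨
            wt (flip (suc k)) ∎

        -- If p c is the top coset then p (c u s) is the longest element, which is central,
        -- so p can be moved to the right of c u s.
        complement : ∀ {k u} → k ≤ n → u ∈ elements k →
          ∃ λ s → All (_< k) s × (∀ x → act u (act s x) ≡ act (longest k) x) × wt u + wt s ≡ wt (longest k)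
        complement {zero} k≤n (here refl) = [] , [] , (λ x → refl) , refl
        complement {suc k} k<n u∈ with element-view k u∈
        ... | c , u , c-coset , u∈ , refl with complement (<⇒≤ k<n) u∈ | coset-complement c-coset
        ...   | s , s<k , us≡ , sum | p , p≤k , pc≡ , sum′ =
          s ++ p , All.++⁺ (All.map m<n⇒m<1+n s<k) p<k , eq , sum″
          where
          p<k = All.map s≤s p≤k
          w = act (longest (suc k))
          p⁻¹ = act (reverse p)
          cus : ∀ x → act p (act c (act u (act s x))) ≡ w x
          cus x = begin
            act p (act c (act u (act s x)))    ≡⟨ pc≡ _ ⟩
            act (flip k) (act u (act s x))     ≡⟨ cong (act (flip k)) (us≡ x) ⟩
            act (flip k) (act (longest k) x)   ≡⟨ act-++ (flip k) _ x ⟨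
            w x ∎
          cancel : ∀ y → p⁻¹ (act p y) ≡ y
          cancel = act-reverse (All.map (λ i<k → ≤-trans i<k k<n) p<k)
          eq : ∀ x → act (c ++ u) (act (s ++ p) x) ≡ w x
          eq x = begin
            act (c ++ u) (act (s ++ p) x)               ≡⟨ act-++ c u _ ⟩
            act c (act u (act (s ++ p) x))              ≡⟨ cong (act c ∘ act u) (act-++ s p x) ⟩
            act c (act u (act s (act p x)))             ≡⟨ cancel _ ⟨
            p⁻¹ (act p (act c (act u (act s (act p x))))) ≡⟨ cong p⁻¹ (cus (act p x)) ⟩
            p⁻¹ (w (act p x))
              ≡⟨ cong p⁻¹ (longest-central-word (suc k) k<n p<k x) ⟨
            p⁻¹ (act p (w x))                           ≡⟨ cancel _ ⟩
            w x ∎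
          lemma : ∀ c u s p → c + u + (s + p) ≡ (p + c) + (u + s)
          lemma = solve-∀
          sum″ : wt (c ++ u) + wt (s ++ p) ≡ wt (flip k ++ longest k)
          sum″ = begin
            wt (c ++ u) + wt (s ++ p)             ≡⟨ cong₂ _+_ (wt-++ c u) (wt-++ s p) ⟩
            wt c + wt u + (wt s + wt p)           ≡⟨ lemma (wt c) (wt u) (wt s) (wt p) ⟩
            (wt p + wt c) + (wt u + wt s)         ≡⟨ cong₂ _+_ sum′ sum ⟩
            wt (flip k) + wt (longest k)          ≡⟨ wt-++ (flip k) (longest k) ⟨
            wt (flip k ++ longest k) ∎

-- Sums of monomials over normal forms and over dihedral elements.

module GeneratingFunctions where
  open import Algebra.Bundles using (CommutativeRing)
  open import Data.List using (List; []; _∷_; _++_; map; _∷ʳ_; cartesianProductWith; foldr; upTo; applyUpTo)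
  open import Data.List.Properties using (map-applyUpTo; map-upTo; upTo-∷ʳ; map-++)
  open import Data.List.Relation.Binary.Permutation.Propositional.Properties using (map⁺)
  open import Data.List.Membership.Propositional using (_∈_)
  open import Data.List.Relation.Binary.Permutation.Propositional using (_↭_; prep; swap)
  open import Data.List.Relation.Unary.Any using (here; there)
  open import Data.Nat as ℕ using (ℕ; zero; suc; _∸_)
  import Data.Nat.Properties as ℕ
  open import Function using (_∘_)
  open import Relation.Binary.PropositionalEquality as ≡ using (_≡_)
  open GeometricSums
  open CosetWords

  module Sums {c l} (R : CommutativeRing c l) where
    open CommutativeRing R
    open Geometric R
    open import Algebra.Solver.Ring.NaturalCoefficients.Default commutativeSemiring
    open import Relation.Binary.Reasoning.Setoid setoid

    sum : List Carrier → Carrier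
    sum = foldr _+_ 0#

    product : List Carrier → Carrier
    product = foldr _*_ 1#

    product-++ : ∀ xs ys → product (xs ++ ys) ≈ product xs * product ys
    product-++ []       ys = sym (*-identityˡ _)
    product-++ (x ∷ xs) ys = trans (*-congˡ (product-++ xs ys)) (sym (*-assoc x _ _))

    sum-↭ : ∀ {xs ys} → xs ↭ ys → sum xs ≈ sum ys
    sum-↭ _↭_.refl        = refl
    sum-↭ (prep x p)      = +-congˡ (sum-↭ p)
    sum-↭ (swap x y p)    = trans (+-congˡ (+-congˡ (sum-↭ p)))
      (trans (sym (+-assoc x y _)) (trans (+-congʳ (+-comm x y)) (+-assoc y x _)))
    sum-↭ (_↭_.trans p q) = trans (sum-↭ p) (sum-↭ q)

    sum-geo : ∀ x (s : ℕ → Carrier) → s 0 ≈ 1# → (∀ j → s (suc j) ≈ x * s j) →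
      ∀ k → sum (map s (upTo k)) ≈ geo x k
    sum-geo x s s-0 s-suc k =
      trans (reflexive (≡.cong sum (map-upTo s k))) (trans (go k s s-suc) (trans (*-congʳ s-0) (*-identityˡ _)))
      where
      step : ∀ u g x → u + x * u * g ≈ u * (1# + x * g)
      step = solve 3 (λ u g x → u :+ x :* u :* g := u :* (con 1 :+ x :* g)) refl
      go : ∀ k (f : ℕ → Carrier) → (∀ j → f (suc j) ≈ x * f j) → sum (applyUpTo f k) ≈ f 0 * geo x k
      go zero    f f-suc = sym (zeroʳ _)
      go (suc k) f f-suc = trans (+-congˡ (trans (go k (f ∘ suc) (f-suc ∘ suc)) (*-congʳ (f-suc 0))))
        (step (f 0) (geo x k) x)

    -- `X k` plays the role of q^k; only the exponent law is used, so the computation takes place in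
    -- any commutative ring.
    module Monomials (X : ℕ → Carrier) (X-0 : X 0 ≈ 1#) (X-+ : ∀ k l → X (k ℕ.+ l) ≈ X k * X l) where

      X-cong : ∀ {k l} → k ≡ l → X k ≈ X l
      X-cong ≡.refl = refl

      gf : {A : Set} → (A → ℕ) → List A → Carrier
      gf f xs = sum (map (λ x → X (f x)) xs)

      gf-++ : {A : Set} (f : A → ℕ) (xs ys : List A) → gf f (xs ++ ys) ≈ gf f xs + gf f ys
      gf-++ f []       ys = sym (+-identityˡ _)
      gf-++ f (x ∷ xs) ys = trans (+-congˡ (gf-++ f xs ys)) (sym (+-assoc _ _ _))

      gf-cong : {A : Set} {f g : A → ℕ} (xs : List A) → (∀ {x} → x ∈ xs → f x ≡ g x) → gf f xs ≈ gf g xs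
      gf-cong []       eq = refl
      gf-cong (x ∷ xs) eq = +-cong (X-cong (eq (here ≡.refl))) (gf-cong xs (eq ∘ there))

      gf-map : {A B : Set} (f : B → ℕ) (h : A → B) (xs : List A) → gf f (map h xs) ≈ gf (f ∘ h) xs
      gf-map f h []       = refl
      gf-map f h (x ∷ xs) = +-congˡ (gf-map f h xs)

      gf-shift : {A : Set} (f : A → ℕ) (k : ℕ) (xs : List A) → gf (λ x → k ℕ.+ f x) xs ≈ X k * gf f xs
      gf-shift f k []       = sym (zeroʳ _)
      gf-shift f k (x ∷ xs) = trans (+-cong (X-+ k (f x)) (gf-shift f k xs)) (sym (distribˡ _ _ _))

      gf-product : {A B C : Set} (f : A → ℕ) (g : B → ℕ) (h : C → ℕ) (_∙_ : A → B → C) →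
        (∀ x y → h (x ∙ y) ≡ f x ℕ.+ g y) → ∀ xs ys →
        gf h (cartesianProductWith _∙_ xs ys) ≈ gf f xs * gf g ys
      gf-product f g h _∙_ hom []       ys = sym (zeroˡ _)
      gf-product f g h _∙_ hom (x ∷ xs) ys = begin
        gf h (map (x ∙_) ys ++ cartesianProductWith _∙_ xs ys)          ≈⟨ gf-++ h (map (x ∙_) ys) _ ⟩
        gf h (map (x ∙_) ys) + gf h (cartesianProductWith _∙_ xs ys)
          ≈⟨ +-cong (gf-map h (x ∙_) ys) (gf-product f g h _∙_ hom xs ys) ⟩
        gf (λ y → h (x ∙ y)) ys + gf f xs * gf g ys
          ≈⟨ +-congʳ (trans (gf-cong ys (λ _ → hom x _)) (gf-shift g (f x) ys)) ⟩
        X (f x) * gf g ys + gf f xs * gf g ys                           ≈⟨ distribʳ (gf g ys) _ _ ⟨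
        gf f (x ∷ xs) * gf g ys ∎

      pow-X : ∀ a k → pow (X a) k ≈ X (a ℕ.* k)
      pow-X a zero    = trans (sym X-0) (X-cong (≡.sym (ℕ.*-zeroʳ a)))
      pow-X a (suc k) = trans (*-congˡ (pow-X a k))
        (trans (sym (X-+ a (a ℕ.* k))) (X-cong (≡.sym (ℕ.*-suc a k))))

      module _ (a b : ℕ) where
        open Weights a b
        private
          x = X a
          y = X b

        X-flip : ∀ k → X (wt (flip k)) ≈ y * (pow x k * pow x k)
        X-flip zero    = trans (X-cong (ℕ.+-identityʳ b))
          (sym (trans (*-congˡ (*-identityˡ 1#)) (*-identityʳ y)))
        X-flip (suc k) = begin
          X (wt (flip (suc k)))                       ≈⟨ X-cong (wt-flip k) ⟩
          X (a ℕ.+ (wt (flip k) ℕ.+ a))               ≈⟨ trans (X-+ a _) (*-congˡ (X-+ _ a)) ⟩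
          x * (X (wt (flip k)) * x)                   ≈⟨ *-congˡ (*-congʳ (X-flip k)) ⟩
          x * ((y * (pow x k * pow x k)) * x)         ≈⟨ lemma x y (pow x k) ⟩
          y * (pow x (suc k) * pow x (suc k)) ∎
          where
          lemma : ∀ x y p → x * ((y * (p * p)) * x) ≈ y * ((x * p) * (x * p))
          lemma = solve 3 (λ x y p → x :* ((y :* (p :* p)) :* x) := y :* ((x :* p) :* (x :* p))) refl

        mutual
          gf-cosets : ∀ k → gf wt (cosets k) ≈ cosetSum x y k
          gf-cosets zero    = begin
            X 0 + (X (b ℕ.+ 0) + 0#)
              ≈⟨ +-cong X-0 (+-congʳ (X-cong (ℕ.+-identityʳ b))) ⟩
            1# + (y + 0#)                               ≈⟨ lemma x y ⟩
            cosetSum x y 0 ∎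
            where
            lemma : ∀ x y → 1# + (y + 0#) ≈ (1# + y * 1#) * (1# + x * 0#)
            lemma = solve 2 (λ x y → con 1 :+ (y :+ con 0) := (con 1 :+ y :* con 1) :* (con 1 :+ x :* con 0)) refl
          gf-cosets (suc k) = begin
            X 0 + gf wt (middle (suc k) ∷ʳ flip (suc k))
              ≈⟨ +-cong X-0 (gf-++ wt (middle (suc k)) _) ⟩
            1# + (gf wt (middle (suc k)) + (X (wt (flip (suc k))) + 0#))
              ≈⟨ +-congˡ (+-cong (gf-middle k) (trans (+-identityʳ _) (X-flip (suc k)))) ⟩
            1# + (cosetSum x y k * x + y * (pow x (suc k) * pow x (suc k)))  ≈⟨ +-assoc _ _ _ ⟨
            1# + cosetSum x y k * x + y * (pow x (suc k) * pow x (suc k))    ≈⟨ cosetSum-suc x y k ⟩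
            cosetSum x y (suc k) ∎

          gf-middle : ∀ k → gf wt (middle (suc k)) ≈ cosetSum x y k * x
          gf-middle k = begin
            gf wt (map (_∷ʳ suc k) (cosets k))            ≈⟨ gf-map wt _ (cosets k) ⟩
            gf (λ c → wt (c ∷ʳ suc k)) (cosets k)
              ≈⟨ gf-cong (cosets k) (λ {c} _ → ≡.trans (wt-∷ʳ c k) (ℕ.+-comm _ a)) ⟩
            gf (λ c → a ℕ.+ wt c) (cosets k)              ≈⟨ gf-shift wt a (cosets k) ⟩
            x * gf wt (cosets k)                          ≈⟨ *-comm x _ ⟩
            gf wt (cosets k) * x                          ≈⟨ *-congʳ (gf-cosets k) ⟩
            cosetSum x y k * x ∎

        gf-elements : ∀ k → gf wt (elements k) ≈ poincare x y k
        gf-elements zero    = trans (+-identityʳ _) X-0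
        gf-elements (suc k) = trans
          (gf-product wt wt wt _++_ wt-++ (cosets k) (elements k))
          (*-cong (gf-cosets k) (gf-elements k))

        -- The list of group elements in the theorem is arbitrary apart from its members, so it is
        -- compared with the normal forms up to order only.
        gf-enumeration : {A : Set} (f : A → ℕ) (ev : List ℕ → A) (n : ℕ) {L : List A} →
          L ↭ map ev (elements n) → (∀ {w} → w ∈ elements n → f (ev w) ≡ wt w) →
          gf f L ≈ poincare x y n
        gf-enumeration f ev n {L} L↭ f≡ = begin
          gf f L                          ≈⟨ sum-↭ (map⁺ (λ x → X (f x)) L↭) ⟩
          gf f (map ev (elements n))      ≈⟨ gf-map f ev (elements n) ⟩
          gf (f ∘ ev) (elements n)        ≈⟨ gf-cong (elements n) f≡ ⟩
          gf wt (elements n)              ≈⟨ gf-elements n ⟩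
          poincare x y n ∎

    product-∷ʳ : ∀ xs x → product (xs ∷ʳ x) ≈ product xs * x
    product-∷ʳ xs x = trans (product-++ xs (x ∷ [])) (*-congˡ (*-identityʳ x))

    product-upTo : ∀ (f : ℕ → Carrier) (g : ℕ → ℕ) m →
      product (map f (map g (upTo (suc m)))) ≈ product (map f (map g (upTo m))) * f (g m)
    product-upTo f g m = trans
      (reflexive (≡.cong product (≡.trans (≡.cong (map f ∘ map g) (≡.sym (upTo-∷ʳ m)))
        (≡.trans (≡.cong (map f) (map-++ g (upTo m) (m ∷ []))) (map-++ f (map g (upTo m)) (g m ∷ []))))))
      (product-∷ʳ (map f (map g (upTo m))) (f (g m)))

    -- The factors with indices 2k + 1 and 2k + 2 together are the coset factor of B_k in B_(k+1).
    product-odd : ∀ q (f : ℕ → Carrier) →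
      (∀ k → f (suc (k ℕ.+ k)) ≈ geo (- q) (suc (k ℕ.+ k))) →
      (∀ k → f (suc k ℕ.+ suc k) ≈ geo q (suc k ℕ.+ suc k)) →
      ∀ k → product (map f (fromTo 1 (k ℕ.+ k))) ≈ poincare (q * q) q k
    product-odd q f f-odd f-even zero    = refl
    product-odd q f f-odd f-even (suc k) = begin
      product (map f (fromTo 1 (suc k ℕ.+ suc k)))
        ≡⟨ ≡.cong (λ m → product (map f (fromTo 1 (suc m)))) (ℕ.+-suc k k) ⟩
      product (map f (fromTo 1 (suc (suc (k ℕ.+ k)))))
        ≈⟨ trans (product-upTo f suc (suc (k ℕ.+ k))) (*-congʳ (product-upTo f suc (k ℕ.+ k))) ⟩
      p * f (suc (k ℕ.+ k)) * f (suc (suc (k ℕ.+ k)))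
        ≈⟨ *-cong (*-cong (product-odd q f f-odd f-even k) (f-odd k)) (reflexive (≡.cong (λ m → f (suc m)) (≡.sym (ℕ.+-suc k k)))) ⟩
      poincare (q * q) q k * geo (- q) (suc (k ℕ.+ k)) * f (suc k ℕ.+ suc k)
        ≈⟨ trans (*-assoc _ _ _) (trans (*-comm _ _) (*-congʳ (*-congˡ (f-even k)))) ⟩
      geo (- q) (suc (k ℕ.+ k)) * geo q (suc k ℕ.+ suc k) * poincare (q * q) q k
        ≈⟨ *-congʳ (cosetSum-odd q k) ⟨
      poincare (q * q) q (suc k) ∎
      where p = product (map f (fromTo 1 (k ℕ.+ k)))

    -- Here [1] = 1 stands alone and the pairs are shifted by one: indices 2k + 2 and 2k + 3.
    product-even : ∀ q (f : ℕ → Carrier) →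
      (∀ k → f (suc (k ℕ.+ k)) ≈ geo (- q) (suc (k ℕ.+ k))) →
      (∀ k → f (suc k ℕ.+ suc k) ≈ geo q (suc k ℕ.+ suc k)) →
      ∀ k → product (map f (fromTo 1 (suc (k ℕ.+ k)))) ≈ poincare (q * q) (q * (q * q)) k
    product-even q f f-odd f-even zero    =
      trans (*-identityʳ _) (trans (f-odd 0) (trans (+-congˡ (zeroʳ _)) (+-identityʳ 1#)))
    product-even q f f-odd f-even (suc k) = begin
      product (map f (fromTo 1 (suc (suc k ℕ.+ suc k))))
        ≈⟨ product-upTo f suc (suc k ℕ.+ suc k) ⟩
      product (map f (fromTo 1 (suc k ℕ.+ suc k))) * f (suc (suc k ℕ.+ suc k))
        ≡⟨ ≡.cong (λ m → product (map f (fromTo 1 (suc m))) * f (suc (suc k ℕ.+ suc k))) (ℕ.+-suc k k) ⟩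
      product (map f (fromTo 1 (suc (suc (k ℕ.+ k))))) * f (suc (suc k ℕ.+ suc k))
        ≈⟨ *-congʳ (product-upTo f suc (suc (k ℕ.+ k))) ⟩
      p * f (suc (suc (k ℕ.+ k))) * f (suc (suc k ℕ.+ suc k))
        ≈⟨ *-cong (*-cong (product-even q f f-odd f-even k)
             (trans (reflexive (≡.cong (λ m → f (suc m)) (≡.sym (ℕ.+-suc k k)))) (f-even k))) (f-odd (suc k)) ⟩
      poincare (q * q) (q * (q * q)) k * geo q (suc k ℕ.+ suc k) * geo (- q) (suc (suc k ℕ.+ suc k))
        ≈⟨ trans (*-assoc _ _ _) (*-comm _ _) ⟩
      geo q (suc k ℕ.+ suc k) * geo (- q) (suc (suc k ℕ.+ suc k)) * poincare (q * q) (q * (q * q)) k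
        ≈⟨ *-congʳ (cosetSum-even q k) ⟨
      poincare (q * q) (q * (q * q)) (suc k) ∎
      where p = product (map f (fromTo 1 (suc (k ℕ.+ k))))

    -- The three leading q-integers account for rank 2; from there on each factor of the product is
    -- one coset sum.
    product-D : ∀ q (f : ℕ → Carrier) → (∀ k → f k ≈ geo q (suc (k ℕ.+ k)) + - pow q k) →
      ∀ m → geo q 2 * (geo (- q) 3 * (geo q 4 * product (map f (fromTo 3 (2 ℕ.+ m))))) ≈ poincare q (q * q) (2 ℕ.+ m)
    product-D q f f≈ zero    = trans (*-congˡ (*-congˡ (*-identityʳ _))) (sym (poincare-D₂ q))
    product-D q f f≈ (suc m) = begin
      u * (v * (w * product (map f (fromTo 3 (3 ℕ.+ m)))))
        ≈⟨ *-congˡ (*-congˡ (*-congˡ (product-upTo f (3 ℕ.+_) m))) ⟩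
      u * (v * (w * (p * f (3 ℕ.+ m))))                     ≈⟨ lemma u v w p (f (3 ℕ.+ m)) ⟩
      f (3 ℕ.+ m) * (u * (v * (w * p)))
        ≈⟨ *-cong (trans (f≈ (3 ℕ.+ m)) (sym (cosetSum-D q (2 ℕ.+ m)))) (product-D q f f≈ m) ⟩
      poincare q (q * q) (3 ℕ.+ m) ∎
      where
      u = geo q 2
      v = geo (- q) 3
      w = geo q 4
      p = product (map f (fromTo 3 (2 ℕ.+ m)))
      lemma : ∀ u v w p g → u * (v * (w * (p * g))) ≈ g * (u * (v * (w * p)))
      lemma = solve 5 (λ u v w p g → u :* (v :* (w :* (p :* g))) := g :* (u :* (v :* (w :* p)))) refl

    Σ< : ℕ → (ℕ → Carrier) → Carrier
    Σ< n f = sum (map f (upTo n))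

    Σ<-suc : ∀ n f → Σ< (suc n) f ≈ f 0 + Σ< n (f ∘ suc)
    Σ<-suc n f = +-congˡ (reflexive (≡.cong sum
      (≡.trans (map-applyUpTo suc f n) (≡.sym (map-upTo (f ∘ suc) n)))))

    Σ<-+ : ∀ m n f → Σ< (m ℕ.+ n) f ≈ Σ< m f + Σ< n (λ i → f (m ℕ.+ i))
    Σ<-+ zero    n f = sym (+-identityˡ _)
    Σ<-+ (suc m) n f = begin
      Σ< (suc m ℕ.+ n) f                                          ≈⟨ Σ<-suc (m ℕ.+ n) f ⟩
      f 0 + Σ< (m ℕ.+ n) (f ∘ suc)                                ≈⟨ +-congˡ (Σ<-+ m n (f ∘ suc)) ⟩
      f 0 + (Σ< m (f ∘ suc) + Σ< n (λ i → f (suc m ℕ.+ i)))       ≈⟨ +-assoc _ _ _ ⟨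
      f 0 + Σ< m (f ∘ suc) + Σ< n (λ i → f (suc m ℕ.+ i))         ≈⟨ +-congʳ (Σ<-suc m f) ⟨
      Σ< (suc m) f + Σ< n (λ i → f (suc m ℕ.+ i)) ∎

    Σ<-cong : ∀ n {f g : ℕ → Carrier} → (∀ {i} → i ℕ.< n → f i ≈ g i) → Σ< n f ≈ Σ< n g
    Σ<-cong zero    eq = refl
    Σ<-cong (suc n) {f} {g} eq = trans (Σ<-suc n f)
      (trans (+-cong (eq ℕ.z<s) (Σ<-cong n (eq ∘ ℕ.s<s))) (sym (Σ<-suc n g)))

    Σ<-reverse : ∀ n f → Σ< n (λ i → f (n ∸ suc i)) ≈ Σ< n f
    Σ<-reverse zero    f = refl
    Σ<-reverse (suc n) f = begin
      Σ< (suc n) (λ i → f (n ∸ i))            ≈⟨ Σ<-suc n (λ i → f (n ∸ i)) ⟩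
      f n + Σ< n (λ i → f (n ∸ suc i))
        ≈⟨ +-cong (reflexive (≡.cong f (≡.sym (ℕ.+-identityʳ n)))) (Σ<-reverse n f) ⟩
      f (n ℕ.+ 0) + Σ< n f                    ≈⟨ trans (+-comm _ _) (+-congˡ (sym (+-identityʳ _))) ⟩
      Σ< n f + Σ< 1 (λ i → f (n ℕ.+ i))       ≈⟨ Σ<-+ n 1 f ⟨
      Σ< (n ℕ.+ 1) f                          ≡⟨ ≡.cong (λ m → Σ< m f) (ℕ.+-comm n 1) ⟩
      Σ< (suc n) f ∎

    Σ<-geo : ∀ z y (f : ℕ → Carrier) → (∀ k → f k ≈ pow z k * y) → ∀ n → Σ< n f ≈ geo z n * y
    Σ<-geo z y f f≈ zero    = sym (zeroˡ y)
    Σ<-geo z y f f≈ (suc n) = begin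
      Σ< (suc n) f                            ≈⟨ Σ<-suc n f ⟩
      f 0 + Σ< n (f ∘ suc)
        ≈⟨ +-cong (f≈ 0) (Σ<-geo z (z * y) (f ∘ suc) (λ k → trans (f≈ (suc k)) (lemma₁ z (pow z k) y)) n) ⟩
      1# * y + geo z n * (z * y)              ≈⟨ lemma₂ z (geo z n) y ⟩
      geo z (suc n) * y ∎
      where
      lemma₁ : ∀ z p y → z * p * y ≈ p * (z * y)
      lemma₁ = solve 3 (λ z p y → z :* p :* y := p :* (z :* y)) refl
      lemma₂ : ∀ z g y → 1# * y + g * (z * y) ≈ (1# + z * g) * y
      lemma₂ = solve 3 (λ z g y → con 1 :* y :+ g :* (z :* y) := (con 1 :+ z :* g) :* y) refl

    -- With u = q^m, the first summand lists each of u⁰, ..., u^(2m+1) once and the second each of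
    -- u¹, ..., u^(2m) once.
    dihedral-even : ∀ u m →
      geo (u * u) (suc m) * (1# + u) + geo (u * u) m * (u * u + u) ≈ geo u 2 * geo u (suc (m ℕ.+ m))
    dihedral-even u m = begin
      (1# + u * u * g) * (1# + u) + g * (u * u + u)           ≈⟨ lemma u g ⟩
      (1# + u * (1# + u * 0#)) * (1# + u * ((1# + u) * g))
        ≈⟨ *-congˡ (+-congˡ (*-congˡ (geo-double u m))) ⟨
      geo u 2 * geo u (suc (m ℕ.+ m)) ∎
      where
      g = geo (u * u) m
      lemma : ∀ u g → (1# + u * u * g) * (1# + u) + g * (u * u + u)
        ≈ (1# + u * (1# + u * 0#)) * (1# + u * ((1# + u) * g))
      lemma = solve 2 (λ u g → (con 1 :+ u :* u :* g) :* (con 1 :+ u) :+ g :* (u :* u :+ u)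
        := (con 1 :+ u :* (con 1 :+ u :* con 0)) :* (con 1 :+ u :* ((con 1 :+ u) :* g))) refl

    dihedral-odd : ∀ u v z g → z ≈ u * v → g * (1# + u) + g * (z + v) ≈ geo v 2 * (geo u 2 * g)
    dihedral-odd u v z g z≈ = trans (+-congˡ (*-congˡ (+-congʳ z≈))) (lemma u v g)
      where
      lemma : ∀ u v g → g * (1# + u) + g * (u * v + v) ≈ (1# + v * (1# + v * 0#)) * ((1# + u * (1# + u * 0#)) * g)
      lemma = solve 3 (λ u v g → g :* (con 1 :+ u) :+ g :* (u :* v :+ v)
        := (con 1 :+ v :* (con 1 :+ v :* con 0)) :* ((con 1 :+ u :* (con 1 :+ u :* con 0)) :* g)) refl

    module _ (X : ℕ → Carrier) (X-0 : X 0 ≈ 1#) (X-+ : ∀ k l → X (k ℕ.+ l) ≈ X k * X l) where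
      open Monomials X X-0 X-+

      -- The rotations ρᵏ and reflections ρᵏ r₁ with k < p, then those with p ≤ k < p + m in
      -- terms of j = p + m − k.
      Σ<-dihedral : ∀ (c : ℕ → ℕ) (d : ℕ → ℕ) α β p m →
        (∀ {k} → k ℕ.< p → c k ≡ k ℕ.* (α ℕ.+ β)) →
        (∀ {k} → k ℕ.< p → d k ≡ k ℕ.* (α ℕ.+ β) ℕ.+ α) →
        (∀ {j} → j ℕ.< m → c (p ℕ.+ (m ∸ suc j)) ≡ suc j ℕ.* (α ℕ.+ β)) →
        (∀ {j} → j ℕ.< m → d (p ℕ.+ (m ∸ suc j)) ≡ j ℕ.* (α ℕ.+ β) ℕ.+ β) →
        Σ< (p ℕ.+ m) (λ k → X (c k) + X (d k)) ≈
          geo (X (α ℕ.+ β)) p * (1# + X α) + geo (X (α ℕ.+ β)) m * (X (α ℕ.+ β) + X β)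
      Σ<-dihedral c d α β p m c-low d-low c-high d-high = begin
        Σ< (p ℕ.+ m) f                                      ≈⟨ Σ<-+ p m f ⟩
        Σ< p f + Σ< m (λ i → f (p ℕ.+ i))
          ≈⟨ +-congˡ (Σ<-reverse m (λ i → f (p ℕ.+ i))) ⟨
        Σ< p f + Σ< m (λ j → f (p ℕ.+ (m ∸ suc j)))
          ≈⟨ +-cong
               (trans (Σ<-cong p (λ i<p → +-cong (X-cong (c-low i<p)) (X-cong (d-low i<p)))) (Σ<-geo z (1# + X α) low low≈ p))
               (trans (Σ<-cong m (λ j<m → +-cong (X-cong (c-high j<m)) (X-cong (d-high j<m)))) (Σ<-geo z (z + X β) high high≈ m)) ⟩
        geo z p * (1# + X α) + geo z m * (z + X β) ∎
        where
        γ = α ℕ.+ β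
        z = X γ
        f low high : ℕ → Carrier
        f k = X (c k) + X (d k)
        low k = X (k ℕ.* γ) + X (k ℕ.* γ ℕ.+ α)
        high k = X (suc k ℕ.* γ) + X (k ℕ.* γ ℕ.+ β)
        X-* : ∀ k → X (k ℕ.* γ) ≈ pow z k
        X-* k = trans (X-cong (ℕ.*-comm k γ)) (sym (pow-X γ k))
        low≈ : ∀ k → low k ≈ pow z k * (1# + X α)
        low≈ k = trans (+-cong (X-* k) (trans (X-+ (k ℕ.* γ) α) (*-congʳ (X-* k))))
          (trans (+-congʳ (sym (*-identityʳ _))) (sym (distribˡ _ _ _)))
        high≈ : ∀ k → high k ≈ pow z k * (z + X β)
        high≈ k =
          trans (+-cong (trans (X-+ γ (k ℕ.* γ)) (trans (*-comm _ _) (*-congʳ (X-* k)))) (trans (X-+ (k ℕ.* γ) β) (*-congʳ (X-* k))))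
          (sym (distribˡ _ _ _))

-- The q-integers of the statement as geometric sums of polynomials.

module QIntegers where
  open import Algebra.Bundles using (CommutativeRing)
  open import Data.Bool using (true; false; if_then_else_)
  open import Data.Integer as ℤ using (ℤ; +_; -_)
  import Data.Integer.Properties as ℤ
  open import Data.Nat as ℕ using (ℕ; zero; suc)
  import Data.Nat.Properties as ℕ
  open import Relation.Binary.PropositionalEquality
  open import Relation.Nullary using (does)
  open Polynomials
  open GeometricSums
  open GeneratingFunctions

  module P = CommutativeRing polyRing
  open Geometric polyRing public
  open Sums polyRing public

  X : ℕ → Poly
  X = mono (+ 1)

  open Monomials X (λ _ → refl) (λ k l → P.sym {mono (+ 1) k *P mono (+ 1) l} {mono (+ 1) (k ℕ.+ l)} (mono*mono (+ 1) (+ 1) k l)) public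

  X-+ : ∀ k l → X (k ℕ.+ l) ≈P (X k *P X l)
  X-+ k l i = sym (mono*mono (+ 1) (+ 1) k l i)

  qint-geo : ∀ c m k → qint c m k ≈P geo (mono c m) k
  qint-geo c m = sum-geo (mono c m) (λ j → mono (c ℤ.^ j) (m ℕ.* j))
    (mono-cong refl (ℕ.*-zeroʳ m))
    (λ j i → trans (mono-cong {c ℤ.* c ℤ.^ j} {c ℤ.* c ℤ.^ j} refl (ℕ.*-suc m j) i) (sym (mono*mono c (c ℤ.^ j) m (m ℕ.* j) i)))

  mono-neg : mono (- + 1) 1 ≈P (P.- X 1)
  mono-neg i = lemma (does (i ℕ.≟ 1))
    where
    lemma : ∀ b → (if b then - + 1 else + 0) ≡ - (if b then + 1 else + 0)
    lemma true  = refl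
    lemma false = refl

  -1^even : ∀ k → (- + 1) ℤ.^ (k ℕ.+ k) ≡ + 1
  -1^even zero    = refl
  -1^even (suc k) rewrite ℕ.+-suc k k | -1^even k = refl

  []±q-odd : ∀ k → [ suc (k ℕ.+ k) ]±q ≈P geo (P.- X 1) (suc (k ℕ.+ k))
  []±q-odd k i = trans (cong (λ c → qint ((- + 1) ℤ.* c) 1 (suc (k ℕ.+ k)) i) (-1^even k))
    (trans (qint-geo (- + 1) 1 (suc (k ℕ.+ k)) i) (geo-cong (suc (k ℕ.+ k)) mono-neg i))

  []±q-even : ∀ k → [ suc k ℕ.+ suc k ]±q ≈P geo (X 1) (suc k ℕ.+ suc k)
  []±q-even k i = trans (cong (λ c → qint c 1 (suc k ℕ.+ suc k) i) (-1^even (suc k)))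
    (qint-geo (+ 1) 1 (suc k ℕ.+ suc k) i)

open import Data.Bool as Bool using (Bool; true; false; not; if_then_else_; _xor_)
open import Data.Bool.Properties using (xor-assoc; xor-identityʳ; not-involutive)
open import Data.Empty using (⊥; ⊥-elim)
open import Data.Fin as Fin using (Fin; toℕ; fromℕ<; inject₁; fromℕ)
import Data.Fin.Properties as Fin
open import Data.List
  using (List; []; _∷_; _++_; map; [_]; _∷ʳ_; reverse; cartesianProductWith; length; concatMap; filter; foldr)
open import Data.List.Membership.Propositional using (_∈_)
open import Data.List.Membership.Propositional.Properties
  using (∈-map⁺; ∈-map⁻; ∈-cartesianProductWith⁻; ∈-upTo⁺; ∈-upTo⁻; ∈-++⁺ˡ; ∈-++⁺ʳ; ∈-++⁻; ∈-filter⁻)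
open import Data.List.Membership.Propositional.Properties.WithK using (unique∧set⇒bag)
open import Data.List.Properties
  using (length-++; ++-identityʳ; reverse-involutive; ∷ʳ-injectiveˡ; length-map; map-upTo)
open import Data.List.Relation.Binary.BagAndSetEquality using (∼bag⇒↭)
open import Data.List.Relation.Binary.Permutation.Propositional using (_↭_; ↭-sym)
import Data.List.Relation.Binary.Permutation.Propositional.Properties as ↭
open import Data.List.Relation.Unary.All as All using (All; []; _∷_)
import Data.List.Relation.Unary.All.Properties as All
open import Data.List.Relation.Unary.AllPairs using ([]; _∷_)
open import Data.List.Relation.Unary.Any using (here; there)
open import Data.List.Relation.Unary.Unique.Propositional using (Unique)
import Data.List.Relation.Unary.Unique.Propositional.Properties as Unique
open import Data.Nat as ℕ
  using (ℕ; zero; suc; _+_; _≤_; _<_; s≤s; _*_; s≤s⁻¹; z<s; s<s; s<s⁻¹; _∸_; z≤n; _<?_; _<ᵇ_; _≤?_; _≟_; pred)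
open import Data.Nat.Properties hiding (_≤?_; _≟_)
open import Data.Nat.Tactic.RingSolver using (solve-∀)
open import Data.Product using (_×_; _,_; ∃; proj₁; proj₂; map₁)
open import Data.Sum using (inj₁; inj₂)
open import Data.Vec as Vec using (Vec; lookup)
open import Data.Vec.Properties using (lookup∘tabulate; tabulate∘lookup; tabulate-cong; lookup-map)
open import Function using (_⇔_; mk⇔; Equivalence; _∘_; id)
open import Relation.Binary.PropositionalEquality hiding ([_])
open import Relation.Nullary using (yes; no; Dec; does)
open import Relation.Nullary.Decidable using (dec-true; dec-false)

-- Lengths of normal forms and enumeration of the folding subgroup.

module LengthsAndEnumeration where
  open CosetWords

  unique-map : {A B : Set} {f : A → B} {xs : List A} →
    (∀ {x y} → x ∈ xs → y ∈ xs → f x ≡ f y → x ≡ y) → Unique xs → Unique (map f xs)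
  unique-map inj []           = []
  unique-map inj (x∉xs ∷ xs!) =
    All.map⁺ (All.tabulate (λ y∈ eq → All.lookup x∉xs y∈ (inj (here refl) (there y∈) eq)))
    ∷ unique-map (λ x∈ y∈ → inj (there x∈) (there y∈)) xs!

  unique-product : {A B C : Set} {f : A → B → C} {xs : List A} {ys : List B} →
    (∀ {x x′ y y′} → x ∈ xs → x′ ∈ xs → y ∈ ys → y′ ∈ ys → f x y ≡ f x′ y′ → x ≡ x′ × y ≡ y′) →
    Unique xs → Unique ys → Unique (cartesianProductWith f xs ys)
  unique-product inj [] ys! = []
  unique-product {f = f} {xs = x ∷ xs} {ys} inj (x∉xs ∷ xs!) ys! = Unique.++⁺
    (unique-map (λ y∈ y′∈ eq → proj₂ (inj (here refl) (here refl) y∈ y′∈ eq)) ys!)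
    (unique-product (λ x∈ x′∈ → inj (there x∈) (there x′∈)) xs! ys!)
    disjoint
    where
    disjoint : ∀ {z} → z ∈ map (f x) ys × z ∈ cartesianProductWith f xs ys → _
    disjoint (z∈₁ , z∈₂) with ∈-map⁻ (f x) z∈₁ | ∈-cartesianProductWith⁻ f xs ys z∈₂
    ... | y , y∈ , refl | x′ , y′ , x′∈ , y′∈ , eq =
      All.lookup x∉xs x′∈ (proj₁ (inj (here refl) (there x′∈) y∈ y′∈ eq))

  []≢∷ʳ : ∀ {A : Set} {x : A} xs → [] ≢ xs ∷ʳ x
  []≢∷ʳ []       ()
  []≢∷ʳ (_ ∷ xs) ()

  -- Without its last letter, `flip (suc k)` still begins with k + 1, whereas the representatives
  -- one rank lower have letters at most k.
  flip∉middle : ∀ k → flip k ∈ middle k → ⊥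
  flip∉middle (suc k) flip∈ with ∈-map⁻ _ flip∈
  ... | d , d∈ , eq with ∷ʳ-injectiveˡ (suc k ∷ flip k) d eq
  ...   | refl = 1+n≰n (All.head (coset-letters (∈⇒IsCoset k d∈)))

  cosets-unique : ∀ k → Unique (cosets k)
  cosets-unique k = All.∷ʳ⁺ ([]≢middle k) ([]≢flip k) ∷ Unique.++⁺ (middle-unique k) ([] ∷ [])
    λ { (c∈ , here refl) → flip∉middle k c∈ }
    where
    []≢flip : ∀ k → [] ≢ flip k
    []≢flip zero    ()
    []≢flip (suc k) ()
    []≢middle : ∀ k → All ([] ≢_) (middle k)
    []≢middle zero    = []
    []≢middle (suc k) = All.map⁺ (All.universal []≢∷ʳ (cosets k))
    middle-unique : ∀ k → Unique (middle k)
    middle-unique zero    = []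
    middle-unique (suc k) = Unique.map⁺ (∷ʳ-injectiveˡ _ _) (cosets-unique k)

  reverse-letters : ∀ {n w} → All (_< n) w → All (_< n) (reverse w)
  reverse-letters {w = w} = ↭.All-resp-↭ (↭-sym (↭.↭-reverse w))

  -- `word i` spells the image of letter i in the Coxeter generators of the ambient group. The
  -- function `ℓ` is known only through its specification on generated elements, so every use of it
  -- must exhibit such a word.
  module Folding {G : Set} (_·_ : G → G → G) (e : G)
    (·-assoc : ∀ x y z → (x · y) · z ≡ x · (y · z))
    (·-identityˡ : ∀ x → e · x ≡ x) (·-identityʳ : ∀ x → x · e ≡ x)
    (S : List G) (ℓ : G → ℕ) (isLength : Words.IsLength _·_ e S ℓ)
    (a b : ℕ)
    (n : ℕ) (r : ℕ → G) (word : ℕ → List G)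
    (word-S : ∀ {i} → i < n → All (_∈ S) (word i))
    (word-r : ∀ {i} → i < n → Words.prod _·_ e (word i) ≡ r i)
    (word-length : ∀ {i} → i < n → length (word i) ≡ Weights.weight a b i)
    where

    open Words _·_ e
    open Weights a b
    open Action (λ i → r i ·_)

    act-· : ∀ w x → act w x ≡ act w e · x
    act-· []      x = sym (·-identityˡ x)
    act-· (i ∷ w) x = trans (cong (r i ·_) (act-· w x)) (sym (·-assoc (r i) _ x))

    prod-++ : ∀ u v → prod (u ++ v) ≡ prod u · prod v
    prod-++ []      v = sym (·-identityˡ _)
    prod-++ (g ∷ u) v = trans (cong (g ·_) (prod-++ u v)) (sym (·-assoc g _ _))

    expand : List ℕ → List G
    expand = concatMap word

    expand-S : ∀ {w} → All (_< n) w → All (_∈ S) (expand w)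
    expand-S []          = []
    expand-S (i<n ∷ w<n) = All.++⁺ (word-S i<n) (expand-S w<n)

    expand-prod : ∀ {w} → All (_< n) w → prod (expand w) ≡ act w e
    expand-prod []                    = refl
    expand-prod {i ∷ w} (i<n ∷ w<n) =
      trans (prod-++ (word i) (expand w)) (cong₂ _·_ (word-r i<n) (expand-prod w<n))

    expand-length : ∀ {w} → All (_< n) w → length (expand w) ≡ wt w
    expand-length []                  = refl
    expand-length {i ∷ w} (i<n ∷ w<n) =
      trans (length-++ (word i)) (cong₂ _+_ (word-length i<n) (expand-length w<n))

    -- A shortest word for u, extended by s, is a word for the product.
    reduced : ∀ {u s} → All (_< n) u → All (_< n) s →
      (∀ v → All (_∈ S) v → prod v ≡ act u (act s e) → wt u + wt s ≤ length v) →
      ℓ (act u e) ≡ wt u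
    reduced {u} {s} u<n s<n bound with isLength (act u e) (expand u , expand-S u<n , expand-prod u<n)
    ... | (v , v-S , prod-v , length-v) , minimal = ≤-antisym
      (subst (ℓ (act u e) ≤_) (expand-length u<n) (minimal (expand u) (expand-S u<n) (expand-prod u<n)))
      (+-cancelʳ-≤ (wt s) _ _ (subst (wt u + wt s ≤_) length-vs
        (bound (v ++ expand s) (All.++⁺ v-S (expand-S s<n)) prod-vs)))
      where
      length-vs : length (v ++ expand s) ≡ ℓ (act u e) + wt s
      length-vs = trans (length-++ v) (cong₂ _+_ length-v (expand-length s<n))
      prod-vs : prod (v ++ expand s) ≡ act u (act s e)
      prod-vs = trans (prod-++ v (expand s))
        (trans (cong₂ _·_ prod-v (expand-prod s<n)) (sym (act-· u _)))

    -- `bound`, for the longest element, is the only lower bound on lengths that the ambient group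
    -- has to supply.
    module Count (1≤a : 1 ≤ a) (1≤b : 1 ≤ b)
      (square  : ∀ {i} → i < n → ∀ x → r i · (r i · x) ≡ x)
      (commute : ∀ {i j} → suc i < j → j < n → ∀ x → r i · (r j · x) ≡ r j · (r i · x))
      (braid   : ∀ {i} → 2 + i < n → ∀ x →
        r (1 + i) · (r (2 + i) · (r (1 + i) · x)) ≡ r (2 + i) · (r (1 + i) · (r (2 + i) · x)))
      (braid₄  : 1 < n → ∀ x → r 0 · (r 1 · (r 0 · (r 1 · x))) ≡ r 1 · (r 0 · (r 1 · (r 0 · x))))
      (bound   : ∀ v → All (_∈ S) v → prod v ≡ act (longest n) e → wt (longest n) ≤ length v)
      where
      open Relations n square commute braid braid₄

      ℓ-element : ∀ {u} → u ∈ elements n → ℓ (act u e) ≡ wt u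
      ℓ-element {u} u∈ with complement a b ≤-refl u∈
      ... | s , s<n , us≡ , sum = reduced (element-letters n u∈) s<n λ v v-S prod-v →
        subst (_≤ length v) (sym sum) (bound v v-S (trans prod-v (us≡ e)))

      element-≤ : ∀ {k u} → k ≤ n → u ∈ elements k → u ∈ elements n
      element-≤ {k} k≤n u∈ = go (≤⇒≤′ k≤n)
        where
        go : ∀ {m} → k ℕ.≤′ m → _ ∈ elements m
        go (ℕ.≤′-reflexive refl) = u∈
        -- The larger parabolic contains the same word with the empty representative in front.
        go (ℕ.≤′-step {m} k≤m)   = mk-element m nil (go k≤m)

      act-cancel : ∀ {w} → All (_< n) w → ∀ x → act w (act (reverse w) x) ≡ x
      act-cancel {w} w<n x = trans (cong (λ v → act v (act (reverse w) x)) (sym (reverse-involutive w)))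
        (act-reverse (reverse-letters w<n) x)

      -- Elements of the same coset differ on the right by an element of the parabolic, and
      -- lengths add up; so the two representatives have the same weight.
      coset-weight-≤ : ∀ {k c d u v} → k < n → IsCoset k c → IsCoset k d → u ∈ elements k → v ∈ elements k →
        act (c ++ u) e ≡ act (d ++ v) e → wt d ≤ wt c
      coset-weight-≤ {k} {c} {d} {u} {v} k<n c-coset d-coset u∈ v∈ eq
        with normalise (<⇒≤ k<n) (All.++⁺ (element-letters k v∈) (reverse-letters (element-letters k u∈)))
      ... | z , z∈ , z≡ = ≤-trans (m≤m+n (wt d) (wt z)) (≤-reflexive (begin
        wt d + wt z             ≡⟨ wt-++ d z ⟨
        wt (d ++ z)             ≡⟨ ℓ-element (element-≤ k<n (mk-element k d-coset z∈)) ⟨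
        ℓ (act (d ++ z) e)      ≡⟨ cong ℓ c≡dz ⟨
        ℓ (act (c ++ []) e)     ≡⟨ ℓ-element (element-≤ k<n (mk-element k c-coset ([]∈elements k))) ⟩
        wt (c ++ [])            ≡⟨ cong wt (++-identityʳ c) ⟩
        wt c ∎))
        where
        open ≡-Reasoning
        u<n = All.map (λ i<k → ≤-trans i<k (<⇒≤ k<n)) (element-letters k u∈)
        u⁻¹ = act (reverse u) e
        c≡dz : act (c ++ []) e ≡ act (d ++ z) e
        c≡dz = begin
          act (c ++ []) e                   ≡⟨ cong (λ w → act w e) (++-identityʳ c) ⟩
          act c e                           ≡⟨ cong (act c) (act-cancel u<n e) ⟨
          act c (act u u⁻¹)                 ≡⟨ act-++ c u u⁻¹ ⟨
          act (c ++ u) u⁻¹                  ≡⟨ act-· (c ++ u) u⁻¹ ⟩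
          act (c ++ u) e · u⁻¹              ≡⟨ cong (_· u⁻¹) eq ⟩
          act (d ++ v) e · u⁻¹              ≡⟨ act-· (d ++ v) u⁻¹ ⟨
          act (d ++ v) u⁻¹                  ≡⟨ act-++ d v u⁻¹ ⟩
          act d (act v u⁻¹)                 ≡⟨ cong (act d) (act-++ v (reverse u) e) ⟨
          act d (act (v ++ reverse u) e)    ≡⟨ cong (act d) (z≡ e) ⟩
          act d (act z e)                   ≡⟨ act-++ d z e ⟨
          act (d ++ z) e ∎

      coset-injective : ∀ {k c d u v} → k < n → IsCoset k c → IsCoset k d → u ∈ elements k → v ∈ elements k →
        act (c ++ u) e ≡ act (d ++ v) e → c ≡ d × act u e ≡ act v e
      coset-injective {k} {c} {d} {u} {v} k<n c-coset d-coset u∈ v∈ eq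
        with wt-injective 1≤a 1≤b c-coset d-coset (≤-antisym
          (coset-weight-≤ k<n d-coset c-coset v∈ u∈ (sym eq)) (coset-weight-≤ k<n c-coset d-coset u∈ v∈ eq))
      ... | refl = refl , (begin
        act u e                             ≡⟨ cancel (act u e) ⟨
        act (reverse c) (act c (act u e))   ≡⟨ cong (act (reverse c)) (act-++ c u e) ⟨
        act (reverse c) (act (c ++ u) e)    ≡⟨ cong (act (reverse c)) eq ⟩
        act (reverse c) (act (c ++ v) e)    ≡⟨ cong (act (reverse c)) (act-++ c v e) ⟩
        act (reverse c) (act c (act v e))   ≡⟨ cancel (act v e) ⟩
        act v e ∎)
        where
        open ≡-Reasoning
        cancel : ∀ x → act (reverse c) (act c x) ≡ x
        cancel = act-reverse (All.map (λ i≤k → ≤-trans (s≤s i≤k) k<n) (coset-letters c-coset))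

      element-injective : ∀ {k u v} → k ≤ n → u ∈ elements k → v ∈ elements k → act u e ≡ act v e → u ≡ v
      element-injective {zero} k≤n (here refl) (here refl) eq = refl
      element-injective {suc k} k<n u∈ v∈ eq with element-view k u∈ | element-view k v∈
      ... | c , u , c-coset , u∈′ , refl | d , v , d-coset , v∈′ , refl
        with coset-injective k<n c-coset d-coset u∈′ v∈′ eq
      ...   | c≡d , eq′ = cong₂ _++_ c≡d (element-injective (<⇒≤ k<n) u∈′ v∈′ eq′)

      elements-unique : ∀ {k} → k ≤ n → Unique (elements k)
      elements-unique {zero}  k≤n = [] ∷ []
      elements-unique {suc k} k<n = unique-product injective (cosets-unique k) (elements-unique (<⇒≤ k<n))
        where
        injective : ∀ {c d u v} → c ∈ cosets k → d ∈ cosets k → u ∈ elements k → v ∈ elements k →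
          c ++ u ≡ d ++ v → c ≡ d × u ≡ v
        injective c∈ d∈ u∈ v∈ eq
          -- Equal words have equal products, and for products the splitting into coset and
          -- remainder is already known to be unique.
          with coset-injective k<n (∈⇒IsCoset k c∈) (∈⇒IsCoset k d∈) u∈ v∈ (cong (λ w → act w e) eq)
        ... | c≡d , eq′ = c≡d , element-injective (<⇒≤ k<n) u∈ v∈ eq′

      -- Two lists without repetition and with the same members are permutations of each other;
      -- membership is compared through `normalise`.
      enumeration : ∀ {T L} → (∀ {i} → i < n → r i ∈ T) → (∀ {x} → x ∈ T → ∃ λ i → i < n × x ≡ r i) →
        Unique L → (∀ x → x ∈ L ⇔ Gen T x) → L ↭ map (λ w → act w e) (elements n)
      enumeration {T} {L} r∈T T⊆r L! L⇔Gen = ∼bag⇒↭ (unique∧set⇒bag L!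
        (unique-map (element-injective ≤-refl) (elements-unique ≤-refl))
        (λ {x} → mk⇔ (to x) (from x)))
        where
        letters : ∀ {v} → All (_∈ T) v → ∃ λ w → All (_< n) w × prod v ≡ act w e
        letters []        = [] , [] , refl
        letters (g∈ ∷ v∈) with T⊆r g∈ | letters v∈
        ... | i , i<n , refl | w , w<n , eq = i ∷ w , i<n ∷ w<n , cong (r i ·_) eq
        to : ∀ x → x ∈ L → x ∈ map (λ w → act w e) (elements n)
        to x x∈ with Equivalence.to (L⇔Gen x) x∈
        ... | v , v∈ , refl with letters v∈
        ...   | w , w<n , eq with normalise ≤-refl w<n
        ...     | u , u∈ , eq′ = subst (_∈ _) (sym (trans eq (eq′ e))) (∈-map⁺ _ u∈)
        prod-letters : ∀ w → prod (map r w) ≡ act w e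
        prod-letters []      = refl
        prod-letters (i ∷ w) = cong (r i ·_) (prod-letters w)
        from : ∀ x → x ∈ map (λ w → act w e) (elements n) → x ∈ L
        from x x∈ with ∈-map⁻ _ x∈
        ... | w , w∈ , refl = Equivalence.from (L⇔Gen _)
          (map r w , All.map⁺ (All.map r∈T (element-letters n w∈)) , prod-letters w)

-- Adjacent transpositions, pair statistics and the signed coordinates.

module SignedModel where
  open CosetWords

  -- The transposition of k and k + 1 on all natural numbers: no bounds to carry, and its laws hold
  -- by structural recursion.
  adj : ℕ → ℕ → ℕ
  adj zero    zero          = 1
  adj zero    (suc zero)    = 0
  adj zero    (suc (suc x)) = suc (suc x)
  adj (suc k) zero          = zero
  adj (suc k) (suc x)       = suc (adj k x)

  adj-lower : ∀ k → adj k k ≡ suc k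
  adj-lower zero    = refl
  adj-lower (suc k) = cong suc (adj-lower k)

  adj-upper : ∀ k → adj k (suc k) ≡ k
  adj-upper zero    = refl
  adj-upper (suc k) = cong suc (adj-upper k)

  adj-< : ∀ {k x} → x < k → adj k x ≡ x
  adj-< {suc k} {zero}  x<k = refl
  adj-< {suc k} {suc x} x<k = cong suc (adj-< (s<s⁻¹ x<k))

  adj-> : ∀ {k x} → suc k < x → adj k x ≡ x
  adj-> {zero}  {suc (suc x)} k<x = refl
  adj-> {zero}  {suc zero}    (s≤s ())
  adj-> {suc k} {suc x}       k<x = cong suc (adj-> (s<s⁻¹ k<x))

  adj-fix : ∀ {k x} → x ≢ k → x ≢ suc k → adj k x ≡ x
  adj-fix {zero}  {zero}        x≢k x≢1+k = ⊥-elim (x≢k refl)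
  adj-fix {zero}  {suc zero}    x≢k x≢1+k = ⊥-elim (x≢1+k refl)
  adj-fix {zero}  {suc (suc x)} x≢k x≢1+k = refl
  adj-fix {suc k} {zero}        x≢k x≢1+k = refl
  adj-fix {suc k} {suc x}       x≢k x≢1+k = cong suc (adj-fix (x≢k ∘ cong suc) (x≢1+k ∘ cong suc))

  adj-involutive : ∀ k x → adj k (adj k x) ≡ x
  adj-involutive zero    zero          = refl
  adj-involutive zero    (suc zero)    = refl
  adj-involutive zero    (suc (suc x)) = refl
  adj-involutive (suc k) zero          = refl
  adj-involutive (suc k) (suc x)       = cong suc (adj-involutive k x)

  adj-commute : ∀ {i j} → suc i < j → ∀ x → adj i (adj j x) ≡ adj j (adj i x)
  adj-commute {zero}  {suc (suc j)} i<j zero          = refl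
  adj-commute {zero}  {suc (suc j)} i<j (suc zero)    = refl
  adj-commute {zero}  {suc (suc j)} i<j (suc (suc x)) = refl
  adj-commute {zero}  {suc zero}    (s≤s ()) x
  adj-commute {suc i} {suc j}       i<j zero          = refl
  adj-commute {suc i} {suc j}       i<j (suc x)       = cong suc (adj-commute (s<s⁻¹ i<j) x)

  adj-braid : ∀ k x → adj k (adj (suc k) (adj k x)) ≡ adj (suc k) (adj k (adj (suc k) x))
  adj-braid zero    zero                = refl
  adj-braid zero    (suc zero)          = refl
  adj-braid zero    (suc (suc zero))    = refl
  adj-braid zero    (suc (suc (suc x))) = refl
  adj-braid (suc k) zero                = refl
  adj-braid (suc k) (suc x)             = cong suc (adj-braid k x)

  adj-shift : ∀ c k x → adj (c + k) (c + x) ≡ c + adj k x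
  adj-shift zero    k x = refl
  adj-shift (suc c) k x = cong suc (adj-shift c k x)

  -- The reflection x ↦ n - x carries the transposition at a = n - k - 1 to the one at k. Sums
  -- replace differences to avoid truncated subtraction.
  adj-reflect : ∀ {n a x k j} → a + suc k ≡ n → x + j ≡ n → adj a x + adj k j ≡ n
  adj-reflect {a = a} {x} {k} {j} refl eq with j ≟ k | j ≟ suc k
  ... | yes refl | _ with +-cancelʳ-≡ k x (suc a) (trans eq (+-suc a k))
  ...   | refl = cong₂ _+_ (adj-upper a) (adj-lower k)
  adj-reflect {a = a} {x} {k} refl eq | no _ | yes refl with +-cancelʳ-≡ (suc k) x a eq
  ...   | refl = trans (cong₂ _+_ (adj-lower a) (adj-upper k)) (sym (+-suc a k))
  adj-reflect {a = a} {x} {k} {j} refl eq | no j≢k | no j≢1+k =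
    trans (cong₂ _+_ (adj-fix x≢a x≢1+a) (adj-fix j≢k j≢1+k)) eq
    where
    x≢a : x ≢ a
    x≢a refl = j≢1+k (+-cancelˡ-≡ x j (suc k) eq)
    x≢1+a : x ≢ suc a
    x≢1+a refl = j≢k (+-cancelˡ-≡ x j k (trans eq (+-suc a k)))

  -- `stat m F` adds up `p` over the pairs of positions i < j < m. It covers inversions in type A
  -- and negative roots in type D alike.
  module PairStatistic {A : Set} (p : A → A → ℕ) where
    row : ℕ → A → (ℕ → A) → ℕ
    row zero    a F = 0
    row (suc m) a F = p a (F 0) + row m a (F ∘ suc)

    stat : ℕ → (ℕ → A) → ℕ
    stat zero    F = 0
    stat (suc m) F = row m (F 0) (F ∘ suc) + stat m (F ∘ suc)

    row-cong : ∀ m a {F F′} → (∀ {i} → i < m → F i ≡ F′ i) → row m a F ≡ row m a F′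
    row-cong zero    a eq = refl
    row-cong (suc m) a eq = cong₂ _+_ (cong (p a) (eq z<s)) (row-cong m a (eq ∘ s<s))

    stat-cong : ∀ m {F F′} → (∀ {i} → i < m → F i ≡ F′ i) → stat m F ≡ stat m F′
    stat-cong zero    eq = refl
    stat-cong (suc m) {F} {F′} eq = cong₂ _+_
      (trans (row-cong m (F 0) (eq ∘ s<s)) (cong (λ a → row m a (F′ ∘ suc)) (eq z<s)))
      (stat-cong m (eq ∘ s<s))

    row-const : ∀ m a c {F} → (∀ {i} → i < m → p a (F i) ≡ c) → row m a F ≡ m * c
    row-const zero    a c eq = refl
    row-const (suc m) a c eq = cong₂ _+_ (eq z<s) (row-const m a c (eq ∘ s<s))

    row-adj : ∀ {m k} a F → suc k < m → row m a (F ∘ adj k) ≡ row m a F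
    row-adj {suc (suc m)} {zero}  a F k<m = lemma (p a (F 1)) (p a (F 0)) _
      where
      lemma : ∀ x y z → x + (y + z) ≡ y + (x + z)
      lemma = solve-∀
    row-adj {suc zero}    {zero}  a F (s≤s ())
    row-adj {suc m}       {suc k} a F k<m = cong (p a (F 0) +_) (row-adj a (F ∘ suc) (s<s⁻¹ k<m))

    -- Exchanging neighbours permutes the other pairs among themselves, so only the contribution of
    -- the exchanged pair can grow.
    stat-adj : (∀ a b → p b a ≤ suc (p a b)) →
      ∀ {m k} F → suc k < m → stat m (F ∘ adj k) ≤ suc (stat m F)
    stat-adj p≤ {suc (suc m)} {zero}  F k<m = ≤-trans
      (+-monoˡ-≤ (row m (F 0) G + stat m G) (+-monoˡ-≤ (row m (F 1) G) (p≤ (F 0) (F 1))))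
      (≤-reflexive (lemma (p (F 0) (F 1)) (row m (F 1) G) (row m (F 0) G) (stat m G)))
      where
      G = F ∘ suc ∘ suc
      lemma : ∀ x y z w → suc x + y + (z + w) ≡ suc (x + z + (y + w))
      lemma = solve-∀
    stat-adj p≤ {suc zero}    {zero}  F (s≤s ())
    stat-adj p≤ {suc m}       {suc k} F k<m = ≤-trans
      (+-mono-≤ (≤-reflexive (row-adj (F 0) (F ∘ suc) (s<s⁻¹ k<m))) (stat-adj p≤ (F ∘ suc) (s<s⁻¹ k<m)))
      (≤-reflexive (+-suc _ _))

    -- Right multiplication by the generator s_{n+1} of D_{n+1} in one-line notation, for k = n − 1.
    twist : (A → A) → ℕ → (ℕ → A) → ℕ → A
    twist neg zero    F zero          = neg (F 1)
    twist neg zero    F (suc zero)    = neg (F 0)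
    twist neg zero    F (suc (suc i)) = F (suc (suc i))
    twist neg (suc k) F zero          = F 0
    twist neg (suc k) F (suc i)       = twist neg k (F ∘ suc) i

    -- The twist moves the last two of 2 + k positions. Earlier entries meet these only as second
    -- arguments of `p`, where the sign is ignored.
    module _ (neg : A → A) (p-neg : ∀ a b → p a (neg b) ≡ p a b) where
      row-twist : ∀ k a F → row (2 + k) a (twist neg k F) ≡ row (2 + k) a F
      row-twist zero    a F = trans (cong₂ (λ x y → x + (y + 0)) (p-neg a (F 1)) (p-neg a (F 0)))
        (lemma (p a (F 1)) (p a (F 0)))
        where
        lemma : ∀ x y → x + (y + 0) ≡ y + (x + 0)
        lemma = solve-∀
      row-twist (suc k) a F = cong (p a (F 0) +_) (row-twist k a (F ∘ suc))

      stat-twist : (∀ a b → p (neg b) (neg a) ≤ suc (p a b)) →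
        ∀ k F → stat (2 + k) (twist neg k F) ≤ suc (stat (2 + k) F)
      stat-twist p≤ zero    F = +-monoˡ-≤ 0 (+-monoˡ-≤ 0 (p≤ (F 0) (F 1)))
      stat-twist p≤ (suc k) F = ≤-trans
        (+-mono-≤ (≤-reflexive (row-twist k (F 0) (F ∘ suc))) (stat-twist p≤ k (F ∘ suc)))
        (≤-reflexive (+-suc _ _))

  -- `Rep` is a relation because the one-line tables are functions on all of ℕ, whose values outside
  -- the range of an element are arbitrary.
  module LengthBound {G : Set} (_·_ : G → G → G) (e : G)
    (·-assoc : ∀ x y z → (x · y) · z ≡ x · (y · z)) (·-identityʳ : ∀ x → x · e ≡ x)
    (S : List G) {F : Set} (Rep : G → F → Set) (stat : F → ℕ)
    (step : ∀ {x f s} → s ∈ S → Rep x f → ∃ λ f′ → Rep (x · s) f′ × stat f′ ≤ suc (stat f))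
    where
    open Words _·_ e

    word-bound : ∀ {x f w} → All (_∈ S) w → Rep x f → ∃ λ f′ → Rep (x · prod w) f′ × stat f′ ≤ length w + stat f
    word-bound {x} {f} [] rep = f , subst (λ y → Rep y f) (sym (·-identityʳ x)) rep , ≤-refl
    word-bound {x} {w = s ∷ w} (s∈ ∷ w∈) rep with step s∈ rep
    ... | f′ , rep′ , stat′ with word-bound w∈ rep′
    ...   | f″ , rep″ , stat″ = f″ , subst (λ y → Rep y f″) (·-assoc x s (prod w)) rep″ ,
      ≤-trans stat″ (≤-trans (+-monoʳ-≤ (length w) stat′) (≤-reflexive (+-suc _ _)))

  -- The hyperoctahedral group acting on signed coordinates 1, 2, …; the sign change of
  -- coordinate 1 acts on the extra coordinate 0 by the involution h.
  module SignedCoordinates (h : Bool → Bool) (h-involutive : ∀ s → h (h s) ≡ s) where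

    T : ℕ → ℕ × Bool → ℕ × Bool
    T zero    (zero        , s) = zero , h s
    T zero    (suc zero    , s) = 1 , not s
    T zero    (suc (suc j) , s) = suc (suc j) , s
    T (suc i) (j           , s) = adj (suc i) j , s

    not-not : ∀ s → not (not s) ≡ s
    not-not true  = refl
    not-not false = refl

    T-square : ∀ i y → T i (T i y) ≡ y
    T-square zero    (zero        , s) = cong (0 ,_) (h-involutive s)
    T-square zero    (suc zero    , s) = cong (1 ,_) (not-not s)
    T-square zero    (suc (suc j) , s) = refl
    T-square (suc i) (j           , s) = cong (_, s) (adj-involutive (suc i) j)

    T-commute : ∀ {i j} → suc i < j → ∀ y → T i (T j y) ≡ T j (T i y)
    T-commute {zero}  {suc (suc j)} i<j (zero        , s)  = refl
    T-commute {zero}  {suc (suc j)} i<j (suc zero    , s)  = refl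
    T-commute {zero}  {suc (suc j)} i<j (suc (suc k) , s)  = refl
    T-commute {zero}  {suc zero}    (s≤s ()) y
    T-commute {suc i} {suc j}       i<j (k           , s)  = cong (_, s) (adj-commute i<j k)

    T-braid : ∀ i y → T (1 + i) (T (2 + i) (T (1 + i) y)) ≡ T (2 + i) (T (1 + i) (T (2 + i) y))
    T-braid i (j , s) = cong (_, s) (adj-braid (suc i) j)

    T-braid₄ : ∀ y → T 0 (T 1 (T 0 (T 1 y))) ≡ T 1 (T 0 (T 1 (T 0 y)))
    T-braid₄ (zero              , s) = refl
    T-braid₄ (suc zero          , s) = refl
    T-braid₄ (suc (suc zero)    , s) = refl
    T-braid₄ (suc (suc (suc j)) , s) = refl

    open Action T

    flip-sign : ∀ k s → act (flip k) (suc k , s) ≡ (suc k , not s)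
    flip-sign zero    s = refl
    flip-sign (suc k) s = begin
      T (suc k) (act (flip k ++ suc k ∷ []) (2 + k , s))  ≡⟨ cong (T (suc k)) (act-++ (flip k) _ _) ⟩
      T (suc k) (act (flip k) (adj (suc k) (2 + k) , s))
        ≡⟨ cong (λ j → T (suc k) (act (flip k) (j , s))) (adj-upper (suc k)) ⟩
      T (suc k) (act (flip k) (suc k , s))                ≡⟨ cong (T (suc k)) (flip-sign k s) ⟩
      (adj (suc k) (suc k) , not s)                       ≡⟨ cong (_, not s) (adj-lower (suc k)) ⟩
      (2 + k , not s) ∎
      where open ≡-Reasoning

    flip-fix : ∀ k {j} s → j ≢ k → act (flip k) (suc j , s) ≡ (suc j , s)
    flip-fix zero    {zero}  s j≢k = ⊥-elim (j≢k refl)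
    flip-fix zero    {suc j} s j≢k = refl
    flip-fix (suc k) {j} s j≢1+k = begin
      T (suc k) (act (flip k ++ suc k ∷ []) (suc j , s))  ≡⟨ cong (T (suc k)) (act-++ (flip k) _ _) ⟩
      T (suc k) (act (flip k) (suc (adj k j) , s))        ≡⟨ cong (T (suc k)) (flip-fix k s adj≢k) ⟩
      (suc (adj k (adj k j)) , s)
        ≡⟨ cong (λ x → suc x , s) (adj-involutive k j) ⟩
      (suc j , s) ∎
      where
      open ≡-Reasoning
      adj≢k : adj k j ≢ k
      adj≢k eq = j≢1+k (trans (sym (adj-involutive k j)) (trans (cong (adj k) eq) (adj-lower k)))

    flip-zero : ∀ k s → act (flip k) (0 , s) ≡ (0 , h s)
    flip-zero zero    s = refl
    flip-zero (suc k) s = trans (cong (T (suc k)) (trans (act-++ (flip k) _ _) (flip-zero k s))) refl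

    longest-fix : ∀ {k j} s → k ≤ j → act (longest k) (suc j , s) ≡ (suc j , s)
    longest-fix {zero}  s k≤j = refl
    longest-fix {suc k} s k<j = trans (act-++ (flip k) _ _)
      (trans (cong (act (flip k)) (longest-fix s (<⇒≤ k<j))) (flip-fix k s (>⇒≢ k<j)))

    longest-sign : ∀ {k j} s → j < k → act (longest k) (suc j , s) ≡ (suc j , not s)
    longest-sign {suc k} {j} s j<1+k with j ≟ k
    ... | yes refl = trans (act-++ (flip k) _ _) (trans (cong (act (flip k)) (longest-fix s ≤-refl)) (flip-sign k s))
    ... | no j≢k   = trans (act-++ (flip k) _ _)
      (trans (cong (act (flip k)) (longest-sign s (≤∧≢⇒< (s≤s⁻¹ j<1+k) j≢k))) (flip-fix k (not s) j≢k))

    longest-zero : ∀ k s → ∃ λ s′ → act (longest k) (0 , s) ≡ (0 , s′)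
    longest-zero zero    s = s , refl
    longest-zero (suc k) s with longest-zero k s
    ... | s′ , eq = h s′ , trans (act-++ (flip k) _ _) (trans (cong (act (flip k)) eq) (flip-zero k s′))

    -- `At` labels points by signed coordinates and need not reach every label: in A_{2n-1} no point
    -- has coordinate 0. Injectivity of the labelling and faithfulness of the action suffice to pull
    -- relations back.
    module Represented {G : Set} (_·_ : G → G → G) (e : G) {P : Set} (apply : G → P → P)
      (apply-· : ∀ x y p → apply (x · y) p ≡ apply x (apply y p))
      (faithful : ∀ {x y} → (∀ p → apply x p ≡ apply y p) → x ≡ y)
      (At : P → ℕ × Bool → Set)
      (coordinate : ∀ p → ∃ (At p))
      (At-injective : ∀ {p p′ y} → At p y → At p′ y → p ≡ p′)
      (n : ℕ) (r : ℕ → G)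
      (r-T : ∀ {i p y} → i < n → At p y → At (apply (r i) p) (T i y))
      where
      module R = Action (λ i → r i ·_)

      act-T : ∀ {w x p y} → All (_< n) w → At (apply x p) y → At (apply (R.act w x) p) (act w y)
      act-T []                         at = at
      act-T {i ∷ w} {x} {p} (i<n ∷ w<n) at =
        subst (λ q → At q _) (sym (apply-· (r i) (R.act w x) p)) (r-T i<n (act-T w<n at))

      relation : ∀ {u v} → All (_< n) u → All (_< n) v → (∀ y → act u y ≡ act v y) →
        ∀ x → R.act u x ≡ R.act v x
      relation u<n v<n eq x = faithful λ p → let y , at = coordinate (apply x p) in
        At-injective (act-T u<n at) (subst (At _) (sym (eq y)) (act-T v<n at))

      square : ∀ {i} → i < n → ∀ x → r i · (r i · x) ≡ x
      square {i} i<n = relation {i ∷ i ∷ []} {[]} (i<n ∷ i<n ∷ []) [] (T-square i)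

      commute : ∀ {i j} → suc i < j → j < n → ∀ x → r i · (r j · x) ≡ r j · (r i · x)
      commute {i} {j} i<j j<n = relation {i ∷ j ∷ []} {j ∷ i ∷ []}
        (i<n ∷ j<n ∷ []) (j<n ∷ i<n ∷ []) (T-commute i<j)
        where i<n = <-trans (<-trans (n<1+n i) i<j) j<n

      braid : ∀ {i} → 2 + i < n → ∀ x →
        r (1 + i) · (r (2 + i) · (r (1 + i) · x)) ≡ r (2 + i) · (r (1 + i) · (r (2 + i) · x))
      braid {i} i<n = relation {1 + i ∷ 2 + i ∷ 1 + i ∷ []} {2 + i ∷ 1 + i ∷ 2 + i ∷ []}
        (<⇒≤ i<n ∷ i<n ∷ <⇒≤ i<n ∷ []) (i<n ∷ <⇒≤ i<n ∷ i<n ∷ []) (T-braid i)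

      braid₄ : 1 < n → ∀ x → r 0 · (r 1 · (r 0 · (r 1 · x))) ≡ r 1 · (r 0 · (r 1 · (r 0 · x)))
      braid₄ 1<n = relation {0 ∷ 1 ∷ 0 ∷ 1 ∷ []} {1 ∷ 0 ∷ 1 ∷ 0 ∷ []}
        (<⇒≤ 1<n ∷ 1<n ∷ <⇒≤ 1<n ∷ 1<n ∷ []) (1<n ∷ <⇒≤ 1<n ∷ 1<n ∷ <⇒≤ 1<n ∷ []) T-braid₄

-- Permutations in one-line notation and the inversion bound.

module Permutations where
  open SignedModel

  lookup-∘P : ∀ {m} (σ τ : Perm m) i → lookup (σ ∘P τ) i ≡ lookup σ (lookup τ i)
  lookup-∘P σ τ = lookup∘tabulate _

  lookup-ext : ∀ {A : Set} {m} {u v : Vec A m} → (∀ i → lookup u i ≡ lookup v i) → u ≡ v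
  lookup-ext {u = u} {v} eq = trans (sym (tabulate∘lookup u)) (trans (tabulate-cong eq) (tabulate∘lookup v))

  ∘P-assoc : ∀ {m} (ρ σ τ : Perm m) → (ρ ∘P σ) ∘P τ ≡ ρ ∘P (σ ∘P τ)
  ∘P-assoc ρ σ τ = tabulate-cong λ i →
    trans (lookup-∘P ρ σ (lookup τ i)) (cong (lookup ρ) (sym (lookup-∘P σ τ i)))

  ∘P-identityˡ : ∀ {m} (σ : Perm m) → idP ∘P σ ≡ σ
  ∘P-identityˡ σ = trans (tabulate-cong λ i → lookup∘tabulate (λ j → j) (lookup σ i)) (tabulate∘lookup σ)

  ∘P-identityʳ : ∀ {m} (σ : Perm m) → σ ∘P idP ≡ σ
  ∘P-identityʳ σ = trans (tabulate-cong λ i → cong (lookup σ) (lookup∘tabulate (λ j → j) i)) (tabulate∘lookup σ)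

  sA-adj : ∀ {N k} → k < N → ∀ i → toℕ (lookup (sA N (suc k)) i) ≡ adj k (toℕ i)
  sA-adj {N} {k} k<N i with k <? N
  ... | no k≮N = ⊥-elim (k≮N k<N)
  ... | yes p = trans (cong toℕ (lookup∘tabulate exchange i)) (swapped (i Fin.≟ a) (i Fin.≟ b))
    where
    a b : Fin (suc N)
    a = inject₁ (fromℕ< p)
    b = Fin.suc (fromℕ< p)
    toℕ-a : toℕ a ≡ k
    toℕ-a = trans (Fin.toℕ-inject₁ _) (Fin.toℕ-fromℕ< p)
    toℕ-b : toℕ b ≡ suc k
    toℕ-b = cong suc (Fin.toℕ-fromℕ< p)
    exchange : Fin (suc N) → Fin (suc N)
    exchange j = if does (j Fin.≟ a) then b else if does (j Fin.≟ b) then a else j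
    swapped : ∀ (i≟a : Dec (i ≡ a)) (i≟b : Dec (i ≡ b)) →
      toℕ (if does i≟a then b else if does i≟b then a else i) ≡ adj k (toℕ i)
    swapped (yes refl) _          = trans toℕ-b (sym (trans (cong (adj k) toℕ-a) (adj-lower k)))
    swapped (no _)     (yes refl) = trans toℕ-a (sym (trans (cong (adj k) toℕ-b) (adj-upper k)))
    swapped (no i≢a)   (no i≢b)   = sym (adj-fix
      (λ eq → i≢a (Fin.toℕ-injective (trans eq (sym toℕ-a))))
      (λ eq → i≢b (Fin.toℕ-injective (trans eq (sym toℕ-b)))))

  m+2+n≡1+o⇒m<o : ∀ m n {o} → m + suc (suc n) ≡ suc o → m < o
  m+2+n≡1+o⇒m<o m n eq = ≤-trans (s≤s (m≤m+n m n)) (≤-reflexive (suc-injective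
    (trans (sym (trans (+-suc m (suc n)) (cong suc (+-suc m n)))) eq)))

  ∈-fromTo⁺ : ∀ {i m} → 1 ≤ i → i ≤ m → i ∈ fromTo 1 m
  ∈-fromTo⁺ {suc i} _ i≤m = ∈-map⁺ suc (∈-upTo⁺ i≤m)

  ∈-fromTo⁻ : ∀ {i m} → i ∈ fromTo 1 m → ∃ λ j → i ≡ suc j × j < m
  ∈-fromTo⁻ i∈ with ∈-map⁻ suc i∈
  ... | j , j∈ , eq = j , eq , ∈-upTo⁻ j∈

  -- The folding generators in the order t₀ = φ(rₙ), t₁ = φ(rₙ₋₁), ….
  module Reindex {G : Set} (g : ℕ → G) (t₀ : G) (n : ℕ) where
    generator : ℕ → G
    generator zero    = t₀
    generator (suc k) = g (n ∸ suc k)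

    generators : List G
    generators = map g (fromTo 1 (n ∸ 1)) ++ (t₀ ∷ [])

    generator-∈ : ∀ {i} → i < n → generator i ∈ generators
    generator-∈ {zero}  i<n = ∈-++⁺ʳ _ (here refl)
    generator-∈ {suc i} i<n = ∈-++⁺ˡ (∈-map⁺ g (∈-fromTo⁺ (m<n⇒0<n∸m i<n) (∸-monoʳ-≤ n (s≤s (z≤n {i})))))

    ∈-generator : 1 ≤ n → ∀ {x} → x ∈ generators → ∃ λ i → i < n × x ≡ generator i
    ∈-generator 1≤n x∈ with ∈-++⁻ (map g (fromTo 1 (n ∸ 1))) x∈
    ... | inj₂ (here refl) = 0 , 1≤n , refl
    ... | inj₁ x∈′ with ∈-map⁻ g x∈′
    ...   | i , i∈ , refl with ∈-fromTo⁻ i∈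
    ∈-generator (s≤s {n = n} _) x∈ | inj₁ x∈′ | _ , i∈ , refl | j , refl , j<n =
      n ∸ j , s≤s (m∸n≤m n j) , cong-generator (m<n⇒0<n∸m j<n) refl
      where
      -- `generator` reduces only at a literal successor, so `n ∸ j` is first generalised to a
      -- positive `k`.
      cong-generator : ∀ {k} → 1 ≤ k → n ∸ j ≡ k → g (suc j) ≡ generator (n ∸ j)
      cong-generator {suc k} _ eq = trans
        (cong g (sym (trans (cong (suc n ∸_) (sym eq)) (trans (+-∸-assoc 1 (m∸n≤m n j)) (cong suc (m∸[m∸n]≡n (<⇒≤ j<n)))))))
        (cong generator (sym eq))

  bit : Bool → ℕ
  bit true  = 1
  bit false = 0

  inversion : ℕ → ℕ → ℕ
  inversion a b = bit (b <ᵇ a)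

  -- The number m (m - 1) / 2 of pairs of positions, so `triangle (suc N)` counts the positive roots
  -- of A_N.
  triangle : ℕ → ℕ
  triangle zero    = 0
  triangle (suc m) = m + triangle m

  module Inversions where
    open PairStatistic inversion

    bit-≤ : ∀ b c → bit b ≤ suc (bit c)
    bit-≤ true  c = s≤s z≤n
    bit-≤ false c = z≤n

    <ᵇ-true : ∀ {m n} → m < n → (m <ᵇ n) ≡ true
    <ᵇ-true {zero}  {suc n} m<n = refl
    <ᵇ-true {suc m} {suc n} m<n = <ᵇ-true (s<s⁻¹ m<n)

    <ᵇ-false : ∀ {m n} → n ≤ m → (m <ᵇ n) ≡ false
    <ᵇ-false {m}     {zero}  n≤m = refl
    <ᵇ-false {suc m} {suc n} n≤m = <ᵇ-false (s≤s⁻¹ n≤m)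

    stat-increasing : ∀ m c → stat m (c +_) ≡ 0
    stat-increasing zero    c = refl
    stat-increasing (suc m) c = cong₂ _+_
      (trans (row-const m (c + 0) 0 (λ {i} i<m → cong bit (<ᵇ-false (+-monoʳ-≤ c z≤n)))) (*-zeroʳ m))
      (trans (stat-cong m (λ {i} _ → +-suc c i)) (stat-increasing m (suc c)))

    stat-reverse : ∀ m → stat (suc m) (m ∸_) ≡ triangle (suc m)
    stat-reverse zero    = refl
    stat-reverse (suc m) = cong₂ _+_
      (trans (row-const (suc m) (suc m) 1 {m ∸_} (λ {i} _ → cong bit (<ᵇ-true (s≤s (m∸n≤m m i))))) (*-identityʳ (suc m)))
      (stat-reverse m)

    module _ (N : ℕ) where
      Rep : Perm (suc N) → (ℕ → ℕ) → Set
      Rep σ F = ∀ i → toℕ (lookup σ i) ≡ F (toℕ i)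

      step : ∀ {σ F s} → s ∈ coxA N → Rep σ F →
        ∃ λ F′ → Rep (σ ∘P s) F′ × stat (suc N) F′ ≤ suc (stat (suc N) F)
      step {σ} {F} s∈ rep with ∈-map⁻ (sA N) s∈
      ... | _ , k∈ , refl with ∈-fromTo⁻ k∈
      ...   | k , refl , k<N = F ∘ adj k ,
        (λ i → trans (cong toℕ (lookup-∘P σ (sA N (suc k)) i)) (trans (rep (lookup (sA N (suc k)) i)) (cong F (sA-adj k<N i)))) ,
        stat-adj (λ a b → bit-≤ (a <ᵇ b) (b <ᵇ a)) F (s<s k<N)

      open Words {Perm (suc N)} _∘P_ idP
      -- Shared by both foldings of type A and by the dihedral groups, since their longest elements
      -- all act as the reversal.
      reversal-bound : ∀ w → All (_∈ coxA N) w → (∀ i → toℕ (lookup (prod w) i) ≡ N ∸ toℕ i) →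
        triangle (suc N) ≤ length w
      reversal-bound w w∈ reversal
        with LengthBound.word-bound _∘P_ idP ∘P-assoc ∘P-identityʳ (coxA N) Rep (stat (suc N))
          (λ {σ} {F} → step {σ} {F}) {idP} {λ i → i} w∈ (λ i → cong toℕ (lookup∘tabulate (λ j → j) i))
      ... | F , rep , F≤ = begin
        triangle (suc N)                      ≡⟨ stat-reverse N ⟨
        stat (suc N) (N ∸_)                   ≡⟨ stat-cong (suc N) (λ i<N → sym (F-reversal i<N)) ⟩
        stat (suc N) F                        ≤⟨ F≤ ⟩
        length w + stat (suc N) (λ i → i)     ≡⟨ cong (length w +_) (stat-increasing (suc N) 0) ⟩
        length w + 0                          ≡⟨ +-identityʳ _ ⟩
        length w ∎
        where
        open ≤-Reasoning
        F-reversal : ∀ {i} → i < suc N → F i ≡ N ∸ i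
        F-reversal {i} i<N = begin-equality
          F i                                       ≡⟨ cong F (Fin.toℕ-fromℕ< i<N) ⟨
          F (toℕ j)                                 ≡⟨ rep j ⟨
          toℕ (lookup (idP ∘P prod w) j)
            ≡⟨ cong (λ σ → toℕ (lookup σ j)) (∘P-identityˡ (prod w)) ⟩
          toℕ (lookup (prod w) j)                   ≡⟨ reversal j ⟩
          N ∸ toℕ j                                 ≡⟨ cong (N ∸_) (Fin.toℕ-fromℕ< i<N) ⟩
          N ∸ i ∎
          where j = fromℕ< i<N

-- Centrally symmetric permutations as signed permutations.

module SymmetricPermutations where
  open CosetWords
  open LengthsAndEnumeration
  open SignedModel
  open Permutations
  open QIntegers

  sA∈coxA : ∀ {N k} → 1 ≤ k → k ≤ N → sA N k ∈ coxA N
  sA∈coxA {N} 1≤k k≤N = ∈-map⁺ (sA N) (∈-fromTo⁺ 1≤k k≤N)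

  -- The signed coordinates (j , true) and (j , false) are the positions n − j and c + j,
  -- counted from 0; c = n − 1 for A_{2n-1}, without coordinate 0, and c = n for A_{2n}.
  module SymmetricPositions (N n c : ℕ) (N≡ : N ≡ n + c) (n≤1+c : n ≤ suc c) where

    -- For j ≥ 1 the condition `n ≤ c + j` is automatic. At j = 0 it demands c = n, given `c ≤ n`;
    -- then both signs label the central position.
    At : Fin (suc N) → ℕ × Bool → Set
    At i (j , true)  = n ≤ c + j × toℕ i + j ≡ n
    At i (j , false) = n ≤ c + j × toℕ i ≡ c + j

    At-injective : ∀ {i i′ y} → At i y → At i′ y → i ≡ i′
    At-injective {y = j , true}  (_ , eq) (_ , eq′) = Fin.toℕ-injective (+-cancelʳ-≡ j _ _ (trans eq (sym eq′)))
    At-injective {y = j , false} (_ , eq) (_ , eq′) = Fin.toℕ-injective (trans eq (sym eq′))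

    module _ (c≤n : c ≤ n) where
      coordinate : ∀ i → ∃ (At i)
      coordinate i with c ≤? toℕ i | n ≤? toℕ i
      ... | yes c≤i | yes n≤i = (toℕ i ∸ c , false) , subst (n ≤_) (sym eq) n≤i , sym eq
        where eq = m+[n∸m]≡n c≤i
      ... | _ | no n≰i = (n ∸ toℕ i , true) , n≤ , m+[n∸m]≡n i≤n
        where
        i≤n = <⇒≤ (≰⇒> n≰i)
        n≤ : n ≤ c + (n ∸ toℕ i)
        n≤ = subst (_≤ c + (n ∸ toℕ i)) (m+[n∸m]≡n i≤n) (+-monoˡ-≤ (n ∸ toℕ i) (s≤s⁻¹ (≤-trans (≰⇒> n≰i) n≤1+c)))
      ... | no c≰i | yes n≤i = ⊥-elim (c≰i (≤-trans c≤n n≤i))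

    -- `n + suc c` is N + 1, which is 2n for A_{2n-1} and 2n + 1 for A_{2n}, so one formula serves
    -- both foldings.
    g : ℕ → Perm (suc N)
    g i = sA N i ∘P sA N (n + suc c ∸ i)

    position-bound : ∀ {k} → suc k < n → c + suc k < N
    position-bound {k} k<n = subst (c + suc k <_) (trans (+-comm c n) (sym N≡)) (+-monoʳ-< c k<n)

    g-adj : ∀ {k} → suc k < n → ∀ i →
      toℕ (lookup (g (n ∸ suc k)) i) ≡ adj (n ∸ suc (suc k)) (adj (c + suc k) (toℕ i))
    g-adj {k} k<n i = begin
      toℕ (lookup (g (n ∸ suc k)) i)
        ≡⟨ cong toℕ (lookup-∘P (sA N (n ∸ suc k)) (sA N (n + suc c ∸ (n ∸ suc k))) i) ⟩
      toℕ (lookup (sA N (n ∸ suc k)) (lookup (sA N (n + suc c ∸ (n ∸ suc k))) i))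
        ≡⟨ cong₂ (λ x y → toℕ (lookup (sA N x) (lookup (sA N y) i))) left right ⟩
      toℕ (lookup (sA N (suc (n ∸ suc (suc k)))) (lookup (sA N (suc (c + suc k))) i))
        ≡⟨ sA-adj (<-≤-trans (∸-monoʳ-< {n} {suc (suc k)} {0} z<s k<n) (subst (n ≤_) (sym N≡) (m≤m+n n c))) _ ⟩
      adj (n ∸ suc (suc k)) (toℕ (lookup (sA N (suc (c + suc k))) i))
        ≡⟨ cong (adj (n ∸ suc (suc k))) (sA-adj (position-bound k<n) i) ⟩
      adj (n ∸ suc (suc k)) (adj (c + suc k) (toℕ i)) ∎
      where
      open ≡-Reasoning
      left : n ∸ suc k ≡ suc (n ∸ suc (suc k))
      left = +-∸-assoc 1 k<n
      right : n + suc c ∸ (n ∸ suc k) ≡ suc (c + suc k)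
      right = begin
        n + suc c ∸ (n ∸ suc k)
          ≡⟨ cong (λ m → m + suc c ∸ (n ∸ suc k)) (m∸n+n≡m (<⇒≤ k<n)) ⟨
        n ∸ suc k + suc k + suc c ∸ (n ∸ suc k)
          ≡⟨ cong (_∸ (n ∸ suc k)) (+-assoc (n ∸ suc k) (suc k) (suc c)) ⟩
        n ∸ suc k + (suc k + suc c) ∸ (n ∸ suc k)       ≡⟨ m+n∸m≡n (n ∸ suc k) _ ⟩
        suc k + suc c                                   ≡⟨ +-comm (suc k) (suc c) ⟩
        suc (c + suc k) ∎

    -- Negative coordinates lie at positions up to c, out of reach of the right transposition;
    -- positive ones lie at n or above, out of reach of the left. Each side sees exactly one of the
    -- two.
    g-At : ∀ {k i j s} → suc k < n → At i (j , s) → At (lookup (g (n ∸ suc k)) i) (adj (suc k) j , s)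
    g-At {k} {i} {j} {s} k<n = go s
      where
      open ≡-Reasoning
      a = n ∸ suc (suc k)
      a+k : a + suc (suc k) ≡ n
      a+k = m∸n+n≡m k<n
      valid : ∀ {j} → n ≤ c + j → n ≤ c + adj (suc k) j
      valid {zero}  n≤ = n≤
      valid {suc j} n≤ = ≤-trans n≤1+c (subst (_≤ c + suc (adj k j)) (+-comm c 1) (+-monoʳ-≤ c (s≤s z≤n)))
      go : ∀ s → At i (j , s) → At (lookup (g (n ∸ suc k)) i) (adj (suc k) j , s)
      go true (n≤ , eq) = valid n≤ , (begin
        toℕ (lookup (g (n ∸ suc k)) i) + adj (suc k) j
          ≡⟨ cong (_+ adj (suc k) j) (g-adj k<n i) ⟩
        adj a (adj (c + suc k) (toℕ i)) + adj (suc k) j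
          ≡⟨ cong (λ x → adj a x + adj (suc k) j) (adj-< i<) ⟩
        adj a (toℕ i) + adj (suc k) j                         ≡⟨ adj-reflect a+k eq ⟩
        n ∎)
        where
        c<c+1+k : c < c + suc k
        c<c+1+k = ≤-trans (≤-reflexive (+-comm 1 c)) (+-monoʳ-≤ c (s≤s z≤n))
        i≤c : ∀ j → n ≤ c + j → toℕ i + j ≡ n → toℕ i ≤ c
        i≤c zero    n≤ eq =
          ≤-trans (m≤m+n _ 0) (≤-trans (≤-reflexive eq) (≤-trans n≤ (≤-reflexive (+-identityʳ c))))
        i≤c (suc j) n≤ eq = s≤s⁻¹ (≤-trans (s≤s (m≤m+n (toℕ i) j))
          (≤-trans (≤-reflexive (trans (sym (+-suc (toℕ i) j)) eq)) n≤1+c))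
        i< : toℕ i < c + suc k
        i< = ≤-<-trans (i≤c j n≤ eq) c<c+1+k
      go false (n≤ , eq) = valid n≤ , (begin
        toℕ (lookup (g (n ∸ suc k)) i)            ≡⟨ g-adj k<n i ⟩
        adj a (adj (c + suc k) (toℕ i))           ≡⟨ cong (adj a ∘ adj (c + suc k)) eq ⟩
        adj a (adj (c + suc k) (c + j))           ≡⟨ cong (adj a) (adj-shift c (suc k) j) ⟩
        adj a (c + adj (suc k) j)                 ≡⟨ adj-> (<-≤-trans a< (valid n≤)) ⟩
        c + adj (suc k) j ∎)
        where
        a< : suc a < n
        a< =
          subst (suc a <_) a+k (subst (suc a <_) (sym (+-suc a (suc k))) (s≤s (subst (suc a ≤_) (sym (+-suc a k)) (s≤s (m≤m+n a k)))))

    -- What distinguishes the two foldings enters as arguments: the image `t₀` of rₙ with a word of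
    -- length `b`, its effect on coordinates, and the resulting total weight.
    module Statistics (c≤n : c ≤ n) (1≤n : 1 ≤ n) (b : ℕ) (1≤b : 1 ≤ b)
      (t₀ : Perm (suc N)) (word₀ : List (Perm (suc N)))
      (word₀-S : All (_∈ coxA N) word₀) (word₀-t₀ : Words.prod _∘P_ idP word₀ ≡ t₀) (word₀-length : length word₀ ≡ b)
      (h : Bool → Bool) (h-involutive : ∀ s → h (h s) ≡ s)
      (t₀-At : ∀ {i y} → At i y → At (lookup t₀ i) (SignedCoordinates.T h h-involutive 0 y))
      (wt-longest : Weights.wt 2 b (longest n) ≡ triangle (suc N))
      (ℓ : Perm (suc N) → ℕ) (isLength : Words.IsLength _∘P_ idP (coxA N) ℓ)
      where
      open Words {Perm (suc N)} _∘P_ idP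
      open Reindex g t₀ n
      open Weights 2 b
      open SignedCoordinates h h-involutive using (T; longest-sign; longest-zero)

      word : ℕ → List (Perm (suc N))
      word zero    = word₀
      word (suc k) = sA N (n ∸ suc k) ∷ sA N (n + suc c ∸ (n ∸ suc k)) ∷ []

      word-S : ∀ {i} → i < n → All (_∈ coxA N) (word i)
      word-S {zero}  _   = word₀-S
      word-S {suc k} k<n = sA∈coxA (m<n⇒0<n∸m k<n) (≤-trans (m∸n≤m n (suc k)) (subst (n ≤_) (sym N≡) (m≤m+n n c)))
        ∷ sA∈coxA (≤-trans 1≤n+1+c∸n (∸-monoʳ-≤ (n + suc c) (m∸n≤m n (suc k)))) bound
        ∷ []
        where
        1≤n+1+c∸n : 1 ≤ n + suc c ∸ n
        1≤n+1+c∸n = subst (1 ≤_) (sym (m+n∸m≡n n (suc c))) (s≤s z≤n)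
        bound : n + suc c ∸ (n ∸ suc k) ≤ N
        bound = ≤-trans (∸-monoʳ-≤ (n + suc c) (m<n⇒0<n∸m k<n))
          (≤-reflexive (trans (cong (_∸ 1) (+-suc n c)) (sym N≡)))

      word-generator : ∀ {i} → i < n → prod (word i) ≡ generator i
      word-generator {zero}  _   = word₀-t₀
      word-generator {suc k} k<n = cong (sA N (n ∸ suc k) ∘P_) (∘P-identityʳ (sA N (n + suc c ∸ (n ∸ suc k))))

      word-length : ∀ {i} → i < n → length (word i) ≡ weight i
      word-length {zero}  _ = word₀-length
      word-length {suc k} _ = refl

      generator-At : ∀ {i p y} → i < n → At p y → At (lookup (generator i) p) (T i y)
      generator-At {zero}              _   at = t₀-At at
      generator-At {suc k} {y = j , s} k<n at = g-At {s = s} k<n at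

      module Rep = SignedCoordinates.Represented h h-involutive _∘P_ idP lookup lookup-∘P lookup-ext
        At (coordinate c≤n) (λ {p} {p′} {y} → At-injective {p} {p′} {y}) n generator
        (λ {i} {p} {y} → generator-At {i} {p} {y})

      open Folding {Perm (suc N)} _∘P_ idP ∘P-assoc ∘P-identityˡ ∘P-identityʳ (coxA N) ℓ isLength
        2 b n generator word word-S word-generator word-length

      open Action (λ i → generator i ∘P_) using (act)

      -- A change of sign exchanges the positions n - j and c + j, whose sum is N. A centre, if
      -- present, satisfies n = c and is its own mirror image.
      reversal : ∀ i → toℕ (lookup (act (longest n) idP) i) ≡ N ∸ toℕ i
      reversal i =
        trans (sym (m+n∸m≡n (toℕ i) _)) (cong (_∸ toℕ i) (trans (total y at (act-T (longest-letters n) (subst (λ p → At p y) (sym (lookup∘tabulate id i)) at))) (sym N≡)))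
        where
        open Rep using (act-T)
        y = proj₁ (coordinate c≤n i)
        at = proj₂ (coordinate c≤n i)
        i′ = lookup (act (longest n) idP) i
        centre : ∀ {i s} → At i (0 , s) → toℕ i ≡ n × toℕ i ≡ c
        centre {i} {true} (n≤ , eq) = i≡n , trans i≡n (≤-antisym (≤-trans n≤ (≤-reflexive (+-identityʳ c))) c≤n)
          where i≡n = trans (sym (+-identityʳ _)) eq
        centre {i} {false} (n≤ , eq) = trans i≡c (≤-antisym c≤n (≤-trans n≤ (≤-reflexive (+-identityʳ c)))) , i≡c
          where i≡c = trans eq (+-identityʳ c)
        total : ∀ y → At i y → At i′ (Action.act T (longest n) y) → toℕ i + toℕ i′ ≡ n + c
        total (zero , s) at at′ with longest-zero n s
        ... | s′ , eq = cong₂ _+_ (proj₁ (centre {s = s} at)) (proj₂ (centre {s = s′} (subst (At i′) eq at′)))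
        total (suc j , true) at@(_ , eq) at′ with subst (At i′) (longest-sign true j<n) at′
          where
          j<n : j < n
          j<n = ≤-trans (m≤n+m (suc j) (toℕ i)) (≤-reflexive eq)
        ... | _ , eq′ = trans (cong (toℕ i +_) eq′) (trans (lemma (toℕ i) c (suc j)) (cong (_+ c) eq))
          where
          lemma : ∀ x c j → x + (c + j) ≡ x + j + c
          lemma = solve-∀
        total (suc j , false) at@(_ , eq) at′ with subst (At i′) (longest-sign false j<n) at′
          where
          j<n : j < n
          j<n =
            +-cancelˡ-≤ c _ _ (≤-trans (≤-reflexive (sym eq)) (≤-trans (s≤s⁻¹ (Fin.toℕ<n i)) (≤-reflexive (trans N≡ (+-comm n c)))))
        ... | _ , eq′ = trans (cong (_+ toℕ i′) eq) (trans (lemma c (suc j) (toℕ i′)) (cong (_+ c) eq′))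
          where
          lemma : ∀ c j x → c + j + x ≡ x + j + c
          lemma = solve-∀

      bound : ∀ v → All (_∈ coxA N) v → prod v ≡ act (longest n) idP → wt (longest n) ≤ length v
      bound v v-S eq = subst (_≤ length v) (sym wt-longest)
        (Inversions.reversal-bound N v v-S λ i → trans (cong (λ σ → toℕ (lookup σ i)) eq) (reversal i))

      open Count (s≤s z≤n) 1≤b Rep.square Rep.commute Rep.braid Rep.braid₄ bound

      statistic : ∀ {L} → Unique L → (∀ x → (x ∈ L) ⇔ Gen generators x) → U ℓ L ≈P poincare (X 2) (X b) n
      statistic L! L⇔Gen = gf-enumeration 2 b ℓ (λ w → act w idP) n
        (enumeration generator-∈ (∈-generator 1≤n) L! L⇔Gen) ℓ-element

-- The foldings of A_{2n-1} and A_{2n}.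

module FoldingsOfA where
  open CosetWords
  open SignedModel
  open Permutations
  open QIntegers
  open SymmetricPermutations

  statistic-odd : ∀ n → 1 ≤ n →
    ∀ (ℓ : Perm (suc (2 * n ∸ 1)) → ℕ) (L : List (Perm (suc (2 * n ∸ 1)))) →
    Words.IsLength _∘P_ idP (coxA (2 * n ∸ 1)) ℓ → Unique L →
    (∀ x → (x ∈ L) ⇔ Words.Gen _∘P_ idP (foldB-A-odd n) x) →
    Words.U _∘P_ idP ℓ L ≈P poincare (X 2) (X 1) n
  statistic-odd (suc c) 1≤n ℓ L isLength L! L⇔Gen = Statistics.statistic (n≤1+n c) 1≤n 1 ≤-refl
    (sA N (suc c)) (sA N (suc c) ∷ []) (sA∈coxA (s≤s z≤n) 1+c≤N ∷ []) (∘P-identityʳ (sA N (suc c))) refl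
    id (λ _ → refl) (λ {i} {y} → t₀-At {i} {y}) (trans (wt-longest (suc c)) (cong triangle (sym (double c))))
    ℓ isLength L! (λ x → subst (λ T → x ∈ L ⇔ Words.Gen _∘P_ idP T x) generators≡ (L⇔Gen x))
    where
    N = 2 * suc c ∸ 1
    N≡ : N ≡ suc c + c
    N≡ = trans (cong (c +_) (+-identityʳ (suc c))) (+-comm c (suc c))
    double : ∀ c → suc (2 * suc c ∸ 1) ≡ suc c + suc c
    double c = cong suc (cong (c +_) (+-identityʳ (suc c)))
    open SymmetricPositions N (suc c) c N≡ ≤-refl
    1+c≤N : suc c ≤ N
    1+c≤N = subst (suc c ≤_) (sym N≡) (m≤m+n (suc c) c)
    generators≡ : foldB-A-odd (suc c) ≡ Reindex.generators g (sA N (suc c)) (suc c)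
    generators≡ = cong (λ m → Reindex.generators (λ i → sA N i ∘P sA N (m ∸ i)) (sA N (suc c)) (suc c))
      (cong (suc c +_) (+-identityʳ (suc c)))
    -- Counted from 0, sₙ exchanges the positions c and c + 1, which carry coordinate 1 with signs -
    -- and +. Coordinate 0 would require `suc c ≤ c`.
    t₀-At : ∀ {i y} → At i y → At (lookup (sA N (suc c)) i) (SignedCoordinates.T id (λ _ → refl) 0 y)
    t₀-At {i} {zero , true}  (n≤ , _)  = ⊥-elim (1+n≰n (≤-trans n≤ (≤-reflexive (+-identityʳ c))))
    t₀-At {i} {zero , false} (n≤ , _)  = ⊥-elim (1+n≰n (≤-trans n≤ (≤-reflexive (+-identityʳ c))))
    t₀-At {i} {suc zero , true} (n≤ , eq) = n≤ , (begin
      toℕ (lookup (sA N (suc c)) i)     ≡⟨ sA-adj 1+c≤N i ⟩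
      adj c (toℕ i)
        ≡⟨ cong (adj c) (+-cancelʳ-≡ 1 (toℕ i) c (trans eq (+-comm 1 c))) ⟩
      adj c c                           ≡⟨ adj-lower c ⟩
      suc c                             ≡⟨ +-comm 1 c ⟩
      c + 1 ∎)
      where open ≡-Reasoning
    t₀-At {i} {suc zero , false} (n≤ , eq) = n≤ , (begin
      toℕ (lookup (sA N (suc c)) i) + 1 ≡⟨ cong (_+ 1) (sA-adj 1+c≤N i) ⟩
      adj c (toℕ i) + 1                 ≡⟨ cong (λ x → adj c x + 1) (trans eq (+-comm c 1)) ⟩
      adj c (suc c) + 1                 ≡⟨ cong (_+ 1) (adj-upper c) ⟩
      c + 1                             ≡⟨ +-comm c 1 ⟩
      suc c ∎)
      where open ≡-Reasoning
    t₀-At {i} {suc (suc j) , true} (n≤ , eq) =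
      n≤ , trans (cong (_+ suc (suc j)) (trans (sA-adj 1+c≤N i) (adj-< i<c))) eq
      where
      i<c = m+2+n≡1+o⇒m<o (toℕ i) j eq
    t₀-At {i} {suc (suc j) , false} (n≤ , eq) = n≤ , trans (trans (sA-adj 1+c≤N i) (adj-> 1+c<i)) eq
      where
      1+c<i : suc c < toℕ i
      1+c<i = subst (suc c <_) (sym (trans eq (trans (+-suc c _) (cong suc (+-suc c j))))) (s≤s (s≤s (m≤m+n c j)))
    -- `flip n` weighs 4n + 1 = 2n + (2n + 1), the step from `triangle` at 2n to `triangle` at 2n +
    -- 2.
    wt-longest : ∀ n → Weights.wt 2 1 (longest n) ≡ triangle (n + n)
    wt-longest zero    = refl
    wt-longest (suc n) = begin
      wt (flip n ++ longest n)                     ≡⟨ wt-++ (flip n) (longest n) ⟩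
      wt (flip n) + wt (longest n)                 ≡⟨ cong₂ _+_ (wt-flip-total n) (wt-longest n) ⟩
      1 + 2 * (n + n) + triangle (n + n)           ≡⟨ lemma (n + n) (triangle (n + n)) ⟩
      triangle (2 + (n + n))                       ≡⟨ cong (triangle ∘ suc) (+-suc n n) ⟨
      triangle (suc n + suc n) ∎
      where
      open ≡-Reasoning
      open Weights 2 1
      lemma : ∀ m t → 1 + 2 * m + t ≡ suc m + (m + t)
      lemma = solve-∀

  statistic-even : ∀ n → 1 ≤ n →
    ∀ (ℓ : Perm (suc (2 * n)) → ℕ) (L : List (Perm (suc (2 * n)))) →
    Words.IsLength _∘P_ idP (coxA (2 * n)) ℓ → Unique L →
    (∀ x → (x ∈ L) ⇔ Words.Gen _∘P_ idP (foldB-A-even n) x) →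
    Words.U _∘P_ idP ℓ L ≈P poincare (X 2) (X 3) n
  statistic-even (suc c) 1≤n ℓ L isLength L! L⇔Gen = Statistics.statistic ≤-refl 1≤n 3 (s≤s z≤n)
    t₀ (sA N n ∷ sA N (suc n) ∷ sA N n ∷ [])
    (sA∈coxA (s≤s z≤n) n≤N ∷ sA∈coxA (s≤s z≤n) 1+n≤N ∷ sA∈coxA (s≤s z≤n) n≤N ∷ [])
    (cong (λ σ → sA N n ∘P (sA N (suc n) ∘P σ)) (∘P-identityʳ (sA N n))) refl
    id (λ _ → refl) (λ {i} {y} → t₀-At {i} {y}) (trans (wt-longest n) (cong (triangle ∘ suc) (sym N≡)))
    ℓ isLength L! (λ x → subst (λ T → x ∈ L ⇔ Words.Gen _∘P_ idP T x) generators≡ (L⇔Gen x))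
    where
    open ≡-Reasoning
    n = suc c
    N = 2 * n
    t₀ = sA N n ∘P (sA N (suc n) ∘P sA N n)
    N≡ : N ≡ n + n
    N≡ = cong (n +_) (+-identityʳ n)
    open SymmetricPositions N n n N≡ (n≤1+n n)
    1+n≤N : suc n ≤ N
    1+n≤N = subst (suc n ≤_) (sym N≡) (+-monoˡ-≤ n (s≤s z≤n))
    n≤N : n ≤ N
    n≤N = <⇒≤ 1+n≤N
    generators≡ : foldB-A-even n ≡ Reindex.generators g t₀ n
    generators≡ = cong (λ m → Reindex.generators (λ i → sA N i ∘P sA N (m ∸ i)) t₀ n)
      (trans (cong suc N≡) (sym (+-suc n n)))
    -- The conjugate is the transposition of n - 1 and n + 1, the two positions of coordinate 1,
    -- around the fixed centre n. Its word of three letters gives b = 3.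
    t₀-adj : ∀ i → toℕ (lookup t₀ i) ≡ adj c (adj n (adj c (toℕ i)))
    t₀-adj i = begin
      toℕ (lookup t₀ i)
        ≡⟨ cong toℕ (lookup-∘P (sA N n) (sA N (suc n) ∘P sA N n) i) ⟩
      toℕ (lookup (sA N n) (lookup (sA N (suc n) ∘P sA N n) i))           ≡⟨ sA-adj n≤N _ ⟩
      adj c (toℕ (lookup (sA N (suc n) ∘P sA N n) i))
        ≡⟨ cong (adj c ∘ toℕ) (lookup-∘P (sA N (suc n)) (sA N n) i) ⟩
      adj c (toℕ (lookup (sA N (suc n)) (lookup (sA N n) i)))
        ≡⟨ cong (adj c) (sA-adj 1+n≤N _) ⟩
      adj c (adj n (toℕ (lookup (sA N n) i)))
        ≡⟨ cong (adj c ∘ adj n) (sA-adj n≤N i) ⟩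
      adj c (adj n (adj c (toℕ i))) ∎
    centre : adj c (adj n (adj c n)) ≡ n
    centre = begin
      adj c (adj n (adj c n))     ≡⟨ cong (adj c ∘ adj n) (adj-upper c) ⟩
      adj c (adj n c)             ≡⟨ cong (adj c) (adj-< ≤-refl) ⟩
      adj c c                     ≡⟨ adj-lower c ⟩
      n ∎
    t₀-At : ∀ {i y} → At i y → At (lookup t₀ i) (SignedCoordinates.T id (λ _ → refl) 0 y)
    t₀-At {i} {zero , true} (n≤ , eq) = n≤ , trans (+-identityʳ _) (trans (t₀-adj i)
      (trans (cong (adj c ∘ adj n ∘ adj c) (trans (sym (+-identityʳ _)) eq)) centre))
    t₀-At {i} {zero , false} (n≤ , eq) = n≤ , trans (t₀-adj i)
      (trans (cong (adj c ∘ adj n ∘ adj c) (trans eq (+-identityʳ n))) (trans centre (sym (+-identityʳ n))))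
    t₀-At {i} {suc zero , true} (n≤ , eq) = n≤ , (begin
      toℕ (lookup t₀ i)                 ≡⟨ t₀-adj i ⟩
      adj c (adj n (adj c (toℕ i)))
        ≡⟨ cong (adj c ∘ adj n ∘ adj c) (+-cancelʳ-≡ 1 (toℕ i) c (trans eq (+-comm 1 c))) ⟩
      adj c (adj n (adj c c))           ≡⟨ cong (adj c ∘ adj n) (adj-lower c) ⟩
      adj c (adj n n)                   ≡⟨ cong (adj c) (adj-lower n) ⟩
      adj c (suc n)                     ≡⟨ adj-> ≤-refl ⟩
      suc n                             ≡⟨ +-comm 1 n ⟩
      n + 1 ∎)
    t₀-At {i} {suc zero , false} (n≤ , eq) = n≤ , (begin
      toℕ (lookup t₀ i) + 1             ≡⟨ cong (_+ 1) (t₀-adj i) ⟩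
      adj c (adj n (adj c (toℕ i))) + 1
        ≡⟨ cong (λ x → adj c (adj n (adj c x)) + 1) (trans eq (+-comm n 1)) ⟩
      adj c (adj n (adj c (suc n))) + 1 ≡⟨ cong (λ x → adj c (adj n x) + 1) (adj-> {c} ≤-refl) ⟩
      adj c (adj n (suc n)) + 1         ≡⟨ cong (λ x → adj c x + 1) (adj-upper n) ⟩
      adj c n + 1                       ≡⟨ cong (_+ 1) (adj-upper c) ⟩
      c + 1                             ≡⟨ +-comm c 1 ⟩
      n ∎)
    t₀-At {i} {suc (suc j) , true} (n≤ , eq) = n≤ , trans (cong (_+ suc (suc j)) (trans (t₀-adj i) fixed)) eq
      where
      i<c = m+2+n≡1+o⇒m<o (toℕ i) j eq
      fixed : adj c (adj n (adj c (toℕ i))) ≡ toℕ i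
      fixed = trans (cong (adj c ∘ adj n) (adj-< i<c)) (trans (cong (adj c) (adj-< (m<n⇒m<1+n i<c))) (adj-< i<c))
    t₀-At {i} {suc (suc j) , false} (n≤ , eq) = n≤ , trans (trans (t₀-adj i) fixed) eq
      where
      1+n<i : suc n < toℕ i
      1+n<i = subst (suc n <_) (sym (trans eq (trans (+-suc n _) (cong suc (+-suc n j))))) (s≤s (s≤s (m≤m+n n j)))
      fixed : adj c (adj n (adj c (toℕ i))) ≡ toℕ i
      fixed = trans (cong (adj c ∘ adj n) (adj-> (<⇒≤ 1+n<i)))
        (trans (cong (adj c) (adj-> 1+n<i)) (adj-> (<⇒≤ 1+n<i)))
    -- Now `flip n` weighs 4n + 3 = (2n + 1) + (2n + 2), two consecutive terms again.
    wt-longest : ∀ n → Weights.wt 2 3 (longest n) ≡ triangle (suc (n + n))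
    wt-longest zero    = refl
    wt-longest (suc n) = begin
      wt (flip n ++ longest n)                     ≡⟨ wt-++ (flip n) (longest n) ⟩
      wt (flip n) + wt (longest n)                 ≡⟨ cong₂ _+_ (wt-flip-total n) (wt-longest n) ⟩
      3 + 2 * (n + n) + triangle (suc (n + n))     ≡⟨ lemma (n + n) (triangle (suc (n + n))) ⟩
      triangle (3 + (n + n))                       ≡⟨ cong (triangle ∘ suc ∘ suc) (+-suc n n) ⟨
      triangle (suc (suc n + suc n)) ∎
      where
      open Weights 2 3
      lemma : ∀ m t → 3 + 2 * m + t ≡ suc (suc m) + (suc m + t)
      lemma = solve-∀

-- The folding of D_{n+1}.

module FoldingOfD where
  open CosetWords
  open LengthsAndEnumeration
  open SignedModel
  open Permutations
  open QIntegers

  -- The action on signed points turns `∘S` into composition of functions, so the group laws follow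
  -- from faithfulness.
  apply : ∀ {m} → SPerm m → Fin m × Bool → Fin m × Bool
  apply σ (i , s) = proj₁ (lookup σ i) , s xor proj₂ (lookup σ i)

  lookup-∘S : ∀ {m} (σ τ : SPerm m) i → lookup (σ ∘S τ) i ≡ apply σ (lookup τ i)
  -- The local function in the definition of `_∘S_` cannot be named from outside; its value is
  -- reached by abstracting over the lookups it inspects.
  lookup-∘S σ τ i with lookup (σ ∘S τ) i in eq
  ... | x with lookup τ i | trans (sym (lookup∘tabulate _ i)) eq
  ...   | j , s | eq′ with lookup σ j | eq′
  ...     | k , t | refl = refl

  apply-∘S : ∀ {m} (σ τ : SPerm m) p → apply (σ ∘S τ) p ≡ apply σ (apply τ p)
  apply-∘S σ τ (i , s) = trans (cong (λ (j , t) → j , s xor t) (lookup-∘S σ τ i))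
    (cong (_ ,_) (sym (xor-assoc s _ _)))

  apply-ext : ∀ {m} {σ τ : SPerm m} → (∀ p → apply σ p ≡ apply τ p) → σ ≡ τ
  apply-ext eq = lookup-ext λ i → eq (i , false)

  ∘S-assoc : ∀ {m} (ρ σ τ : SPerm m) → (ρ ∘S σ) ∘S τ ≡ ρ ∘S (σ ∘S τ)
  ∘S-assoc ρ σ τ = apply-ext λ p → begin
    apply ((ρ ∘S σ) ∘S τ) p             ≡⟨ apply-∘S (ρ ∘S σ) τ p ⟩
    apply (ρ ∘S σ) (apply τ p)          ≡⟨ apply-∘S ρ σ (apply τ p) ⟩
    apply ρ (apply σ (apply τ p))       ≡⟨ cong (apply ρ) (apply-∘S σ τ p) ⟨
    apply ρ (apply (σ ∘S τ) p)          ≡⟨ apply-∘S ρ (σ ∘S τ) p ⟨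
    apply (ρ ∘S (σ ∘S τ)) p ∎
    where open ≡-Reasoning

  apply-idS : ∀ {m} (p : Fin m × Bool) → apply idS p ≡ p
  apply-idS {m} (i , s) =
    trans (cong (λ (p : Fin m × Bool) → proj₁ p , s xor proj₂ p) (lookup∘tabulate (λ j → j , false) i)) (cong (i ,_) (xor-identityʳ s))

  ∘S-identityˡ : ∀ {m} (σ : SPerm m) → idS ∘S σ ≡ σ
  ∘S-identityˡ σ = apply-ext λ p → trans (apply-∘S idS σ p) (apply-idS _)

  ∘S-identityʳ : ∀ {m} (σ : SPerm m) → σ ∘S idS ≡ σ
  ∘S-identityʳ σ = apply-ext λ p → trans (apply-∘S σ idS p) (cong (apply σ) (apply-idS p))

  sD-low : ∀ {n k} → k ≤ n → sD n k ≡ liftS (sA n k)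
  sD-low {n} {k} k≤n rewrite dec-true (k ≤? n) k≤n = refl

  sD-high : ∀ n → sD n (suc n) ≡ sDspecial n
  sD-high n rewrite dec-false (suc n ≤? n) 1+n≰n | dec-true (suc n ≟ suc n) refl = refl

  position : ∀ {m} → Fin m × Bool → ℕ × Bool
  position = map₁ toℕ

  lookup-lift : ∀ {n k} → k < n → ∀ i → position (lookup (liftS (sA n (suc k))) i) ≡ (adj k (toℕ i) , false)
  lookup-lift {n} {k} k<n i =
    trans (cong position (lookup-map i _ (sA n (suc k)))) (cong (_, false) (sA-adj k<n i))

  lookup-special : ∀ m i → position (lookup (sDspecial (suc m)) i) ≡ (adj m (toℕ i) , not (toℕ i <ᵇ m))
  lookup-special m i = trans (cong position (lookup∘tabulate exchange i)) (swapped (i Fin.≟ a) (i Fin.≟ b))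
    where
    open Inversions using (<ᵇ-true; <ᵇ-false)
    a b : Fin (suc (suc m))
    a = inject₁ (fromℕ m)
    b = Fin.suc (fromℕ m)
    exchange : Fin (suc (suc m)) → Fin (suc (suc m)) × Bool
    exchange j = if does (j Fin.≟ a) then (b , true) else if does (j Fin.≟ b) then (a , true) else (j , false)
    toℕ-a : toℕ a ≡ m
    toℕ-a = trans (Fin.toℕ-inject₁ _) (Fin.toℕ-fromℕ m)
    toℕ-b : toℕ b ≡ suc m
    toℕ-b = cong suc (Fin.toℕ-fromℕ m)
    swapped : ∀ (i≟a : Dec (i ≡ a)) (i≟b : Dec (i ≡ b)) →
      position (if does i≟a then (b , true) else if does i≟b then (a , true) else (i , false)) ≡ (adj m (toℕ i) , not (toℕ i <ᵇ m))
    swapped (yes refl) _        = cong₂ _,_ (trans toℕ-b (sym (trans (cong (adj m) toℕ-a) (adj-lower m))))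
      (cong not (sym (<ᵇ-false (≤-reflexive (sym toℕ-a)))))
    swapped (no _) (yes refl)   = cong₂ _,_ (trans toℕ-a (sym (trans (cong (adj m) toℕ-b) (adj-upper m))))
      (cong not (sym (<ᵇ-false (≤-trans (n≤1+n m) (≤-reflexive (sym toℕ-b))))))
    swapped (no i≢a) (no i≢b)   = cong₂ _,_ (sym (adj-fix i≢m i≢1+m)) (cong not (sym (<ᵇ-true i<m)))
      where
      i≢m : toℕ i ≢ m
      i≢m eq = i≢a (Fin.toℕ-injective (trans eq (sym toℕ-a)))
      i≢1+m : toℕ i ≢ suc m
      i≢1+m eq = i≢b (Fin.toℕ-injective (trans eq (sym toℕ-b)))
      i<m : toℕ i < m
      i<m = ≤∧≢⇒< (s≤s⁻¹ (≤∧≢⇒< (s≤s⁻¹ (Fin.toℕ<n i)) i≢1+m)) i≢m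

  -- The number of the roots e_i − e_j and e_i + e_j, i < j, made negative by w, in terms of
  -- w(e_i) and w(e_j): a root involving e_k and e_k′ with k < k′ is negative iff e_k has sign −.
  negativeRoots : ℕ × Bool → ℕ × Bool → ℕ
  negativeRoots (k , s) (k′ , _) = if k <ᵇ k′ then 2 * bit s else 1

  negate : ℕ × Bool → ℕ × Bool
  negate (k , s) = k , not s

  -- At least one of the two comparisons fails, so one side counts exactly 1 while the other lies
  -- between 0 and 2. The signs are arbitrary in order to cover both plain exchanges and the twisted
  -- generator.
  negativeRoots-≤ : ∀ k k′ s s′ t t′ → negativeRoots (k′ , t) (k , t′) ≤ suc (negativeRoots (k , s) (k′ , s′))
  negativeRoots-≤ k k′ s s′ t t′ with k <ᵇ k′ in k<k′ | k′ <ᵇ k in k′<k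
  ... | _     | false = s≤s z≤n
  ... | false | true with t
  ...   | true  = ≤-refl
  ...   | false = z≤n
  negativeRoots-≤ k k′ s s′ t t′ | true | true =
    ⊥-elim (<-asym (<ᵇ⇒< k k′ (subst Bool.T (sym k<k′) _)) (<ᵇ⇒< k′ k (subst Bool.T (sym k′<k) _)))

  module Roots where
    open PairStatistic negativeRoots
    open Inversions using (<ᵇ-true; <ᵇ-false)

    twist-value : ∀ m F i → i < 2 + m → twist negate m F i ≡ (if i <ᵇ m then F i else negate (F (adj m i)))
    twist-value zero    F zero          i< = refl
    twist-value zero    F (suc zero)    i< = refl
    twist-value zero    F (suc (suc i)) (s≤s (s≤s ()))
    twist-value (suc m) F zero          i< = refl
    twist-value (suc m) F (suc i)       i< = twist-value m (F ∘ suc) i (s<s⁻¹ i<)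

    stat-identity : ∀ m c → stat m (λ i → c + i , false) ≡ 0
    stat-identity zero    c = refl
    stat-identity (suc m) c = cong₂ _+_
      (trans (row-const m (c + 0 , false) 0 (λ {i} _ → cong (λ b → if b then 0 else 1)
        (<ᵇ-true (≤-<-trans (≤-reflexive (+-identityʳ c)) (m<m+n c {suc i} z<s))))) (*-zeroʳ m))
      (trans (stat-cong m (λ {i} _ → cong (_, false) (+-suc c i))) (stat-identity m (suc c)))

    -- The sign of the last entry is left free: that entry is always second in its pairs. In the
    -- longest element this sign varies with the parity of n. The value is the number of positive
    -- roots of D_(m+1).
    stat-negated : ∀ m c F → (∀ {i} → i ≤ m → proj₁ (F i) ≡ c + i) → (∀ {i} → i < m → proj₂ (F i) ≡ true) →
      stat (suc m) F ≡ 2 * triangle (suc m)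
    stat-negated zero    c F coordinates signs = refl
    stat-negated (suc m) c F coordinates signs = trans
      (cong₂ _+_
        (row-const (suc m) (F 0) 2 {F ∘ suc} λ {i} i<m → trans
          (cong₂ (λ b s → if b then 2 * bit s else 1)
            (<ᵇ-true (subst₂ _<_ (sym (trans (coordinates z≤n) (+-identityʳ c))) (sym (coordinates i<m)) (m<m+n c {suc i} z<s)))
            (signs z<s)) refl)
        (stat-negated m (suc c) (F ∘ suc) (λ i≤m → trans (coordinates (s≤s i≤m)) (+-suc c _)) (signs ∘ s<s)))
      (lemma (suc m) (triangle (suc m)))
      where
      lemma : ∀ m t → m * 2 + 2 * t ≡ 2 * (m + t)
      lemma = solve-∀

  module EvenSigned (m : ℕ) where
    n = suc m
    open PairStatistic negativeRoots
    open Roots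
    open Words {SPerm (suc n)} _∘S_ idS

    Rep : SPerm (suc n) → (ℕ → ℕ × Bool) → Set
    Rep σ F = ∀ i → position (lookup σ i) ≡ F (toℕ i)

    Rep-apply : ∀ {σ F} → Rep σ F → ∀ i s →
      position (apply σ (i , s)) ≡ (proj₁ (F (toℕ i)) , s xor proj₂ (F (toℕ i)))
    Rep-apply rep i s = cong (λ (k , t) → k , s xor t) (rep i)

    step : ∀ {σ F s} → s ∈ coxD n → Rep σ F → ∃ λ F′ → Rep (σ ∘S s) F′ × stat (suc n) F′ ≤ suc (stat (suc n) F)
    step {σ} {F} s∈ rep with ∈-map⁻ (sD n) s∈
    ... | _ , k∈ , refl with ∈-fromTo⁻ k∈
    ...   | k , refl , k<1+n with m≤n⇒m<n∨m≡n k<1+n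
    ...     | inj₁ k<n rewrite sD-low {n} {suc k} (s≤s⁻¹ k<n) = F ∘ adj k , rep′ ,
      stat-adj (λ (k , s) (k′ , s′) → negativeRoots-≤ k k′ s s′ s′ s) F k<n
      where
      s = liftS (sA n (suc k))
      rep′ : Rep (σ ∘S s) (F ∘ adj k)
      rep′ i = begin
        position (lookup (σ ∘S s) i)
          ≡⟨ cong position (lookup-∘S σ s i) ⟩
        position (apply σ (lookup s i))
          ≡⟨ Rep-apply {σ} {F} rep (proj₁ (lookup s i)) (proj₂ (lookup s i)) ⟩
        (proj₁ (F (toℕ (proj₁ (lookup s i)))) , proj₂ (lookup s i) xor proj₂ (F (toℕ (proj₁ (lookup s i)))))
          ≡⟨ cong (λ (x , t) → proj₁ (F x) , t xor proj₂ (F x)) (lookup-lift (s≤s⁻¹ k<n) i) ⟩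
        F (adj k (toℕ i)) ∎
        where open ≡-Reasoning
    ...     | inj₂ refl rewrite sD-high n = twist negate m F , rep′ ,
      stat-twist negate (λ a b → refl) (λ (k , s) (k′ , s′) → negativeRoots-≤ k k′ s s′ (not s′) (not s)) m F
      where
      s = sDspecial n
      rep′ : Rep (σ ∘S s) (twist negate m F)
      rep′ i = begin
        position (lookup (σ ∘S s) i)
          ≡⟨ cong position (lookup-∘S σ s i) ⟩
        position (apply σ (lookup s i))
          ≡⟨ Rep-apply {σ} {F} rep (proj₁ (lookup s i)) (proj₂ (lookup s i)) ⟩
        (proj₁ (F (toℕ (proj₁ (lookup s i)))) , proj₂ (lookup s i) xor proj₂ (F (toℕ (proj₁ (lookup s i)))))
          ≡⟨ cong (λ (x , t) → proj₁ (F x) , t xor proj₂ (F x)) (lookup-special m i) ⟩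
        (proj₁ (F (adj m (toℕ i))) , not (toℕ i <ᵇ m) xor proj₂ (F (adj m (toℕ i)))) ≡⟨ value ⟩
        (if toℕ i <ᵇ m then F (toℕ i) else negate (F (adj m (toℕ i))))
          ≡⟨ twist-value m F (toℕ i) (Fin.toℕ<n i) ⟨
        twist negate m F (toℕ i) ∎
        where
        open ≡-Reasoning
        value : (proj₁ (F (adj m (toℕ i))) , not (toℕ i <ᵇ m) xor proj₂ (F (adj m (toℕ i))))
          ≡ (if toℕ i <ᵇ m then F (toℕ i) else negate (F (adj m (toℕ i))))
        value with toℕ i <ᵇ m in eq
        ... | true  = cong F (adj-< (<ᵇ⇒< (toℕ i) m (subst Bool.T (sym eq) _)))
        ... | false = refl

    bound : ∀ w → All (_∈ coxD n) w → (∀ i → toℕ (proj₁ (lookup (prod w) i)) ≡ toℕ i) →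
      (∀ i → toℕ i < n → proj₂ (lookup (prod w) i) ≡ true) → 2 * triangle (suc n) ≤ length w
    bound w w∈ coordinates signs
      with LengthBound.word-bound _∘S_ idS ∘S-assoc ∘S-identityʳ (coxD n) Rep (stat (suc n))
        (λ {σ} {F} → step {σ} {F}) {idS} {λ i → i , false} w∈ (λ i → cong position (lookup∘tabulate (λ j → j , false) i))
    ... | F , rep , F≤ = begin
      2 * triangle (suc n)
        ≡⟨ stat-negated n 0 F (λ i≤n → cong proj₁ (F-value _ (s≤s i≤n)))
          (λ {i} i<n → trans (cong proj₂ (F-value i (m<n⇒m<1+n i<n)))
            (signs _ (subst (_< n) (sym (Fin.toℕ-fromℕ< (m<n⇒m<1+n i<n))) i<n))) ⟨
      stat (suc n) F                                ≤⟨ F≤ ⟩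
      length w + stat (suc n) (λ i → i , false)     ≡⟨ cong (length w +_) (stat-identity (suc n) 0) ⟩
      length w + 0                                  ≡⟨ +-identityʳ _ ⟩
      length w ∎
      where
      open ≤-Reasoning
      F-value : ∀ i (i<n : i < suc n) → F i ≡ (i , proj₂ (lookup (prod w) (fromℕ< i<n)))
      F-value i i<n = trans (cong F (sym (Fin.toℕ-fromℕ< i<n))) (trans (sym (rep j))
        (trans (cong (λ σ → position (lookup σ j)) (∘S-identityˡ (prod w)))
          (cong (_, proj₂ (lookup (prod w) j)) (trans (coordinates j) (Fin.toℕ-fromℕ< i<n)))))
        where j = fromℕ< i<n

    -- The signed coordinate (j , s) is the position n − j, counted from 0, with sign s.
    At : Fin (suc n) × Bool → ℕ × Bool → Set
    At (i , s) (j , s′) = toℕ i + j ≡ n × s ≡ s′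

    At-injective : ∀ {p p′ y} → At p y → At p′ y → p ≡ p′
    At-injective {y = j , _} (eq , refl) (eq′ , refl) =
      cong (_, _) (Fin.toℕ-injective (+-cancelʳ-≡ j _ _ (trans eq (sym eq′))))

    coordinate : ∀ p → ∃ (At p)
    coordinate (i , s) = (n ∸ toℕ i , s) , m+[n∸m]≡n (s≤s⁻¹ (Fin.toℕ<n i)) , refl

    t₀ = sD n n ∘S sD n (suc n)
    open Reindex (sD n) t₀ n
    open SignedCoordinates not not-involutive using (longest-sign; longest-zero) renaming (T to move)

    -- The exchanges in sₙ and sₙ₊₁ cancel, which leaves sign changes on the last two positions.
    -- These are the signed coordinates 1 and 0, hence `not` as the action on coordinate 0.
    apply-t₀ : ∀ i s → position (apply t₀ (i , s)) ≡ (toℕ i , s xor not (toℕ i <ᵇ m))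
    apply-t₀ i s rewrite sD-low {n} {n} ≤-refl | sD-high n = begin
      position (apply (u ∘S v) (i , s))               ≡⟨ cong position (apply-∘S u v (i , s)) ⟩
      position (apply u (apply v (i , s)))
        ≡⟨ cong (λ (x , t) → x , (s xor proj₂ (lookup v i)) xor t) (lookup-lift ≤-refl (proj₁ (lookup v i))) ⟩
      (adj m (toℕ (proj₁ (lookup v i))) , (s xor proj₂ (lookup v i)) xor false)
        ≡⟨ cong (λ (x , t) → adj m x , (s xor t) xor false) (lookup-special m i) ⟩
      (adj m (adj m (toℕ i)) , (s xor not (toℕ i <ᵇ m)) xor false)
        ≡⟨ cong₂ _,_ (adj-involutive m (toℕ i)) (xor-identityʳ _) ⟩
      (toℕ i , s xor not (toℕ i <ᵇ m)) ∎
      where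
      open ≡-Reasoning
      u = liftS (sA n n)
      v = sDspecial n

    generator-At : ∀ {i p y} → i < n → At p y → At (apply (generator i) p) (move i y)
    generator-At {suc k} {i , s} {j , _} k<n (eq , refl) rewrite sD-low {n} {n ∸ suc k} (m∸n≤m n (suc k)) =
      subst (λ (x , t) → x + adj (suc k) j ≡ n × s xor t ≡ s) (sym lookup-g)
        (adj-reflect (m∸n+n≡m k<n) eq , xor-identityʳ s)
      where
      lookup-g : position (lookup (liftS (sA n (n ∸ suc k))) i) ≡ (adj (n ∸ suc (suc k)) (toℕ i) , false)
      lookup-g = trans (cong (λ x → position (lookup (liftS (sA n x)) i)) (+-∸-assoc 1 k<n))
        (lookup-lift (∸-monoʳ-< {n} {suc (suc k)} {0} z<s k<n) i)
    generator-At {zero} {i , s} {j , _} _ (eq , refl) =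
      subst (λ (x , t) → AtPosition x t) (sym (apply-t₀ i s)) (go j eq)
      where
      open Inversions using (<ᵇ-true; <ᵇ-false)
      AtPosition : ℕ → Bool → Set
      AtPosition x t = x + proj₁ (move 0 (j , s)) ≡ n × t ≡ proj₂ (move 0 (j , s))
      xor-true : ∀ s → s xor true ≡ not s
      xor-true true  = refl
      xor-true false = refl
      flipped : m ≤ toℕ i → s xor not (toℕ i <ᵇ m) ≡ not s
      flipped m≤i = trans (cong (λ b → s xor not b) (<ᵇ-false m≤i)) (xor-true s)
      go : ∀ j → toℕ i + j ≡ n → toℕ i + proj₁ (move 0 (j , s)) ≡ n × s xor not (toℕ i <ᵇ m)
        ≡ proj₂ (move 0 (j , s))
      go zero          eq = eq , flipped (≤-trans (n≤1+n m) (≤-reflexive (sym (trans (sym (+-identityʳ _)) eq))))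
      go (suc zero)    eq = eq , flipped (≤-reflexive (sym (+-cancelʳ-≡ 1 (toℕ i) m (trans eq (+-comm 1 m)))))
      go (suc (suc j)) eq = eq , trans (cong (λ b → s xor not b) (<ᵇ-true i<m)) (xor-identityʳ s)
        where i<m = m+2+n≡1+o⇒m<o (toℕ i) j eq

    word : ℕ → List (SPerm (suc n))
    word zero    = sD n n ∷ sD n (suc n) ∷ []
    word (suc k) = sD n (n ∸ suc k) ∷ []

    sD∈coxD : ∀ {k} → 1 ≤ k → k ≤ suc n → sD n k ∈ coxD n
    sD∈coxD 1≤k k≤n = ∈-map⁺ (sD n) (∈-fromTo⁺ 1≤k k≤n)

    word-S : ∀ {i} → i < n → All (_∈ coxD n) (word i)
    word-S {zero}  _   = sD∈coxD (s≤s z≤n) (n≤1+n n) ∷ sD∈coxD (s≤s z≤n) ≤-refl ∷ []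
    word-S {suc k} k<n = sD∈coxD (m<n⇒0<n∸m k<n) (m≤n⇒m≤1+n (m∸n≤m n (suc k))) ∷ []

    word-generator : ∀ {i} → i < n → prod (word i) ≡ generator i
    word-generator {zero}  _ = cong (sD n n ∘S_) (∘S-identityʳ (sD n (suc n)))
    word-generator {suc k} _ = ∘S-identityʳ (sD n (n ∸ suc k))

    word-length : ∀ {i} → i < n → length (word i) ≡ Weights.weight 1 2 i
    word-length {zero}  _ = refl
    word-length {suc k} _ = refl

    wt-longest : ∀ n → Weights.wt 1 2 (longest n) ≡ 2 * triangle (suc n)
    wt-longest zero    = refl
    wt-longest (suc n) = begin
      wt (flip n ++ longest n)                      ≡⟨ wt-++ (flip n) (longest n) ⟩
      wt (flip n) + wt (longest n)                  ≡⟨ cong₂ _+_ (wt-flip-total n) (wt-longest n) ⟩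
      2 + 1 * (n + n) + 2 * triangle (suc n)        ≡⟨ lemma n (triangle (suc n)) ⟩
      2 * triangle (suc (suc n)) ∎
      where
      open ≡-Reasoning
      open Weights 1 2
      lemma : ∀ n t → 2 + 1 * (n + n) + 2 * t ≡ 2 * (suc n + t)
      lemma = solve-∀

    module Rep′ = SignedCoordinates.Represented not not-involutive _∘S_ idS apply apply-∘S apply-ext
      At coordinate (λ {p} {p′} {y} → At-injective {p} {p′} {y}) n generator
      (λ {i} {p} {y} → generator-At {i} {p} {y})

    open Action (λ i → generator i ∘S_) using (act)

    apply-longest : ∀ i → ∃ λ s → apply (act (longest n) idS) (i , false) ≡ (i , s) × (toℕ i < n → s ≡ true)
    apply-longest i = go (n ∸ toℕ i) (m+[n∸m]≡n (s≤s⁻¹ (Fin.toℕ<n i)))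
      where
      w = act (longest n) idS
      moved : ∀ {j} → At (i , false) (j , false) →
        At (apply w (i , false)) (Action.act move (longest n) (j , false))
      moved at =
        Rep′.act-T {x = idS} {p = i , false} (longest-letters n) (subst (λ p → At p _) (sym (apply-idS (i , false))) at)
      go : ∀ j → toℕ i + j ≡ n → ∃ λ s → apply w (i , false) ≡ (i , s) × (toℕ i < n → s ≡ true)
      go zero eq with longest-zero n false | moved (eq , refl)
      ... | s , eq′ | at = s ,
        At-injective {p = apply w (i , false)} {p′ = i , s} {y = 0 , s} (subst (At _) eq′ at) (eq , refl) ,
        λ i<n → ⊥-elim (<⇒≢ i<n (trans (sym (+-identityʳ _)) eq))
      go (suc j) eq = true ,
        At-injective {p = apply w (i , false)} {p′ = i , true} {y = suc j , true}
          (subst (At _) (longest-sign false j<n) (moved (eq , refl))) (eq , refl) ,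
        λ _ → refl
        where
        j<n : j < n
        j<n = ≤-trans (m≤n+m (suc j) (toℕ i)) (≤-reflexive eq)

    module _ (ℓ : SPerm (suc n) → ℕ) (isLength : IsLength (coxD n) ℓ) where
      open Folding {SPerm (suc n)} _∘S_ idS ∘S-assoc ∘S-identityˡ ∘S-identityʳ (coxD n) ℓ isLength
        1 2 n generator word word-S word-generator word-length
      open Weights 1 2

      longest-bound : ∀ v → All (_∈ coxD n) v → prod v ≡ act (longest n) idS → wt (longest n) ≤ length v
      longest-bound v v-S eq = subst (_≤ length v) (sym (wt-longest n)) (bound v v-S
        (λ i → let _ , at , _ = apply-longest i in cong toℕ (trans (cong (λ σ → proj₁ (lookup σ i)) eq) (cong proj₁ at)))
        (λ i i<n → let _ , at , sign = apply-longest i in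
          trans (cong (λ σ → proj₂ (lookup σ i)) eq) (trans (cong proj₂ at) (sign i<n))))

      open Count (s≤s z≤n) (s≤s z≤n) Rep′.square Rep′.commute Rep′.braid Rep′.braid₄ longest-bound

      statistic : ∀ {L} → Unique L → (∀ x → (x ∈ L) ⇔ Gen generators x) → U ℓ L ≈P poincare (X 1) (X 2) n
      statistic L! L⇔Gen = gf-enumeration 1 2 ℓ (λ w → act w idS) n
        (enumeration generator-∈ (∈-generator (s≤s z≤n)) L! L⇔Gen) ℓ-element

-- The dihedral groups inside A_n.

module Dihedral where
  open CosetWords
  open LengthsAndEnumeration
  open SignedModel
  open Permutations
  open QIntegers
  open SymmetricPermutations using (sA∈coxA)

  -- Letter 0 is r₁ and letter 1 is r₂; the word starts with r₁ if the flag is true.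
  alternate : Bool → ℕ → List ℕ
  alternate s     zero    = []
  alternate true  (suc k) = 0 ∷ alternate false k
  alternate false (suc k) = 1 ∷ alternate true k

  -- The flag with which an alternating word continues after k letters.
  shift : ℕ → Bool → Bool
  shift zero    s = s
  shift (suc k) s = shift k (not s)

  shift-not : ∀ k s → shift k (not s) ≡ not (shift k s)
  shift-not zero    s = refl
  shift-not (suc k) s = shift-not k (not s)

  shift-even : ∀ k s → shift (k + k) s ≡ s
  shift-even zero    s = refl
  shift-even (suc k) s = trans (cong (λ j → shift j (not s)) (+-suc k k))
    (trans (shift-even k (not (not s))) (not-involutive s))

  alternate-++ : ∀ s k l → alternate s (k + l) ≡ alternate s k ++ alternate (shift k s) l
  alternate-++ s     zero    l = refl
  alternate-++ true  (suc k) l = cong (0 ∷_) (alternate-++ false k l)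
  alternate-++ false (suc k) l = cong (1 ∷_) (alternate-++ true k l)

  alternate-even-++ : ∀ s k l → alternate s (k + k + l) ≡ alternate s (k + k) ++ alternate s l
  alternate-even-++ s k l =
    trans (alternate-++ s (k + k) l) (cong (λ b → alternate s (k + k) ++ alternate b l) (shift-even k s))

  alternate-letters : ∀ s k → All (_< 2) (alternate s k)
  alternate-letters s     zero    = []
  alternate-letters true  (suc k) = s≤s z≤n ∷ alternate-letters false k
  alternate-letters false (suc k) = ≤-refl ∷ alternate-letters true k

  double-suc : ∀ k → suc k + suc k ≡ suc (suc (k + k))
  double-suc k = cong suc (+-suc k k)

  module AlternatingWeights (α β : ℕ) where
    -- The order is reversed because letter 0 takes the second parameter: r₁ weighs α and r₂ weighs
    -- β.
    open Weights β α

    wt-even : ∀ s k → wt (alternate s (k + k)) ≡ k * (α + β)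
    wt-even s zero    = refl
    wt-even s (suc k) rewrite double-suc k = go s
      where
      lemma : ∀ α β w → β + (α + w) ≡ α + β + w
      lemma = solve-∀
      go : ∀ s → wt (alternate s (suc (suc (k + k)))) ≡ α + β + k * (α + β)
      go true  = trans (sym (+-assoc α β _)) (cong (α + β +_) (wt-even true k))
      go false = trans (lemma α β _) (cong (α + β +_) (wt-even false k))

    wt-odd-true : ∀ k → wt (alternate true (suc (k + k))) ≡ k * (α + β) + α
    wt-odd-true k = trans (cong (α +_) (wt-even false k)) (+-comm α _)

    wt-odd-false : ∀ k → wt (alternate false (suc (k + k))) ≡ k * (α + β) + β
    wt-odd-false k = trans (cong (β +_) (wt-even true k)) (+-comm β _)

  parity : ℕ → Bool
  parity zero    = true
  parity (suc x) = not (parity x)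

  parity-+ : ∀ x k → parity (x + k) ≡ shift k (parity x)
  parity-+ x zero    = cong parity (+-identityʳ x)
  parity-+ x (suc k) = trans (cong parity (+-suc x k)) (parity-+ (suc x) k)

  -- The action of r₁ (flag true) and r₂ on the positions 0, …, n, counted from 0.
  bounce : ℕ → Bool → ℕ → ℕ
  bounce zero    s     x             = x
  bounce (suc n) true  zero          = 1
  bounce (suc n) true  (suc zero)    = 0
  bounce (suc n) true  (suc (suc x)) = suc (bounce n false (suc x))
  bounce (suc n) false zero          = 0
  bounce (suc n) false (suc x)       = suc (bounce n true x)

  not-≡ : ∀ {b c} → not b ≡ c → b ≡ not c
  not-≡ {b} refl = sym (not-involutive b)

  -- The flag is the parity of the lower position of each exchanged pair: s_i with i odd exchanges i
  -- - 1 and i, counted from 0.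
  bounce-right : ∀ {n s x} → parity x ≡ s → x < n → bounce n s x ≡ suc x
  bounce-right {suc n} {true}  {zero}        p x<n = refl
  bounce-right {suc n} {true}  {suc zero}    () x<n
  bounce-right {suc n} {true}  {suc (suc x)} p x<n =
    cong suc (bounce-right {n} {false} {suc x} (not-≡ p) (s<s⁻¹ x<n))
  bounce-right {suc n} {false} {zero}        () x<n
  bounce-right {suc n} {false} {suc x}       p x<n = cong suc (bounce-right {n} {true} {x} (not-≡ p) (s<s⁻¹ x<n))

  bounce-left : ∀ {n s y} → parity y ≡ s → y < n → bounce n s (suc y) ≡ y
  bounce-left {suc n} {true}  {zero}  p y<n = refl
  bounce-left {suc n} {true}  {suc y} p y<n = cong suc (bounce-left {n} {false} {y} (not-≡ p) (s<s⁻¹ y<n))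
  bounce-left {suc n} {false} {zero}  () y<n
  bounce-left {suc n} {false} {suc y} p y<n = cong suc (bounce-left {n} {true} {y} (not-≡ p) (s<s⁻¹ y<n))

  bounce-last : ∀ {n s} → parity n ≡ s → bounce n s n ≡ n
  bounce-last {zero}        p = refl
  bounce-last {suc zero}    {true} ()
  bounce-last {suc (suc n)} {true}  p = cong suc (bounce-last {suc n} {false} (not-≡ p))
  bounce-last {suc n}       {false} p = cong suc (bounce-last {n} {true} (not-≡ p))

  bounce-first : ∀ {n s} → s ≡ false → bounce n s 0 ≡ 0
  bounce-first {zero}  refl = refl
  bounce-first {suc n} refl = refl

  bounce-involutive : ∀ n s x → bounce n s (bounce n s x) ≡ x
  bounce-involutive zero          s     x             = refl
  bounce-involutive (suc n)       true  zero          = refl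
  bounce-involutive (suc n)       true  (suc zero)    = refl
  bounce-involutive (suc zero)    true  (suc (suc x)) = refl
  bounce-involutive (suc (suc n)) true  (suc (suc x)) = cong (suc ∘ suc) (bounce-involutive n true x)
  bounce-involutive (suc n)       false zero          = refl
  bounce-involutive (suc n)       false (suc x)       = cong suc (bounce-involutive n true x)

  letter : ℕ → Bool
  letter zero    = true
  letter (suc _) = false

  module Trajectories (n : ℕ) where
    open Action (λ i → bounce n (letter i)) public

    run : Bool → ℕ → ℕ → ℕ
    run s k = act (alternate s k)

    run-suc : ∀ s k x → run s (suc k) x ≡ bounce n s (run (not s) k x)
    run-suc true  k x = refl
    run-suc false k x = refl

    -- Each step moves by one and changes the letter, so the parity condition persists along the
    -- run. It is stated at the end point because the leftmost letter `s` acts last.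
    run-right : ∀ {s} k {x} → parity (x + k) ≡ not s → x + k ≤ n → run s k x ≡ x + k
    run-right zero    p x≤n = sym (+-identityʳ _)
    run-right {s} (suc k) {x} p x≤n = begin
      run s (suc k) x               ≡⟨ run-suc s k x ⟩
      bounce n s (run (not s) k x)
        ≡⟨ cong (bounce n s) (run-right k (trans p′ (sym (not-involutive s))) (<⇒≤ x<n)) ⟩
      bounce n s (x + k)            ≡⟨ bounce-right p′ x<n ⟩
      suc (x + k)                   ≡⟨ +-suc x k ⟨
      x + suc k ∎
      where
      open ≡-Reasoning
      p′ : parity (x + k) ≡ s
      p′ = trans (not-≡ (trans (sym (cong parity (+-suc x k))) p)) (not-involutive s)
      x<n : x + k < n
      x<n = subst (_≤ n) (+-suc x k) x≤n

    run-left : ∀ {s} k {y} → parity y ≡ s → y + k ≤ n → run s k (y + k) ≡ y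
    run-left zero    p y≤n = +-identityʳ _
    run-left {s} (suc k) {y} p y≤n = begin
      run s (suc k) (y + suc k)               ≡⟨ cong (run s (suc k)) (+-suc y k) ⟩
      run s (suc k) (suc y + k)               ≡⟨ run-suc s k (suc y + k) ⟩
      bounce n s (run (not s) k (suc y + k))  ≡⟨ cong (bounce n s) (run-left k (cong not p) y<n) ⟩
      bounce n s (suc y)                      ≡⟨ bounce-left p (≤-trans (s≤s (m≤m+n y k)) y<n) ⟩
      y ∎
      where
      open ≡-Reasoning
      y<n : suc y + k ≤ n
      y<n = subst (_≤ n) (+-suc y k) y≤n

    run-split : ∀ s k l x → run s (k + suc l) x ≡ run s k (bounce n (shift k s) (run (not (shift k s)) l x))
    run-split s k l x = begin
      run s (k + suc l) x
        ≡⟨ cong (λ w → act w x) (alternate-++ s k (suc l)) ⟩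
      act (alternate s k ++ alternate (shift k s) (suc l)) x ≡⟨ act-++ (alternate s k) _ x ⟩
      run s k (run (shift k s) (suc l) x)             ≡⟨ cong (run s k) (run-suc (shift k s) l x) ⟩
      run s k (bounce n (shift k s) (run (not (shift k s)) l x)) ∎
      where open ≡-Reasoning

    -- Each position moves steadily to one end of the path, rests there for one step, and
    -- moves back; whether it starts to the right depends on the parity of its final position y.
    run-reverse : ∀ s x y → x + y ≡ n → run s (suc n) x ≡ y
    run-reverse s x y eq with parity y Bool.≟ s
    ... | yes p = begin
      run s (suc n) x
        ≡⟨ cong (λ m → run s m x) (trans (cong suc (sym eq)) (sym (+-suc x y))) ⟩
      run s (x + suc y) x                         ≡⟨ run-split s x y x ⟩
      run s x (bounce n s′ (run (not s′) y x))
        ≡⟨ cong (run s x ∘ bounce n s′) (run-right y (trans (cong parity eq) (trans p′ (sym (not-involutive s′)))) (≤-reflexive eq)) ⟩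
      run s x (bounce n s′ (x + y))               ≡⟨ cong (run s x ∘ bounce n s′) eq ⟩
      run s x (bounce n s′ n)                     ≡⟨ cong (run s x) (bounce-last p′) ⟩
      run s x n                                   ≡⟨ cong (run s x) (trans (sym eq) (+-comm x y)) ⟩
      run s x (y + x)
        ≡⟨ run-left x p (≤-reflexive (trans (+-comm y x) eq)) ⟩
      y ∎
      where
      open ≡-Reasoning
      s′ = shift x s
      p′ : parity n ≡ s′
      p′ = trans (cong parity (trans (sym eq) (+-comm x y))) (trans (parity-+ y x) (cong (shift x) p))
    ... | no ¬p = begin
      run s (suc n) x
        ≡⟨ cong (λ m → run s m x) (trans (cong suc (trans (sym eq) (+-comm x y))) (sym (+-suc y x))) ⟩
      run s (y + suc x) x                         ≡⟨ run-split s y x x ⟩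
      run s y (bounce n s′ (run (not s′) x x))
        ≡⟨ cong (run s y ∘ bounce n s′) (run-left x {0} (sym (cong not s′≡false)) x≤n) ⟩
      run s y (bounce n s′ 0)                     ≡⟨ cong (run s y) (bounce-first s′≡false) ⟩
      run s y 0                                   ≡⟨ run-right y p y≤n ⟩
      y ∎
      where
      open ≡-Reasoning
      s′ = shift y s
      x≤n : x ≤ n
      x≤n = subst (x ≤_) eq (m≤m+n x y)
      y≤n : y ≤ n
      y≤n = subst (y ≤_) eq (m≤n+m y x)
      ≢⇒≡not : ∀ b c → b ≢ c → b ≡ not c
      ≢⇒≡not true  true  ne = ⊥-elim (ne refl)
      ≢⇒≡not true  false ne = refl
      ≢⇒≡not false true  ne = refl
      ≢⇒≡not false false ne = ⊥-elim (ne refl)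
      p : parity y ≡ not s
      p = ≢⇒≡not _ _ ¬p
      shift-involutive : ∀ y s → shift y (shift y s) ≡ s
      shift-involutive zero    s = refl
      shift-involutive (suc y) s = trans (cong (shift y) (sym (shift-not y (not s))))
        (trans (shift-involutive y (not (not s))) (not-involutive s))
      s′≡false : s′ ≡ false
      s′≡false = begin
        shift y s
          ≡⟨ cong (shift y) (trans (sym (not-involutive s)) (cong not (sym p))) ⟩
        shift y (not (parity y))    ≡⟨ shift-not y (parity y) ⟩
        not (shift y (parity y))    ≡⟨ cong (not ∘ shift y) (parity-+ 0 y) ⟩
        not (shift y (shift y true)) ≡⟨ cong not (shift-involutive y true) ⟩
        false ∎

  withParity : Bool → List ℕ → List ℕ
  withParity s = filter (λ i → oddB i Bool.≟ s)

  select : Bool → ℕ → List ℕ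
  select s n = withParity s (fromTo 1 n)

  oddB-suc : ∀ i → oddB (suc i) ≡ not (oddB i)
  oddB-suc zero          = refl
  oddB-suc (suc zero)    = refl
  oddB-suc (suc (suc i)) = oddB-suc i

  withParity-suc : ∀ s xs → withParity s (map suc xs) ≡ map suc (withParity (not s) xs)
  withParity-suc s []       = refl
  withParity-suc s (x ∷ xs) rewrite oddB-suc x with oddB x | s
  ... | true  | true  = withParity-suc true xs
  ... | true  | false = cong (suc x ∷_) (withParity-suc false xs)
  ... | false | true  = cong (suc x ∷_) (withParity-suc true xs)
  ... | false | false = withParity-suc false xs

  fromTo-suc : ∀ n → fromTo 1 (suc n) ≡ 1 ∷ map suc (fromTo 1 n)
  fromTo-suc n = cong (λ xs → 1 ∷ map suc xs) (sym (map-upTo suc n))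

  select-true : ∀ n → select true (suc n) ≡ 1 ∷ map suc (select false n)
  select-true n = trans (cong (withParity true) (fromTo-suc n)) (cong (1 ∷_) (withParity-suc true (fromTo 1 n)))

  select-false : ∀ n → select false (suc n) ≡ map suc (select true n)
  select-false n = trans (cong (withParity false) (fromTo-suc n)) (withParity-suc false (fromTo 1 n))

  select-bounds : ∀ {s n} → All (λ k → 1 ≤ k × k ≤ n) (select s n)
  select-bounds {s} {n} =
    All.tabulate λ k∈ → bounds (proj₁ (∈-filter⁻ (λ i → oddB i Bool.≟ s) {xs = fromTo 1 n} k∈))
    where
    bounds : ∀ {k} → k ∈ fromTo 1 n → 1 ≤ k × k ≤ n
    bounds k∈ with ∈-fromTo⁻ k∈
    ... | j , refl , j<n = s≤s z≤n , j<n

  adjs : List ℕ → ℕ → ℕ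
  adjs ks x = foldr (adj ∘ pred) x ks

  adjs-zero : ∀ {ks} → All (1 ≤_) ks → adjs (map suc ks) 0 ≡ 0
  adjs-zero []                         = refl
  adjs-zero {suc k ∷ ks} (1≤k ∷ 1≤ks) = cong (adj (suc k)) (adjs-zero 1≤ks)

  adjs-suc : ∀ {ks} → All (1 ≤_) ks → ∀ x → adjs (map suc ks) (suc x) ≡ suc (adjs ks x)
  adjs-suc []                         x = refl
  adjs-suc {suc k ∷ ks} (1≤k ∷ 1≤ks) x = cong (adj (suc k)) (adjs-suc 1≤ks x)

  -- Removing s₁, if present, leaves the indices of the opposite parity shifted by one, which is the
  -- recursion of `bounce`.
  adjs-select : ∀ n s x → adjs (select s n) x ≡ bounce n s x
  adjs-select zero    s     x = refl
  adjs-select (suc n) true  x = trans (cong (λ ks → adjs ks x) (select-true n)) (go n x)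
    where
    1≤ : ∀ n → All (1 ≤_) (select false n)
    1≤ n = All.map proj₁ (select-bounds {false} {n})
    positive : ∀ n x → adj 0 (suc (bounce n false (suc x))) ≡ suc (bounce n false (suc x))
    positive zero    x = refl
    positive (suc n) x = refl
    go : ∀ n x → adj 0 (adjs (map suc (select false n)) x) ≡ bounce (suc n) true x
    go n zero          = cong (adj 0) (adjs-zero (1≤ n))
    go n (suc zero)    = cong (adj 0) (trans (adjs-suc (1≤ n) 0)
      (cong suc (trans (adjs-select n false 0) (bounce-first {n} refl))))
    go n (suc (suc x)) =
      trans (cong (adj 0) (trans (adjs-suc (1≤ n) (suc x)) (cong suc (adjs-select n false (suc x)))))
      (positive n x)
  adjs-select (suc n) false x = trans (cong (λ ks → adjs ks x) (select-false n)) (go x)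
    where
    1≤ : All (1 ≤_) (select true n)
    1≤ = All.map proj₁ (select-bounds {true} {n})
    go : ∀ x → adjs (map suc (select true n)) x ≡ bounce (suc n) false x
    go zero    = adjs-zero 1≤
    go (suc x) = trans (adjs-suc 1≤ x) (cong suc (adjs-select n true x))

  prodA-adjs : ∀ {n ks} → All (λ k → 1 ≤ k × k ≤ n) ks → ∀ i → toℕ (lookup (prodA n ks) i) ≡ adjs ks (toℕ i)
  prodA-adjs []                                i = cong toℕ (lookup∘tabulate id i)
  prodA-adjs {n} {suc k ∷ ks} ((_ , k<n) ∷ bs) i = begin
    toℕ (lookup (sA n (suc k) ∘P prodA n ks) i)
      ≡⟨ cong toℕ (lookup-∘P (sA n (suc k)) (prodA n ks) i) ⟩
    toℕ (lookup (sA n (suc k)) (lookup (prodA n ks) i)) ≡⟨ sA-adj k<n _ ⟩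
    adj k (toℕ (lookup (prodA n ks) i))               ≡⟨ cong (adj k) (prodA-adjs bs i) ⟩
    adj k (adjs ks (toℕ i)) ∎
    where open ≡-Reasoning

  module DihedralLengths (n : ℕ) (α β : ℕ)
    (α≡ : length (select true n) ≡ α) (β≡ : length (select false n) ≡ β)
    (total : ∀ s → Weights.wt β α (alternate s (suc n)) ≡ triangle (suc n))
    (ℓ : Perm (suc n) → ℕ) (isLength : Words.IsLength _∘P_ idP (coxA n) ℓ)
    where
    open Words {Perm (suc n)} _∘P_ idP
    open Weights β α
    open AlternatingWeights α β
    module T = Trajectories n

    r : ℕ → Perm (suc n)
    r i = prodA n (select (letter i) n)

    word : ℕ → List (Perm (suc n))
    word i = map (sA n) (select (letter i) n)

    word-S : ∀ i → All (_∈ coxA n) (word i)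
    word-S i = All.map⁺ (All.map (λ (1≤k , k≤n) → sA∈coxA 1≤k k≤n) (select-bounds {letter i} {n}))

    word-r : ∀ i → prod (word i) ≡ r i
    word-r i = go (select (letter i) n)
      where
      go : ∀ ks → prod (map (sA n) ks) ≡ prodA n ks
      go []       = refl
      go (k ∷ ks) = cong (sA n k ∘P_) (go ks)

    word-length : ∀ i → i < 2 → length (word i) ≡ weight i
    word-length zero    _ = trans (length-map (sA n) (select true n)) α≡
    word-length (suc i) _ = trans (length-map (sA n) (select false n)) β≡

    open Folding {Perm (suc n)} _∘P_ idP ∘P-assoc ∘P-identityˡ ∘P-identityʳ (coxA n) ℓ isLength
      β α 2 r word (λ {i} _ → word-S i) (λ {i} _ → word-r i) (λ {i} → word-length i)
    open Action (λ i → r i ∘P_) using (act; act-++)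

    act-position : ∀ w i → toℕ (lookup (act w idP) i) ≡ T.act w (toℕ i)
    act-position []      i = cong toℕ (lookup∘tabulate id i)
    act-position (k ∷ w) i = begin
      toℕ (lookup (r k ∘P act w idP) i)             ≡⟨ cong toℕ (lookup-∘P (r k) (act w idP) i) ⟩
      toℕ (lookup (r k) (lookup (act w idP) i))     ≡⟨ prodA-adjs (select-bounds {letter k} {n}) _ ⟩
      adjs (select (letter k) n) (toℕ (lookup (act w idP) i)) ≡⟨ adjs-select n (letter k) _ ⟩
      bounce n (letter k) (toℕ (lookup (act w idP) i))
        ≡⟨ cong (bounce n (letter k)) (act-position w i) ⟩
      T.act (k ∷ w) (toℕ i) ∎
      where open ≡-Reasoning

    reversal : ∀ s i → toℕ (lookup (act (alternate s (suc n)) idP) i) ≡ n ∸ toℕ i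
    reversal s i = trans (act-position (alternate s (suc n)) i)
      (T.run-reverse s (toℕ i) (n ∸ toℕ i) (m+[n∸m]≡n (s≤s⁻¹ (Fin.toℕ<n i))))

    ℓ-alternate : ∀ s {k} → k ≤ suc n → ℓ (act (alternate s k) idP) ≡ wt (alternate s k)
    ℓ-alternate s {k} k≤N =
      reduced (alternate-letters s k) (alternate-letters (shift k s) (suc n ∸ k)) λ v v-S eq →
      subst (_≤ length v) (trans (sym (total s)) (trans (cong wt split) (wt-++ (alternate s k) _)))
        (Inversions.reversal-bound n v v-S λ i →
          trans (cong (λ σ → toℕ (lookup σ i)) (trans eq (trans (sym (act-++ (alternate s k) _ idP)) (cong (λ w → act w idP) (sym split)))))
            (reversal s i))
      where
      split : alternate s (suc n) ≡ alternate s k ++ alternate (shift k s) (suc n ∸ k)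
      split = trans (cong (alternate s) (sym (m+[n∸m]≡n k≤N))) (alternate-++ s k (suc n ∸ k))

    act-injective : ∀ u v → (∀ i → toℕ (lookup (act u idP) i) ≡ toℕ (lookup (act v idP) i)) → ∀ x →
      act u x ≡ act v x
    act-injective u v eq x = trans (act-· u x)
      (trans (cong (_∘P x) (lookup-ext {u = act u idP} {act v idP} λ i → Fin.toℕ-injective (eq i))) (sym (act-· v x)))

    square : ∀ i x → r i ∘P (r i ∘P x) ≡ x
    square i = act-injective (i ∷ i ∷ []) [] λ k → trans (act-position (i ∷ i ∷ []) k)
      (trans (bounce-involutive n (letter i) (toℕ k)) (cong toℕ (sym (lookup∘tabulate id k))))

    -- The word splits into two alternating words of length n + 1, each acting as the reversal.
    full-turn : ∀ x → act (alternate true (suc n + suc n)) x ≡ x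
    full-turn = act-injective (alternate true (suc n + suc n)) [] λ i → let open ≡-Reasoning in begin
      toℕ (lookup (act (alternate true (suc n + suc n)) idP) i)
        ≡⟨ act-position (alternate true (suc n + suc n)) i ⟩
      T.act (alternate true (suc n + suc n)) (toℕ i)
        ≡⟨ cong (λ w → T.act w (toℕ i)) (alternate-++ true (suc n) (suc n)) ⟩
      T.act (alternate true (suc n) ++ alternate (shift (suc n) true) (suc n)) (toℕ i)
        ≡⟨ T.act-++ (alternate true (suc n)) _ (toℕ i) ⟩
      T.run true (suc n) (T.run (shift (suc n) true) (suc n) (toℕ i))
        ≡⟨ cong (T.run true (suc n)) (T.run-reverse (shift (suc n) true) (toℕ i) (n ∸ toℕ i) (m+[n∸m]≡n (s≤s⁻¹ (Fin.toℕ<n i)))) ⟩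
      T.run true (suc n) (n ∸ toℕ i)
        ≡⟨ T.run-reverse true (n ∸ toℕ i) (toℕ i) (m∸n+n≡m (s≤s⁻¹ (Fin.toℕ<n i))) ⟩
      toℕ i                                                       ≡⟨ cong toℕ (lookup∘tabulate id i) ⟨
      toℕ (lookup idP i) ∎

    rotation : ∀ k x → act (alternate true (suc k + suc k)) x ≡ act (alternate true (k + k)) (r 0 ∘P (r 1 ∘P x))
    rotation k x = trans (cong (λ m → act (alternate true m) x) (trans (double-suc k) (+-comm 2 (k + k))))
      (trans (cong (λ w → act w x) (alternate-even-++ true k 2)) (act-++ (alternate true (k + k)) _ x))

    unwind : ∀ k x → act (alternate false (k + k)) (act (alternate true (k + k)) x) ≡ x
    unwind zero    x = refl
    unwind (suc k) x = begin
      act (alternate false (suc k + suc k)) (act (alternate true (suc k + suc k)) x)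
        ≡⟨ cong₂ (λ m y → act (alternate false m) y) (double-suc k) (rotation k x) ⟩
      r 1 ∘P (r 0 ∘P act (alternate false (k + k)) (act (alternate true (k + k)) (r 0 ∘P (r 1 ∘P x))))
        ≡⟨ cong (λ y → r 1 ∘P (r 0 ∘P y)) (unwind k _) ⟩
      r 1 ∘P (r 0 ∘P (r 0 ∘P (r 1 ∘P x)))     ≡⟨ cong (r 1 ∘P_) (square 0 (r 1 ∘P x)) ⟩
      r 1 ∘P (r 1 ∘P x)                       ≡⟨ square 1 x ⟩
      x ∎
      where open ≡-Reasoning

    -- By the full turn, (r₁r₂)^k is the inverse of (r₁r₂)^j, that is (r₂r₁)^j. Past half a turn
    -- this is the shorter word.
    reverse-rotation : ∀ {k j} → k + j ≡ suc n → ∀ x →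
      act (alternate true (k + k)) x ≡ act (alternate false (j + j)) x
    reverse-rotation {k} {j} eq x = begin
      act (alternate true (k + k)) x
        ≡⟨ unwind j _ ⟨
      act (alternate false (j + j)) (act (alternate true (j + j)) (act (alternate true (k + k)) x))
        ≡⟨ cong (act (alternate false (j + j))) turn ⟩
      act (alternate false (j + j)) x ∎
      where
      open ≡-Reasoning
      lemma : ∀ j k → j + j + (k + k) ≡ k + j + (k + j)
      lemma = solve-∀
      turn : act (alternate true (j + j)) (act (alternate true (k + k)) x) ≡ x
      turn = begin
        act (alternate true (j + j)) (act (alternate true (k + k)) x)
          ≡⟨ act-++ (alternate true (j + j)) _ x ⟨
        act (alternate true (j + j) ++ alternate true (k + k)) x
          ≡⟨ cong (λ w → act w x) (alternate-even-++ true j (k + k)) ⟨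
        act (alternate true (j + j + (k + k))) x
          ≡⟨ cong (λ m → act (alternate true m) x) (trans (lemma j k) (cong (λ m → m + m) eq)) ⟩
        act (alternate true (suc n + suc n)) x                            ≡⟨ full-turn x ⟩
        x ∎

    ρ = dihA₁ n ∘P dihA₂ n

    power : ∀ k x → powP ρ k ∘P x ≡ act (alternate true (k + k)) x
    power zero    x = ∘P-identityˡ x
    power (suc k) x = begin
      (ρ ∘P powP ρ k) ∘P x                              ≡⟨ ∘P-assoc ρ (powP ρ k) x ⟩
      ρ ∘P (powP ρ k ∘P x)                              ≡⟨ ∘P-assoc (r 0) (r 1) (powP ρ k ∘P x) ⟩
      r 0 ∘P (r 1 ∘P (powP ρ k ∘P x))
        ≡⟨ cong (λ y → r 0 ∘P (r 1 ∘P y)) (power k x) ⟩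
      act (alternate true (suc (suc (k + k)))) x
        ≡⟨ cong (λ m → act (alternate true m) x) (double-suc k) ⟨
      act (alternate true (suc k + suc k)) x ∎
      where open ≡-Reasoning

    ℓ-rotation : ∀ {k} → k + k ≤ suc n → ℓ (powP ρ k) ≡ k * (α + β)
    ℓ-rotation {k} k≤ = trans (cong ℓ (trans (sym (∘P-identityʳ (powP ρ k))) (power k idP)))
      (trans (ℓ-alternate true k≤) (wt-even true k))

    ℓ-reflection : ∀ {k} → suc (k + k) ≤ suc n → ℓ (powP ρ k ∘P dihA₁ n) ≡ k * (α + β) + α
    ℓ-reflection {k} k≤ = trans (cong ℓ eq) (trans (ℓ-alternate true k≤) (wt-odd-true k))
      where
      eq : powP ρ k ∘P dihA₁ n ≡ act (alternate true (suc (k + k))) idP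
      eq = trans (power k (r 0)) (trans (cong (act (alternate true (k + k))) (sym (∘P-identityʳ (r 0))))
        (trans (sym (act-++ (alternate true (k + k)) (0 ∷ []) idP))
          (cong (λ w → act w idP) (trans (sym (alternate-even-++ true k 1)) (cong (alternate true) (+-comm (k + k) 1))))))

    ℓ-reverse-rotation : ∀ {k j} → k + j ≡ suc n → j + j ≤ suc n → ℓ (powP ρ k) ≡ j * (α + β)
    ℓ-reverse-rotation {k} {j} eq j≤ =
      trans (cong ℓ (trans (sym (∘P-identityʳ (powP ρ k))) (trans (power k idP) (reverse-rotation {k} {j} eq idP))))
      (trans (ℓ-alternate false j≤) (wt-even false j))

    -- The rotation is (r₂r₁)^(j+1), and its last letter r₁ cancels against the reflection, leaving
    -- (r₂r₁)^j r₂.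
    ℓ-reverse-reflection : ∀ {k j} → k + suc j ≡ suc n → suc j + suc j ≤ suc n →
      ℓ (powP ρ k ∘P dihA₁ n) ≡ j * (α + β) + β
    ℓ-reverse-reflection {k} {j} eq j≤ = trans (cong ℓ eq′)
      (trans (ℓ-alternate false (≤-trans (n≤1+n _) (≤-trans (≤-reflexive (sym (double-suc j))) j≤))) (wt-odd-false j))
      where
      open ≡-Reasoning
      eq′ : powP ρ k ∘P dihA₁ n ≡ act (alternate false (suc (j + j))) idP
      eq′ = begin
        powP ρ k ∘P r 0                                                 ≡⟨ power k (r 0) ⟩
        act (alternate true (k + k)) (r 0)
          ≡⟨ reverse-rotation {k} {suc j} eq (r 0) ⟩
        act (alternate false (suc j + suc j)) (r 0)
          ≡⟨ cong (λ m → act (alternate false m) (r 0)) (trans (double-suc j) (+-comm 2 (j + j))) ⟩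
        act (alternate false (j + j + 2)) (r 0)
          ≡⟨ cong (λ w → act w (r 0)) (alternate-even-++ false j 2) ⟩
        act (alternate false (j + j) ++ 1 ∷ 0 ∷ []) (r 0)
          ≡⟨ act-++ (alternate false (j + j)) _ (r 0) ⟩
        act (alternate false (j + j)) (r 1 ∘P (r 0 ∘P r 0))
          ≡⟨ cong (λ y → act (alternate false (j + j)) (r 1 ∘P (r 0 ∘P y))) (∘P-identityʳ (r 0)) ⟨
        act (alternate false (j + j)) (r 1 ∘P (r 0 ∘P (r 0 ∘P idP)))
          ≡⟨ cong (λ y → act (alternate false (j + j)) (r 1 ∘P y)) (square 0 idP) ⟩
        act (alternate false (j + j)) (r 1 ∘P idP)
          ≡⟨ act-++ (alternate false (j + j)) (1 ∷ []) idP ⟨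
        act (alternate false (j + j) ++ 1 ∷ []) idP
          ≡⟨ cong (λ w → act w idP) (alternate-even-++ false j 1) ⟨
        act (alternate false (j + j + 1)) idP
          ≡⟨ cong (λ m → act (alternate false m) idP) (+-comm (j + j) 1) ⟩
        act (alternate false (suc (j + j))) idP ∎

    closedForm : ℕ → ℕ → Poly
    closedForm p m = (geo (X (α + β)) p *P (1P +P X α)) +P (geo (X (α + β)) m *P (X (α + β) +P X β))

    -- The cut is placed so that every alternating word chosen on either side has length at most n +
    -- 1, the range in which lengths are weights.
    UDih-geo : ∀ p m → suc n ≡ p + m → (∀ {k} → k < p → suc (k + k) ≤ suc n) → m + m ≤ suc n →
      UDih n ℓ ≈P closedForm p m
    UDih-geo p m N≡ low high =
      subst (λ N → Σ< N (λ k → X (rotations k) +P X (reflections k)) ≈P closedForm p m) (sym N≡)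
      (Σ<-dihedral X (λ _ → refl) X-+ rotations reflections α β p m
        (λ {k} k<p → ℓ-rotation {k} (<⇒≤ (low k<p)))
        (λ {k} k<p → ℓ-reflection {k} (low k<p))
        (λ {j} j<m → ℓ-reverse-rotation {p + (m ∸ suc j)} {suc j} (index j<m) (≤-trans (+-mono-≤ j<m j<m) high))
        (λ {j} j<m → ℓ-reverse-reflection {p + (m ∸ suc j)} {j} (index j<m) (≤-trans (+-mono-≤ j<m j<m) high)))
      where
      rotations reflections : ℕ → ℕ
      rotations k = ℓ (powP ρ k)
      reflections k = ℓ (powP ρ k ∘P dihA₁ n)
      index : ∀ {j} → j < m → p + (m ∸ suc j) + suc j ≡ suc n
      index {j} j<m = trans (+-assoc p (m ∸ suc j) (suc j)) (trans (cong (p +_) (m∸n+n≡m j<m)) (sym N≡))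

-- Evaluation of the five generating functions.

open import Data.Integer using (+_; -_)
open CosetWords
open Permutations using (triangle)
open QIntegers
open FoldingsOfA
open FoldingOfD
open Dihedral

2*n≡n+n : ∀ n → 2 * n ≡ n + n
2*n≡n+n n = cong (λ m → n + m) (+-identityʳ n)

length-select-true : ∀ n → length (select true (suc n)) ≡ suc (length (select false n))
length-select-true n = trans (cong length (select-true n)) (cong suc (length-map suc (select false n)))

length-select-false : ∀ n → length (select false (suc n)) ≡ length (select true n)
length-select-false n = trans (cong length (select-false n)) (length-map suc (select true n))

length-select-even : ∀ s m → length (select s (m + m)) ≡ m
length-select-even s     zero    = refl
length-select-even true  (suc m) = trans (cong (λ k → length (select true k)) (double-suc m))
  (trans (length-select-true (suc (m + m))) (cong suc (trans (length-select-false (m + m)) (length-select-even true m))))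
length-select-even false (suc m) = trans (cong (λ k → length (select false k)) (double-suc m))
  (trans (length-select-false (suc (m + m))) (trans (length-select-true (m + m)) (cong suc (length-select-even false m))))

length-select-odd-true : ∀ m → length (select true (suc (m + m))) ≡ suc m
length-select-odd-true m = trans (length-select-true (m + m)) (cong suc (length-select-even false m))

length-select-odd-false : ∀ m → length (select false (suc (m + m))) ≡ m
length-select-odd-false m = trans (length-select-false (m + m)) (length-select-even true m)

-- The right-hand side has the form of the weight of an alternating word of length 2m + 1 with α = β
-- = m.
triangle-odd : ∀ m → triangle (suc (m + m)) ≡ m * (m + m) + m
triangle-odd zero    = refl
triangle-odd (suc m) = trans (cong triangle (cong suc (cong suc (+-suc m m))))
  (trans (cong (λ t → suc (suc (m + m)) + (suc (m + m) + t)) (triangle-odd m)) (lemma m))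
  where
  lemma : ∀ m → suc (suc (m + m)) + (suc (m + m) + (m * (m + m) + m)) ≡ suc m * (suc m + suc m) + suc m
  lemma = solve-∀

triangle-even : ∀ m → triangle (suc (suc (m + m))) ≡ suc m * (suc m + m)
triangle-even m = trans (cong (λ t → suc (m + m) + t) (triangle-odd m)) (lemma m)
  where
  lemma : ∀ m → suc (m + m) + (m * (m + m) + m) ≡ suc m * (suc m + m)
  lemma = solve-∀

UDih-even : ∀ m (ℓ : Perm (suc (m + m)) → ℕ) → Words.IsLength _∘P_ idP (coxA (m + m)) ℓ →
  UDih (m + m) ℓ ≈P (qintPow m 2 *P qintPow m (suc (m + m)))
UDih-even m ℓ isLength = begin
  UDih (m + m) ℓ
    ≈⟨ UDih-geo (suc m) m refl (λ k<p → s≤s (+-mono-≤ (s≤s⁻¹ k<p) (s≤s⁻¹ k<p))) (n≤1+n _) ⟩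
  closedForm (suc m) m
    ≈⟨ P.+-cong (P.*-congʳ (geo-cong (suc m) (X-+ m m))) (P.*-cong (geo-cong m (X-+ m m)) (P.+-congʳ (X-+ m m))) ⟩
  (geo (X m *P X m) (suc m) *P (1P +P X m)) +P (geo (X m *P X m) m *P ((X m *P X m) +P X m))
    ≈⟨ dihedral-even (X m) m ⟩
  geo (X m) 2 *P geo (X m) (suc (m + m))
    ≈⟨ P.*-cong (qint-geo (+ 1) m 2) (qint-geo (+ 1) m (suc (m + m))) ⟨
  qintPow m 2 *P qintPow m (suc (m + m)) ∎
  where
  open import Relation.Binary.Reasoning.Setoid P.setoid
  total : ∀ s → Weights.wt m m (alternate s (suc (m + m))) ≡ triangle (suc (m + m))
  total true  = trans (AlternatingWeights.wt-odd-true m m m) (sym (triangle-odd m))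
  total false = trans (AlternatingWeights.wt-odd-false m m m) (sym (triangle-odd m))
  open DihedralLengths (m + m) m m (length-select-even true m) (length-select-even false m) total ℓ isLength

-- The `m` here is one less than in the theorem: n = 2m + 1, with m + 1 odd and m even indices. For
-- m = 0 the image of r₂ is the identity, each of the two permutations is listed twice, and
-- `qintPow 0 2` is the constant 2.
UDih-odd : ∀ m (ℓ : Perm (suc (suc (m + m))) → ℕ) → Words.IsLength _∘P_ idP (coxA (suc (m + m))) ℓ →
  UDih (suc (m + m)) ℓ ≈P (qintPow m 2 *P (qintPow (suc m) 2 *P qintPow (suc (m + m)) (suc m)))
UDih-odd m ℓ isLength = begin
  UDih (suc (m + m)) ℓ
    ≈⟨ UDih-geo (suc m) (suc m) (sym (double-suc m)) low (≤-reflexive (double-suc m)) ⟩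
  closedForm (suc m) (suc m)
    ≈⟨ dihedral-odd (X (suc m)) (X m) (X (suc m + m)) (geo (X (suc m + m)) (suc m)) (X-+ (suc m) m) ⟩
  geo (X m) 2 *P (geo (X (suc m)) 2 *P geo (X (suc m + m)) (suc m))
    ≈⟨ P.*-cong (qint-geo (+ 1) m 2) (P.*-cong (qint-geo (+ 1) (suc m) 2) (qint-geo (+ 1) (suc m + m) (suc m))) ⟨
  qintPow m 2 *P (qintPow (suc m) 2 *P qintPow (suc (m + m)) (suc m)) ∎
  where
  open import Relation.Binary.Reasoning.Setoid P.setoid
  total : ∀ s → Weights.wt m (suc m) (alternate s (suc (suc (m + m)))) ≡ triangle (suc (suc (m + m)))
  total s = trans (cong (λ k → Weights.wt m (suc m) (alternate s k)) (sym (double-suc m)))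
    (trans (AlternatingWeights.wt-even (suc m) m s (suc m)) (sym (triangle-even m)))
  low : ∀ {k} → k < suc m → suc (k + k) ≤ suc (suc (m + m))
  low k<p = m≤n⇒m≤1+n (s≤s (+-mono-≤ (s≤s⁻¹ k<p) (s≤s⁻¹ k<p)))
  open DihedralLengths (suc (m + m)) (suc m) m (length-select-odd-true m) (length-select-odd-false m) total ℓ isLength

theorem1p3 : (∀ (n : ℕ) → 1 ≤ n →
    ∀ (ℓ : Perm (suc (2 * n ∸ 1)) → ℕ) (L : List (Perm (suc (2 * n ∸ 1)))) →
    Words.IsLength _∘P_ idP (coxA (2 * n ∸ 1)) ℓ →
    Unique L →
    (∀ x → (x ∈ L) ⇔ Words.Gen _∘P_ idP (foldB-A-odd n) x) →
    Words.U _∘P_ idP ℓ L ≈P prodP (map [_]±q (fromTo 1 (2 * n))))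
    ×
    (∀ (n : ℕ) → 1 ≤ n →
    ∀ (ℓ : Perm (suc (2 * n)) → ℕ) (L : List (Perm (suc (2 * n)))) →
    Words.IsLength _∘P_ idP (coxA (2 * n)) ℓ →
    Unique L →
    (∀ x → (x ∈ L) ⇔ Words.Gen _∘P_ idP (foldB-A-even n) x) →
    Words.U _∘P_ idP ℓ L ≈P prodP (map [_]±q (fromTo 1 (suc (2 * n)))))
    ×
    (∀ (n : ℕ) → 2 ≤ n →
    ∀ (ℓ : SPerm (suc n) → ℕ) (L : List (SPerm (suc n))) →
    Words.IsLength _∘S_ idS (coxD n) ℓ →
    Unique L →
    (∀ x → (x ∈ L) ⇔ Words.Gen _∘S_ idS (foldB-D n) x) →
    Words.U _∘S_ idS ℓ L
    ≈P ([ 2 ]q *P ([ 3 ]-q *P ([ 4 ]q *P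
    prodP (map (λ k → [ suc (2 * k) ]q -P mono (+ 1) k) (fromTo 3 n))))))
    ×
    (∀ (m : ℕ) → 1 ≤ m →
    ∀ (ℓ : Perm (suc (2 * m)) → ℕ) →
    Words.IsLength _∘P_ idP (coxA (2 * m)) ℓ →
    UDih (2 * m) ℓ ≈P (qintPow m 2 *P qintPow m (suc (2 * m))))
    ×
    (∀ (m : ℕ) → 1 ≤ m →
    ∀ (ℓ : Perm (suc (2 * m ∸ 1)) → ℕ) →
    Words.IsLength _∘P_ idP (coxA (2 * m ∸ 1)) ℓ →
    UDih (2 * m ∸ 1) ℓ
    ≈P (qintPow (m ∸ 1) 2 *P (qintPow m 2 *P qintPow (2 * m ∸ 1) m)))
theorem1p3 = part₁ , part₂ , part₃ , part₄ , part₅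
  where
  q = X 1
  X-square : X 2 ≈P (q *P q)
  X-square = X-+ 1 1
  X-cube : X 3 ≈P (q *P (q *P q))
  X-cube = P.trans (X-+ 1 2) (P.*-congˡ {q} X-square)
  part₁ = λ n 1≤n ℓ L isLength L! L⇔Gen → P.trans (statistic-odd n 1≤n ℓ L isLength L! L⇔Gen)
    (P.trans (poincare-cong {y = q} {q} n X-square P.refl)
      (P.sym (subst (λ m → prodP (map [_]±q (fromTo 1 m)) ≈P poincare (q *P q) q n) (sym (2*n≡n+n n))
        (product-odd q [_]±q []±q-odd []±q-even n))))
  part₂ = λ n 1≤n ℓ L isLength L! L⇔Gen → P.trans (statistic-even n 1≤n ℓ L isLength L! L⇔Gen)
    (P.trans (poincare-cong n X-square X-cube)
      (P.sym (subst (λ m → prodP (map [_]±q (fromTo 1 (suc m))) ≈P poincare (q *P q) (q *P (q *P q)) n) (sym (2*n≡n+n n))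
        (product-even q [_]±q []±q-odd []±q-even n))))
  factor : ℕ → Poly
  factor k = [ suc (2 * k) ]q -P mono (+ 1) k
  factor≈ : ∀ k → factor k ≈P (geo q (suc (k + k)) +P (P.- pow q k))
  factor≈ k = P.+-cong
    (P.trans (qint-geo (+ 1) 1 (suc (2 * k))) (P.reflexive (cong (λ m → geo q (suc m)) (2*n≡n+n k))))
    (P.-‿cong (P.sym (P.trans (pow-X 1 k) (X-cong (*-identityˡ k)))))
  part₃ : ∀ (n : ℕ) → 2 ≤ n → ∀ (ℓ : SPerm (suc n) → ℕ) (L : List (SPerm (suc n))) →
    Words.IsLength _∘S_ idS (coxD n) ℓ → Unique L → (∀ x → (x ∈ L) ⇔ Words.Gen _∘S_ idS (foldB-D n) x) →
    Words.U _∘S_ idS ℓ L ≈P ([ 2 ]q *P ([ 3 ]-q *P ([ 4 ]q *P prodP (map factor (fromTo 3 n)))))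
  part₃ (suc (suc m)) (s≤s (s≤s z≤n)) ℓ L isLength L! L⇔Gen = begin
    Words.U _∘S_ idS ℓ L
      ≈⟨ EvenSigned.statistic (suc m) ℓ isLength L! L⇔Gen ⟩
    poincare q (X 2) (2 + m)
      ≈⟨ poincare-cong {q} {q} (2 + m) P.refl X-square ⟩
    poincare q (q *P q) (2 + m)                             ≈⟨ product-D q factor factor≈ m ⟨
    geo q 2 *P (geo (P.- q) 3 *P (geo q 4 *P prodP (map factor (fromTo 3 (2 + m)))))
      ≈⟨ P.*-cong {[ 2 ]q} {geo q 2} (qint-geo (+ 1) 1 2) (P.*-cong {[ 3 ]-q} {geo (P.- q) 3} three
           (P.*-congʳ {rest} {[ 4 ]q} {geo q 4} (qint-geo (+ 1) 1 4))) ⟨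
    [ 2 ]q *P ([ 3 ]-q *P ([ 4 ]q *P prodP (map factor (fromTo 3 (2 + m))))) ∎
    where
    open import Relation.Binary.Reasoning.Setoid P.setoid
    rest = prodP (map factor (fromTo 3 (2 + m)))
    three : [ 3 ]-q ≈P geo (P.- q) 3
    three = P.trans (qint-geo (- + 1) 1 3) (geo-cong 3 mono-neg)
  -- The size of the permutations contains `2 * m`, so the rewriting to `m + m` takes place in the
  -- whole statement, including the type of `ℓ`.
  part₄ = λ m 1≤m → subst (λ n → ∀ (ℓ : Perm (suc n) → ℕ) → Words.IsLength _∘P_ idP (coxA n) ℓ →
    UDih n ℓ ≈P (qintPow m 2 *P qintPow m (suc n))) (sym (2*n≡n+n m)) (UDih-even m)
  part₅ : ∀ (m : ℕ) → 1 ≤ m → ∀ (ℓ : Perm (suc (2 * m ∸ 1)) → ℕ) →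
    Words.IsLength _∘P_ idP (coxA (2 * m ∸ 1)) ℓ →
    UDih (2 * m ∸ 1) ℓ ≈P (qintPow (m ∸ 1) 2 *P (qintPow m 2 *P qintPow (2 * m ∸ 1) m))
  part₅ (suc m) _ = subst (λ n → ∀ (ℓ : Perm (suc n) → ℕ) → Words.IsLength _∘P_ idP (coxA n) ℓ →
    UDih n ℓ ≈P (qintPow m 2 *P (qintPow (suc m) 2 *P qintPow n (suc m))))
    (sym (trans (cong (λ k → m + k) (+-identityʳ (suc m))) (+-suc m m))) (UDih-odd m)
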